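{- For integers $n\ge1$ and $k\ge0$, let $$\gamma_{n,k}(\mathbf{x}):=\sum_{D\in\mathcal H_{n,k}}s_D(\mathbf{x}),$$ where $s_D(\mathbf{x})$ is the skew Schur function of shape $D$. Then for all $n\ge1$, $$Q_n(\mathbf{x},t)=\sum_{k=0}^{\lfloor\frac{n-1}{2}\rfloor}\gamma_{n,k}(\mathbf{x})\,t^k(1+t)^{n-1-2k}.$$ Consequently the polynomial $Q_n(\mathbf{x},t)$ is Schur-$\gamma$-positive.
   Context: Let $\mathbf{x}=(x_1,x_2,\dots)$, let $\Lambda$ be the $\mathbb{R}$-algebra of symmetric functions in $\mathbf{x}$, let $h_n(\mathbf{x})$ be the complete homogeneous symmetric function of degree $n$, and let $H(z):=\sum_{n\ge0}h_n(\mathbf{x})z^n$. The polynomials $Q_n(\mathbf{x},t)\in\Lambda[t]$ are defined by $$\sum_{n\ge0}Q_n(\mathbf{x},t)z^n:=\frac{(1-t)H(z)}{H(tz)-tH(z)}.$$ A skew hook is a connected skew diagram (English notation, considered up to translation) containing no $2\times2$ square. $\mathcal H_{n,k}$ is the set of skew hooks of size $n$ (i.e. with $n$ cells) for which $k$ columns have size $2$ and the remaining $n-2k$ columns, including the last (rightmost) column, have size $1$. A symmetric function is Schur-positive if its expansion in the basis of Schur functions has nonnegative coefficients. A polynomial $A(t)\in\Lambda[t]$ is Schur-$\gamma$-positive if for some $d$ there exist Schur-positive $\gamma_0,\dots,\gamma_{\lfloor d/2\rfloor}\in\Lambda$ such that $A(t)=\sum_{k=0}^{\lfloor d/2\rfloor}\gamma_kt^k(1+t)^{d-2k}$.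 -}

module Defs where

open import Algebra.Bundles using (CommutativeMonoid; CommutativeRing)
open import Algebra.Bundles.Raw using (RawRing)
import Algebra.Definitions.RawSemiring as RawSemiringOps
import Algebra.Properties.CommutativeSemigroup as CommutativeSemigroup
import Algebra.Properties.Group as GroupProperties
open import Data.Bool.Base using (if_then_else_)
open import Data.List.Base
  using (List; []; _∷_; [_]; _∷ʳ_; map; foldr; filter; length; upTo; zip;
         concatMap; cartesianProductWith; last)
open import Data.List.Membership.Propositional using (_∈_)
import Data.List.Membership.DecPropositional as DecMembership
open import Data.List.Properties using () renaming (≡-dec to List-≡-dec)
open import Data.List.Relation.Binary.Permutation.Propositional using (_↭_)
open import Data.List.Relation.Unary.All using (All; all?)
open import Data.List.Relation.Unary.Any using (Any; any?; here; there)
open import Data.List.Relation.Unary.Linked using (Linked; linked?)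
open import Data.Maybe.Base using (just)
import Data.Maybe.Properties as Maybe
open import Data.Nat.Base as ℕ using (ℕ; zero; suc; _∸_; _≡ᵇ_; ⌊_/2⌋)
import Data.Nat.ListAction as ℕ
import Data.Nat.Properties as ℕ
open import Data.Product.Base using (Σ; ∃; ∃-syntax; _×_; _,_; proj₁; proj₂)
import Data.Product.Properties as Product
open import Data.Rational.Base as ℚ using (ℚ; 0ℚ; 1ℚ; ½)
import Data.Rational.Properties as ℚ
open import Data.Sum.Base using (_⊎_; inj₁; inj₂)
open import Function.Base using (_∘_)
open import Level using (0ℓ; _⊔_)
open import Relation.Binary.Core using (Rel)
open import Relation.Binary.Construct.Closure.ReflexiveTransitive as Star
  using (Star; _◅_; _◅◅_)
open import Relation.Binary.Definitions using (Decidable; DecidableEquality)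
open import Relation.Binary.PropositionalEquality
  using (_≡_; refl; sym; trans; cong; cong₂; subst; module ≡-Reasoning)
open import Relation.Nullary using (Dec; ¬_; ¬?)
open import Relation.Nullary.Decidable using (map′; _×-dec_; _⊎-dec_; _→-dec_)

-- Rational Cauchy sequences modulo null sequences
module Reals where

  open import Data.Rational.Base using (_+_; _*_; -_; _-_; ∣_∣; _<_; _≤_)

  Eventually : (ℕ → Set) → Set
  Eventually P = ∃[ N ] ∀ n → N ℕ.≤ n → P n

  IsCauchy : (ℕ → ℚ) → Set
  IsCauchy x = ∀ ε → 0ℚ < ε →
    ∃[ N ] ∀ m n → N ℕ.≤ m → N ℕ.≤ n → ∣ x m - x n ∣ < ε

  record ℝ : Set where
    constructor mkℝ
    field
      seq    : ℕ → ℚ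
      cauchy : IsCauchy seq

  open ℝ public

  infix 4 _≈ᴿ_ _≤ᴿ_

  _≈ᴿ_ : ℝ → ℝ → Set
  x ≈ᴿ y = ∀ ε → 0ℚ < ε → Eventually λ n → ∣ seq x n - seq y n ∣ < ε

  _≤ᴿ_ : ℝ → ℝ → Set
  x ≤ᴿ y = ∀ ε → 0ℚ < ε → Eventually λ n → seq x n ≤ seq y n + ε

  private

    both : ∀ {P Q R : ℕ → Set} → (∀ {n} → P n → Q n → R n) →
           Eventually P → Eventually Q → Eventually R
    both f (M , p) (N , q) = M ℕ.⊔ N , λ n h →
      f (p n (ℕ.m⊔n≤o⇒m≤o M N h)) (q n (ℕ.m⊔n≤o⇒n≤o M N h))

    half : ∀ {ε} → 0ℚ < ε → 0ℚ < ½ * ε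
    half {ε} p = subst (_< ½ * ε) (ℚ.*-zeroʳ ½) (ℚ.*-monoʳ-<-pos ½ p)

    halves : ∀ ε → ½ * ε + ½ * ε ≡ ε
    halves ε = trans (sym (ℚ.*-distribʳ-+ ε ½ ½)) (ℚ.*-identityˡ ε)

    module Identities where

      open ≡-Reasoning

      neg-sub : ∀ a b → - (a - b) ≡ b - a
      neg-sub a b = begin
        - (a - b)     ≡⟨ ℚ.neg-distrib-+ a (- b) ⟩
        - a + - - b   ≡⟨ cong (- a +_) (GroupProperties.⁻¹-involutive ℚ.+-0-group b) ⟩
        - a + b       ≡⟨ ℚ.+-comm (- a) b ⟩
        b - a         ∎

      cancel : ∀ a b → b + (a - b) ≡ a
      cancel a b = begin
        b + (a - b)   ≡⟨ ℚ.+-comm b (a - b) ⟩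
        (a - b) + b   ≡⟨ ℚ.+-assoc a (- b) b ⟩
        a + (- b + b) ≡⟨ cong (a +_) (ℚ.+-inverseˡ b) ⟩
        a + 0ℚ        ≡⟨ ℚ.+-identityʳ a ⟩
        a             ∎

      telescope : ∀ a b c → (a - b) + (b - c) ≡ a - c
      telescope a b c = begin
        (a - b) + (b - c)   ≡⟨ ℚ.+-assoc (a - b) b (- c) ⟨
        ((a - b) + b) - c   ≡⟨ cong (_- c) (ℚ.+-comm (a - b) b) ⟩
        (b + (a - b)) - c   ≡⟨ cong (_- c) (cancel a b) ⟩
        a - c               ∎

      sub-+ : ∀ a b c d → (a - c) + (b - d) ≡ (a + b) - (c + d)
      sub-+ a b c d = begin
        (a - c) + (b - d)       ≡⟨ interchange a (- c) b (- d) ⟩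
        (a + b) + (- c + - d)   ≡⟨ cong (a + b +_) (ℚ.neg-distrib-+ c d) ⟨
        (a + b) - (c + d)       ∎
        where open CommutativeSemigroup
                (CommutativeMonoid.commutativeSemigroup ℚ.+-0-commutativeMonoid)

      mul-sub : ∀ a b c → a * (b - c) ≡ a * b - a * c
      mul-sub a b c = trans (ℚ.*-distribˡ-+ a b (- c))
        (cong (a * b +_) (sym (ℚ.neg-distribʳ-* a c)))

      sub-* : ∀ a b c d → a * (b - d) + d * (a - c) ≡ a * b - c * d
      sub-* a b c d = begin
        a * (b - d) + d * (a - c)           ≡⟨ cong₂ _+_ (mul-sub a b d) (mul-sub d a c) ⟩
        (a * b - a * d) + (d * a - d * c)   ≡⟨ cong (a * b - a * d +_)
                                                 (cong₂ _-_ (ℚ.*-comm d a) (ℚ.*-comm d c)) ⟩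
        (a * b - a * d) + (a * d - c * d)   ≡⟨ telescope (a * b) (a * d) (c * d) ⟩
        a * b - c * d                       ∎

    open Identities

    dist-refl : ∀ {a b ε} → a ≡ b → 0ℚ < ε → ∣ a - b ∣ < ε
    dist-refl {a} {ε = ε} refl p = subst (λ q → ∣ q ∣ < ε) (sym (ℚ.+-inverseʳ a)) p

    dist-sym : ∀ {a b ε} → ∣ a - b ∣ < ε → ∣ b - a ∣ < ε
    dist-sym {a} {b} {ε} =
      subst (_< ε) (trans (sym (ℚ.∣-p∣≡∣p∣ (a - b)))
        (cong ∣_∣ (neg-sub a b)))

    sum-small : ∀ {u v w ε} → u + v ≡ w → ∣ u ∣ < ½ * ε → ∣ v ∣ < ½ * ε → ∣ w ∣ < ε
    sum-small {u} {v} {ε = ε} refl p q = ℚ.≤-<-trans (ℚ.∣p+q∣≤∣p∣+∣q∣ u v)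
      (subst (∣ u ∣ + ∣ v ∣ <_) (halves ε) (ℚ.+-mono-< p q))

    dist-trans : ∀ {a b c ε} → ∣ a - b ∣ < ½ * ε → ∣ b - c ∣ < ½ * ε → ∣ a - c ∣ < ε
    dist-trans {a} {b} {c} = sum-small (telescope a b c)

    dist-+ : ∀ {a b a′ b′ ε} → ∣ a - a′ ∣ < ½ * ε → ∣ b - b′ ∣ < ½ * ε →
             ∣ (a + b) - (a′ + b′) ∣ < ε
    dist-+ {a} {b} {a′} {b′} = sum-small (sub-+ a b a′ b′)

    dist-neg : ∀ {a b ε} → ∣ a - b ∣ < ε → ∣ - a - - b ∣ < ε
    dist-neg {a} {b} {ε} p = subst (λ q → ∣ q ∣ < ε)
      (ℚ.neg-distrib-+ a (- b)) (subst (_< ε) (sym (ℚ.∣-p∣≡∣p∣ (a - b))) p)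

    scaled : ∀ K → 0ℚ < K → ∀ ε → 0ℚ < ε → ∃[ δ ] 0ℚ < δ × K * δ ≡ ε
    scaled K 0<K ε 0<ε = r * ε , subst (_< r * ε) (ℚ.*-zeroʳ r) (ℚ.*-monoʳ-<-pos r {{r>0}} 0<ε) ,
      trans (sym (ℚ.*-assoc K r ε)) (trans (cong (_* ε) (ℚ.*-inverseʳ K)) (ℚ.*-identityˡ ε))
      where
      instance
        K>0 = ℚ.positive 0<K
        K≢0 = ℚ.pos⇒nonZero K
      r = ℚ.1/ K
      r>0 = ℚ.1/pos⇒pos K

    term : ∀ {K δ η} a c → 0ℚ < K → K * δ ≡ η → ∣ a ∣ ≤ K → ∣ c ∣ < δ → ∣ a * c ∣ < η
    term {K} {δ} a c 0<K refl p q = subst (_< K * δ) (sym (ℚ.∣p*q∣≡∣p∣*∣q∣ a c))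
      (ℚ.≤-<-trans (ℚ.*-monoʳ-≤-nonNeg ∣ c ∣ {{ℚ.∣-∣-nonNeg c}} p)
                   (ℚ.*-monoʳ-<-pos K {{ℚ.positive 0<K}} q))

    dist-* : ∀ {K δ ε a b a′ b′} → 0ℚ < K → K * δ ≡ ½ * ε → ∣ a ∣ ≤ K → ∣ b′ ∣ ≤ K →
             ∣ a - a′ ∣ < δ → ∣ b - b′ ∣ < δ → ∣ a * b - a′ * b′ ∣ < ε
    dist-* {a = a} {b} {a′} {b′} 0<K e p q r s = sum-small
      (sub-* a b a′ b′)
      (term a (b - b′) 0<K e p s) (term b′ (a - a′) 0<K e q r)

    bounded : ∀ x → ∃[ K ] 0ℚ < K × Eventually λ n → ∣ seq x n ∣ ≤ K
    bounded x with N , h ← cauchy x 1ℚ (ℚ.positive⁻¹ 1ℚ) =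
      ∣ a ∣ + 1ℚ , ℚ.+-mono-≤-< (ℚ.0≤∣p∣ a) (ℚ.positive⁻¹ 1ℚ) , N , λ n N≤n → begin
        ∣ seq x n ∣           ≡⟨ cong ∣_∣ (sym (cancel (seq x n) a)) ⟩
        ∣ a + (seq x n - a) ∣ ≤⟨ ℚ.∣p+q∣≤∣p∣+∣q∣ a (seq x n - a) ⟩
        ∣ a ∣ + ∣ seq x n - a ∣ ≤⟨ ℚ.+-monoʳ-≤ ∣ a ∣ (ℚ.<⇒≤ (h n N N≤n ℕ.≤-refl)) ⟩
        ∣ a ∣ + 1ℚ            ∎
      where
      open ℚ.≤-Reasoning
      a = seq x N

    commonBound : ∀ x y → ∃[ K ] 0ℚ < K ×
                  Eventually λ n → ∣ seq x n ∣ ≤ K × ∣ seq y n ∣ ≤ K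
    commonBound x y with K , 0<K , p ← bounded x | L , 0<L , q ← bounded y =
      K + L , ℚ.+-mono-< {0ℚ} {K} {0ℚ} {L} 0<K 0<L , both
        (λ u v → ℚ.≤-trans u (subst (_≤ K + L) (ℚ.+-identityʳ K) (ℚ.+-monoʳ-≤ K (ℚ.<⇒≤ 0<L))) ,
                 ℚ.≤-trans v (subst (_≤ K + L) (ℚ.+-identityˡ L) (ℚ.+-monoˡ-≤ L (ℚ.<⇒≤ 0<K))))
        p q

    pointwise : ∀ {x y} → (∀ n → seq x n ≡ seq y n) → x ≈ᴿ y
    pointwise h ε 0<ε = 0 , λ n _ → dist-refl (h n) 0<ε

  fromℚ : ℚ → ℝ
  fromℚ q = mkℝ (λ _ → q) λ ε 0<ε → 0 , λ _ _ _ _ → dist-refl {q} refl 0<ε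

  infixl 6 _+ᴿ_
  infixl 7 _*ᴿ_
  infix  8 -ᴿ_

  _+ᴿ_ : ℝ → ℝ → ℝ
  x +ᴿ y = mkℝ (λ n → seq x n + seq y n) λ ε 0<ε →
    let M , p = cauchy x (½ * ε) (half 0<ε)
        N , q = cauchy y (½ * ε) (half 0<ε)
    in M ℕ.⊔ N , λ m n h k →
      dist-+ {seq x m} {seq y m} {seq x n} {seq y n}
        (p m n (ℕ.m⊔n≤o⇒m≤o M N h) (ℕ.m⊔n≤o⇒m≤o M N k))
        (q m n (ℕ.m⊔n≤o⇒n≤o M N h) (ℕ.m⊔n≤o⇒n≤o M N k))

  -ᴿ_ : ℝ → ℝ
  -ᴿ x = mkℝ (λ n → - seq x n) λ ε 0<ε →
    let N , p = cauchy x ε 0<ε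
    in N , λ m n h k → dist-neg {seq x m} {seq x n} (p m n h k)

  _*ᴿ_ : ℝ → ℝ → ℝ
  x *ᴿ y = mkℝ (λ n → seq x n * seq y n) λ ε 0<ε →
    let K , 0<K , B , b = commonBound x y
        δ , 0<δ , e = scaled K 0<K (½ * ε) (half 0<ε)
        M , p = cauchy x δ 0<δ
        N , q = cauchy y δ 0<δ
        M⊔N≤ = λ {n} (h : B ℕ.⊔ (M ℕ.⊔ N) ℕ.≤ n) → ℕ.m⊔n≤o⇒n≤o B (M ℕ.⊔ N) h
        B≤ = λ {n} (h : B ℕ.⊔ (M ℕ.⊔ N) ℕ.≤ n) → ℕ.m⊔n≤o⇒m≤o B (M ℕ.⊔ N) h
    in B ℕ.⊔ (M ℕ.⊔ N) , λ m n h k →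
      dist-* {a = seq x m} {seq y m} {seq x n} {seq y n} 0<K e
        (proj₁ (b m (B≤ h))) (proj₂ (b n (B≤ k)))
        (p m n (ℕ.m⊔n≤o⇒m≤o M N (M⊔N≤ h)) (ℕ.m⊔n≤o⇒m≤o M N (M⊔N≤ k)))
        (q m n (ℕ.m⊔n≤o⇒n≤o M N (M⊔N≤ h)) (ℕ.m⊔n≤o⇒n≤o M N (M⊔N≤ k)))

  ℝ-commutativeRing : CommutativeRing 0ℓ 0ℓ
  ℝ-commutativeRing = record
    { Carrier = ℝ
    ; _≈_ = _≈ᴿ_
    ; _+_ = _+ᴿ_
    ; _*_ = _*ᴿ_
    ; -_  = -ᴿ_
    ; 0#  = fromℚ 0ℚ
    ; 1#  = fromℚ 1ℚ
    ; isCommutativeRing = record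
      { isRing = record
        { +-isAbelianGroup = record
          { isGroup = record
            { isMonoid = record
              { isSemigroup = record
                { isMagma = record
                  { isEquivalence = record
                    { refl  = λ {x} → pointwise {x} {x} λ _ → refl
                    ; sym   = λ {x} {y} p ε 0<ε → let N , h = p ε 0<ε in
                              N , λ n k → dist-sym {seq x n} {seq y n} (h n k)
                    ; trans = λ {x} {y} {z} p q ε 0<ε → both
                              (λ {n} → dist-trans {seq x n} {seq y n} {seq z n})
                              (p (½ * ε) (half 0<ε)) (q (½ * ε) (half 0<ε))
                    }
                  ; ∙-cong = λ {x} {x′} {y} {y′} p q ε 0<ε → both
                      (λ {n} → dist-+ {seq x n} {seq y n} {seq x′ n} {seq y′ n})
                      (p (½ * ε) (half 0<ε)) (q (½ * ε) (half 0<ε))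
                  }
                ; assoc = λ x y z → pointwise {(x +ᴿ y) +ᴿ z} {x +ᴿ (y +ᴿ z)}
                    λ n → ℚ.+-assoc (seq x n) (seq y n) (seq z n)
                }
              ; identity = (λ x → pointwise {fromℚ 0ℚ +ᴿ x} {x} λ n → ℚ.+-identityˡ (seq x n))
                         , (λ x → pointwise {x +ᴿ fromℚ 0ℚ} {x} λ n → ℚ.+-identityʳ (seq x n))
              }
            ; inverse = (λ x → pointwise { -ᴿ x +ᴿ x} {fromℚ 0ℚ} λ n → ℚ.+-inverseˡ (seq x n))
                      , (λ x → pointwise {x +ᴿ -ᴿ x} {fromℚ 0ℚ} λ n → ℚ.+-inverseʳ (seq x n))
            ; ⁻¹-cong = λ {x} {y} p ε 0<ε → let N , h = p ε 0<ε in
                        N , λ n k → dist-neg {seq x n} {seq y n} (h n k)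
            }
          ; comm = λ x y → pointwise {x +ᴿ y} {y +ᴿ x} λ n → ℚ.+-comm (seq x n) (seq y n)
          }
        ; *-cong = λ {x} {x′} {y} {y′} p q ε 0<ε →
            let K , 0<K , b = commonBound x y′
                δ , 0<δ , e = scaled K 0<K (½ * ε) (half 0<ε)
            in both (λ {n} (u , v) (r , s) →
                      dist-* {a = seq x n} {seq y n} {seq x′ n} {seq y′ n} 0<K e u v r s)
                 b (both _,_ (p δ 0<δ) (q δ 0<δ))
        ; *-assoc = λ x y z → pointwise {(x *ᴿ y) *ᴿ z} {x *ᴿ (y *ᴿ z)}
            λ n → ℚ.*-assoc (seq x n) (seq y n) (seq z n)
        ; *-identity = (λ x → pointwise {fromℚ 1ℚ *ᴿ x} {x} λ n → ℚ.*-identityˡ (seq x n))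
                     , (λ x → pointwise {x *ᴿ fromℚ 1ℚ} {x} λ n → ℚ.*-identityʳ (seq x n))
        ; distrib = (λ x y z → pointwise {x *ᴿ (y +ᴿ z)} {x *ᴿ y +ᴿ x *ᴿ z}
                      λ n → ℚ.*-distribˡ-+ (seq x n) (seq y n) (seq z n))
                  , (λ x y z → pointwise {(y +ᴿ z) *ᴿ x} {y *ᴿ x +ᴿ z *ᴿ x}
                      λ n → ℚ.*-distribʳ-+ (seq x n) (seq y n) (seq z n))
        }
      ; *-comm = λ x y → pointwise {x *ᴿ y} {y *ᴿ x} λ n → ℚ.*-comm (seq x n) (seq y n)
      }
    }

module Sums {c ℓ} (R : RawRing c ℓ) where

  open RawRing R

  ∑ : ∀ {a} {A : Set a} → List A → (A → Carrier) → Carrier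
  ∑ xs f = foldr _+_ 0# (map f xs)

  ∑≤ : ℕ → (ℕ → Carrier) → Carrier
  ∑≤ n = ∑ (upTo (suc n))

-- A polynomial is its list of coefficients, constant term first; trailing
-- zeros are allowed and ignored by the equality.
module Polynomials {c ℓ} (R : RawRing c ℓ) where

  open RawRing R

  Polynomial : Set c
  Polynomial = List Carrier

  coeff : Polynomial → ℕ → Carrier
  coeff []      _       = 0#
  coeff (a ∷ _) zero    = a
  coeff (_ ∷ p) (suc i) = coeff p i

  addᴾ : Polynomial → Polynomial → Polynomial
  addᴾ []      q       = q
  addᴾ (a ∷ p) []      = a ∷ p
  addᴾ (a ∷ p) (b ∷ q) = (a + b) ∷ addᴾ p q

  mulᴾ : Polynomial → Polynomial → Polynomial
  mulᴾ []      q = []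
  mulᴾ (a ∷ p) q = addᴾ (map (a *_) q) (0# ∷ mulᴾ p q)

  polynomialRing : RawRing c ℓ
  polynomialRing = record
    { Carrier = Polynomial
    ; _≈_ = λ p q → ∀ i → coeff p i ≈ coeff q i
    ; _+_ = addᴾ
    ; _*_ = mulᴾ
    ; -_  = map -_
    ; 0#  = []
    ; 1#  = [ 1# ]
    }

  const : Carrier → Polynomial
  const a = [ a ]

  indeterminate : Polynomial
  indeterminate = 0# ∷ 1# ∷ []

module PowerSeries {c ℓ} (R : RawRing c ℓ) where

  open RawRing R
  open Sums R
  open RawSemiringOps rawSemiring using (_^_)

  constant : Carrier → ℕ → Carrier
  constant a zero    = a
  constant a (suc _) = 0#

  powerSeriesRing : RawRing c ℓ
  powerSeriesRing = record
    { Carrier = ℕ → Carrier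
    ; _≈_ = λ f g → ∀ n → f n ≈ g n
    ; _+_ = λ f g n → f n + g n
    ; _*_ = λ f g n → ∑≤ n λ i → f i * g (n ∸ i)
    ; -_  = λ f n → - f n
    ; 0#  = λ _ → 0#
    ; 1#  = constant 1#
    }

  -- F(z) ↦ F(az)
  rescale : Carrier → (ℕ → Carrier) → ℕ → Carrier
  rescale a f n = a ^ n * f n

-- f (α₁ ∷ … ∷ αₘ ∷ []) is the coefficient of x₁^α₁ ⋯ xₘ^αₘ in the power
-- series f(x₁, …, xₘ, 0, 0, …).  An arbitrary f is thus a family of power
-- series, one for each m; it is a single series in x₁, x₂, … when f ignores
-- trailing zeros, which is demanded in IsSymmetricFunction below.
module MultivariateSeries {c ℓ} (R : RawRing c ℓ) where

  open RawRing R
  open Sums R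

  Series : Set c
  Series = List ℕ → Carrier

  mulˢ : Series → Series → Series
  mulˢ f g []      = f [] * g []
  mulˢ f g (a ∷ α) = ∑≤ a λ i → mulˢ (f ∘ (i ∷_)) (g ∘ (a ∸ i ∷_)) α

  completeHomogeneous : ℕ → Series
  completeHomogeneous n α = if ℕ.sum α ≡ᵇ n then 1# else 0#

  seriesRing : RawRing c ℓ
  seriesRing = record
    { Carrier = Series
    ; _≈_ = λ f g → ∀ α → f α ≈ g α
    ; _+_ = λ f g α → f α + g α
    ; _*_ = mulˢ
    ; -_  = λ f α → - f α
    ; 0#  = λ _ → 0#
    ; 1#  = completeHomogeneous 0
    }

  scale : Carrier → Series → Series
  scale a f α = a * f α

  record IsSymmetricFunction (f : Series) : Set (c ⊔ ℓ) where
    field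
      trailing-zero : ∀ α → f (α ∷ʳ 0) ≈ f α
      symmetric     : ∀ {α β} → α ↭ β → f α ≈ f β
      bounded       : ∃[ d ] ∀ α → d ℕ.< ℕ.sum α → f α ≈ 0#

module Reachability {a r} {A : Set a} {R : Rel A r}
                    (_≟_ : DecidableEquality A) (R? : Decidable R) where

  -- paths whose interior vertices lie in a given list
  Via : List A → Rel A (a ⊔ r)
  Via []       x y = x ≡ y ⊎ R x y
  Via (v ∷ vs) x y = Via vs x y ⊎ (Via vs x v × Via vs v y)

  via? : ∀ vs → Decidable (Via vs)
  via? []       x y = (x ≟ y) ⊎-dec R? x y
  via? (v ∷ vs) x y = via? vs x y ⊎-dec (via? vs x v ×-dec via? vs v y)

  via⇒star : ∀ vs {x y} → Via vs x y → Star R x y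
  via⇒star []       (inj₁ refl)    = Star.ε
  via⇒star []       (inj₂ s)       = s ◅ Star.ε
  via⇒star (v ∷ vs) (inj₁ p)       = via⇒star vs p
  via⇒star (v ∷ vs) (inj₂ (p , q)) = via⇒star vs p ◅◅ via⇒star vs q

  edge : ∀ vs {x y} → x ≡ y ⊎ R x y → Via vs x y
  edge []       e = e
  edge (v ∷ vs) e = inj₁ (edge vs e)

  join : ∀ {vs u x y} → u ∈ vs → Via vs x u → Via vs u y → Via vs x y
  join (here refl) (inj₁ p)       (inj₁ q)       = inj₂ (p , q)
  join (here refl) (inj₁ p)       (inj₂ (_ , q)) = inj₂ (p , q)
  join (here refl) (inj₂ (p , _)) (inj₁ q)       = inj₂ (p , q)
  join (here refl) (inj₂ (p , _)) (inj₂ (_ , q)) = inj₂ (p , q)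
  join (there i)   (inj₁ p)       (inj₁ q)       = inj₁ (join i p q)
  join (there i)   (inj₁ p)       (inj₂ (q , s)) = inj₂ (join i p q , s)
  join (there i)   (inj₂ (p , q)) (inj₁ s)       = inj₂ (p , join i q s)
  join (there i)   (inj₂ (p , _)) (inj₂ (_ , s)) = inj₂ (p , s)

  star⇒via : ∀ {vs} → (∀ {x y} → R x y → y ∈ vs) → ∀ {x y} → Star R x y → Via vs x y
  star⇒via {vs} R⊆ Star.ε   = edge vs (inj₁ refl)
  star⇒via {vs} R⊆ (s ◅ ss) = join (R⊆ s) (edge vs (inj₂ s)) (star⇒via R⊆ ss)

  star? : ∀ vs → (∀ {x y} → R x y → y ∈ vs) → Decidable (Star R)
  star? vs R⊆ x y = map′ (via⇒star vs) (star⇒via R⊆) (via? vs x y)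

words : ∀ {a} {A : Set a} → List A → ℕ → List (List A)
words xs zero    = [ [] ]
words xs (suc n) = cartesianProductWith _∷_ xs (words xs n)

IsPartition : List ℕ → Set
IsPartition λs = Linked ℕ._≥_ λs × All (0 ℕ.<_) λs

isPartition? : ∀ λs → Dec (IsPartition λs)
isPartition? λs = linked? ℕ._≥?_ λs ×-dec all? (0 ℕ.<?_) λs

-- the partitions with at most N parts, all of size at most N
boxPartitions : ℕ → List (List ℕ)
boxPartitions N = filter isPartition? (concatMap (words (map suc (upTo N))) (upTo (suc N)))

part : List ℕ → ℕ → ℕ
part []       _       = 0
part (p ∷ _)  zero    = p
part (_ ∷ ps) (suc i) = part ps i

record SkewDiagram : Set where
  constructor _/_
  field
    outer inner : List ℕ

open SkewDiagram public

IsSkewDiagram : SkewDiagram → Set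
IsSkewDiagram (o / i) =
  IsPartition o × IsPartition i × All (λ r → part i r ℕ.≤ part o r) (upTo (length i))

isSkewDiagram? : ∀ D → Dec (IsSkewDiagram D)
isSkewDiagram? (o / i) =
  isPartition? o ×-dec isPartition? i ×-dec
  all? (λ r → part i r ℕ.≤? part o r) (upTo (length i))

-- (row , column), counted from 0, rows going down
Cell : Set
Cell = ℕ × ℕ

_≟ᶜ_ : DecidableEquality Cell
_≟ᶜ_ = Product.≡-dec ℕ._≟_ ℕ._≟_

open DecMembership _≟ᶜ_ using (_∈?_)

right below : Cell → Cell
right (r , c) = r , suc c
below (r , c) = suc r , c

cells : SkewDiagram → List Cell
cells (o / i) = concatMap
  (λ r → map (r ,_) (filter (part i r ℕ.≤?_) (upTo (part o r)))) (upTo (length o))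

-- Picks out of each class of translates of a connected diagram the one that
-- has cells in both row 0 and column 0.
Normalised : SkewDiagram → Set
Normalised D = Any (λ x → proj₁ x ≡ 0) (cells D) × Any (λ x → proj₂ x ≡ 0) (cells D)

normalised? : ∀ D → Dec (Normalised D)
normalised? D = any? (λ x → proj₁ x ℕ.≟ 0) (cells D) ×-dec any? (λ x → proj₂ x ℕ.≟ 0) (cells D)

Adjacent : Rel Cell 0ℓ
Adjacent x y = right x ≡ y ⊎ right y ≡ x ⊎ below x ≡ y ⊎ below y ≡ x

Step : SkewDiagram → Rel Cell 0ℓ
Step D x y = Adjacent x y × y ∈ cells D

step? : ∀ D → Decidable (Step D)
step? D x y =
  ((right x ≟ᶜ y) ⊎-dec (right y ≟ᶜ x) ⊎-dec (below x ≟ᶜ y) ⊎-dec (below y ≟ᶜ x))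
  ×-dec (y ∈? cells D)

Connected : SkewDiagram → Set
Connected D = All (λ x → All (λ y → Star (Step D) x y) (cells D)) (cells D)

connected? : ∀ D → Dec (Connected D)
connected? D = all? (λ x → all? (λ y → star? (cells D) proj₂ x y) (cells D)) (cells D)
  where open Reachability _≟ᶜ_ (step? D)

-- x is the top left cell of a 2 × 2 square
SquareAt : SkewDiagram → Cell → Set
SquareAt D x =
  x ∈ cells D × right x ∈ cells D × below x ∈ cells D × right (below x) ∈ cells D

squareAt? : ∀ D x → Dec (SquareAt D x)
squareAt? D x =
  (x ∈? cells D) ×-dec (right x ∈? cells D) ×-dec
  (below x ∈? cells D) ×-dec (right (below x) ∈? cells D)

IsSkewHook : SkewDiagram → Set
IsSkewHook D =
  IsSkewDiagram D × Normalised D × Connected D × All (λ x → ¬ SquareAt D x) (cells D)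

isSkewHook? : ∀ D → Dec (IsSkewHook D)
isSkewHook? D =
  isSkewDiagram? D ×-dec normalised? D ×-dec connected? D ×-dec
  all? (λ x → ¬? (squareAt? D x)) (cells D)

size : SkewDiagram → ℕ
size D = length (cells D)

-- In a normalised connected diagram the columns from 0 up to the length of the
-- first row of the outer partition are exactly the nonempty ones.
columnSizes : SkewDiagram → List ℕ
columnSizes D =
  map (λ c → length (filter (λ x → proj₂ x ℕ.≟ c) (cells D))) (upTo (part (outer D) 0))

count : ℕ → List ℕ → ℕ
count m ns = length (filter (m ℕ.≟_) ns)

InHooks : ℕ → ℕ → SkewDiagram → Set
InHooks n k D =
  IsSkewHook D × size D ≡ n ×
  count 2 (columnSizes D) ≡ k ×
  All (λ s → s ≡ 1 ⊎ s ≡ 2) (columnSizes D) ×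
  last (columnSizes D) ≡ just 1

inHooks? : ∀ n k D → Dec (InHooks n k D)
inHooks? n k D =
  isSkewHook? D ×-dec (size D ℕ.≟ n) ×-dec
  (count 2 (columnSizes D) ℕ.≟ k) ×-dec
  all? (λ s → (s ℕ.≟ 1) ⊎-dec (s ℕ.≟ 2)) (columnSizes D) ×-dec
  Maybe.≡-dec ℕ._≟_ (last (columnSizes D)) (just 1)

-- A connected diagram with n cells fits into an n × n box, so no element is
-- missed by restricting to diagrams inside it.
hooks : ℕ → ℕ → List SkewDiagram
hooks n k = filter (inHooks? n k) (cartesianProductWith _/_ (boxPartitions n) (boxPartitions n))

-- A tableau is its list of filled cells, where the entry i stands for the
-- variable with index i, counted from 0.
Tableau : Set
Tableau = List (Cell × ℕ)

IsSemistandard : Tableau → Set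
IsSemistandard T =
  All (λ (x , a) → All (λ (y , b) → (right x ≡ y → a ℕ.≤ b) × (below x ≡ y → a ℕ.< b)) T) T

isSemistandard? : ∀ T → Dec (IsSemistandard T)
isSemistandard? T = all? (λ (x , a) → all? (λ (y , b) →
  ((right x ≟ᶜ y) →-dec (a ℕ.≤? b)) ×-dec ((below x ≟ᶜ y) →-dec (a ℕ.<? b))) T) T

content : ℕ → List ℕ → List ℕ
content m w = map (λ i → count i w) (upTo m)

tableaux : SkewDiagram → List ℕ → List Tableau
tableaux D α =
  filter isSemistandard?
    (map (zip (cells D))
      (filter (λ w → List-≡-dec ℕ._≟_ (content (length α) w) α)
        (words (upTo (length α)) (size D))))

module SymmetricFunctions {c ℓ₁ ℓ₂} (K : RawRing c ℓ₁)
                          (_≤_ : Rel (RawRing.Carrier K) ℓ₂) where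

  open RawRing K using (Carrier; 0#; 1#)
  open RawSemiringOps (RawRing.rawSemiring K) using () renaming (_×_ to _·_)
  open MultivariateSeries K public
  open Polynomials seriesRing public
  open PowerSeries polynomialRing public

  module Ser  = RawRing seriesRing
  module Poly = RawRing polynomialRing
  module PS   = RawRing powerSeriesRing

  skewSchur : SkewDiagram → Series
  skewSchur D α = length (tableaux D α) · 1#

  schur : List ℕ → Series
  schur λs = skewSchur (λs / [])

  γ : ℕ → ℕ → Series
  γ n k = Sums.∑ seriesRing (hooks n k) skewSchur

  t : Polynomial
  t = indeterminate

  H : ℕ → Polynomial
  H n = const (completeHomogeneous n)

  -- Since H(tz) - tH(z) has constant term 1 - t, which is not invertible in
  -- Λ[t], the quotient is cleared of its denominator; as 1 - t is not a zero
  -- divisor, this determines Q.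
  record IsQ (Q : ℕ → Polynomial) : Set (c ⊔ ℓ₁) where
    field
      coefficients∈Λ      : ∀ n → All IsSymmetricFunction (Q n)
      generating-function :
        (Q PS.* (rescale t H PS.+ PS.- (constant t PS.* H)))
          PS.≈ ((PS.1# PS.+ PS.- constant t) PS.* H)

  γ-expansion : ℕ → (ℕ → Series) → Polynomial
  γ-expansion d g = Sums.∑≤ polynomialRing ⌊ d /2⌋ λ k →
    const (g k) Poly.* t ^ k Poly.* (Poly.1# Poly.+ t) ^ (d ∸ 2 ℕ.* k)
    where open RawSemiringOps Poly.rawSemiring using (_^_)

  -- f = ∑ c_λ s_λ with all c_λ ≥ 0; being a finite sum, it may be taken over
  -- the partitions in a large enough box.
  SchurPositive : Series → Set (c ⊔ ℓ₁ ⊔ ℓ₂)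
  SchurPositive f = IsSymmetricFunction f ×
    (∃[ N ] Σ (List ℕ → Carrier) λ coef →
      (∀ λs → 0# ≤ coef λs) ×
      f Ser.≈ Sums.∑ seriesRing (boxPartitions N) (λ λs → scale (coef λs) (schur λs)))

  SchurγPositive : Polynomial → Set (c ⊔ ℓ₁ ⊔ ℓ₂)
  SchurγPositive A = ∃[ d ] Σ (ℕ → Series) λ g →
    (∀ k → k ℕ.≤ ⌊ d /2⌋ → SchurPositive (g k)) × A Poly.≈ γ-expansion d g

open Reals public

open SymmetricFunctions (CommutativeRing.rawRing ℝ-commutativeRing) _≤ᴿ_ public
  using (Polynomial; γ; IsQ; γ-expansion; SchurγPositive; module Poly)

{-# OPTIONS --safe #-}
module Submission where

-- Read from its north-east end, a skew hook is a word in the steps "east" and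
-- "north", and its tableaux are the words whose descents are prescribed by these
-- steps.  The hooks with columns of size at most 2 and last column of size 1 are
-- the products of blocks "east" and "east, north".  Multiplying a ribbon by h_m
-- glues a row to its end in two ways.  Therefore, when blocks of the first kind
-- have weight 1 + t and those of the second kind weight t, the weighted sums of
-- ribbons satisfy Q (H(tz) - t H(z)) = (1 - t) H(z), by a telescoping sum.
-- This equation has only one solution.
--
-- The ribbon with given steps is the sum of s_λ over the standard tableaux with
-- the same descents: a product s_ν h_m is a sum over the ways to add m cells one
-- by one, and these chains split in the same two ways as the product of a ribbon
-- and h_m, according to whether the first new cell makes a descent.  Here the
-- Pieri rule follows by induction on the number of variables from the commutation
-- of adding and removing horizontal strips.  Finally, the γ's are symmetric
-- because they are integral combinations of the coefficients of Q.

open import Defs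
open import Algebra.Bundles using (CommutativeRing)
import Algebra.Definitions.RawSemiring as RawSemiringOps
import Algebra.Properties.CommutativeSemigroup as CommutativeSemigroupProperties
import Algebra.Properties.Monoid.Mult as Mult
import Algebra.Properties.Ring as RingProperties
import Algebra.Solver.CommutativeMonoid as CommutativeMonoidSolver
open import Data.Bool.Base using (Bool; true; false; if_then_else_; not; _∧_; T)
open import Data.Bool.Properties using (T?; T-∧; if-∧)
open import Data.Empty using (⊥; ⊥-elim)
open import Data.List.Base hiding (find; product)
open import Data.List.Membership.Propositional using (_∈_; find; lose)
open import Data.List.Membership.Propositional.Properties
  using (∈-map⁺; ∈-map⁻; ∈-filter⁺; ∈-filter⁻; ∈-concatMap⁺; ∈-concatMap⁻; ∈-upTo⁺; ∈-upTo⁻;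
         ∈-++⁺ˡ; ∈-++⁺ʳ; ∈-++⁻; ∈-cartesianProductWith⁺; ∈-cartesianProductWith⁻)
open import Data.List.Membership.Propositional.Properties.WithK using (unique∧set⇒bag)
open import Data.List.Properties
  using (++-assoc; ++-identityʳ; ∷-injective; ∷ʳ-injective; applyUpTo-∷ʳ; concatMap-cong; concatMap-map;
         filter-accept; filter-all; filter-none; filter-reject; filter-++; length-++; length-drop;
         length-filter; length-map; length-replicate; length-reverse; length-take; length-upTo;
         map-applyUpTo; map-cong; map-cong-local; map-id-local; map-++; map-∘; reverse-++;
         reverse-involutive; take++drop≡id; unfold-reverse)
  renaming (≡-dec to List-≡-dec)
open import Data.List.Relation.Binary.BagAndSetEquality using (∼bag⇒↭)
open import Data.List.Relation.Binary.Permutation.Propositional as ↭ using (_↭_; ↭-refl; ↭-sym)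
open import Data.List.Relation.Binary.Permutation.Propositional.Properties
  using (↭-reverse; ↭-length; All-resp-↭; filter-↭)
  renaming (++⁺ to ↭-++⁺)
open import Data.List.Relation.Unary.All as All using (All; []; _∷_)
import Data.List.Relation.Unary.All.Properties as All
open import Data.List.Relation.Unary.AllPairs using ([]; _∷_)
open import Data.List.Relation.Unary.Any using (here; there)
open import Data.List.Relation.Unary.Linked as Linked using (Linked; []; [-]; _∷_)
import Data.List.Relation.Unary.Linked.Properties as Linked
open import Data.List.Relation.Unary.Unique.Propositional using (Unique)
import Data.List.Relation.Unary.Unique.Propositional.Properties as Unique
open import Data.List.Reverse using (Reverse; []; _∶_∶ʳ_; reverseView)
open import Data.Maybe.Base using (just)
import Data.Maybe.Properties as Maybe
open import Data.Nat.Base as ℕ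
  using (ℕ; zero; suc; pred; _∸_; _≤_; _<_; z≤n; s≤s; _≤ᵇ_; _<ᵇ_; _≡ᵇ_; ⌊_/2⌋)
open import Data.Nat.Induction using (<-rec)
import Data.Nat.ListAction as ℕ
import Data.Nat.ListAction.Properties as ℕ
import Data.Nat.Properties as ℕ
open import Data.Nat.Tactic.RingSolver using (solve-∀)
open import Data.Product.Base using (_×_; _,_; proj₁; proj₂; ∃-syntax)
open import Data.Rational.Base as ℚ using (0ℚ; 1ℚ)
import Data.Rational.Properties as ℚ
open import Data.Sum.Base using (_⊎_; inj₁; inj₂)
open import Data.Unit.Base using (⊤; tt)
open import Function.Base using (_∘_; id)
open import Function.Bundles using (Equivalence; mk⇔)
open import Relation.Binary.Construct.Closure.ReflexiveTransitive as Star using (Star; _◅_; _◅◅_)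
open import Relation.Binary.Core using (Rel)
open import Relation.Binary.PropositionalEquality
  using (_≡_; refl; sym; trans; cong; cong₂; subst; subst₂; module ≡-Reasoning)
open import Relation.Nullary using (Dec; yes; no; ¬_; does)
open import Relation.Nullary.Decidable using (_×-dec_; does-⇔; dec-true; dec-false)
open import Relation.Unary using (Pred; Decidable)

-- Finite sums

-- The exponents in the theorem count blocks: n - 1 steps with k blocks of two steps leave n - 1 -
-- 2k blocks of one step, each of weight 1 + t.
--
-- Schur positivity includes membership in Λ, but the symmetry of skew Schur functions is never
-- derived combinatorially; they are handled as plain families of coefficients. Only the γ's have to
-- be symmetric, and they inherit this from `coefficients∈Λ`. Likewise the Schur expansion of a
-- ribbon uses no Littlewood-Richardson rule. A ribbon with top row of m + 1 cells is the ribbon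
-- below it times h_(m+1), minus a ribbon with one north step less, so products with h_m suffice.
--
-- Every identity between counts is a bijection between lists without duplicates. To give such lists
-- a uniform form, shapes have a number of rows fixed in advance, zero rows included; these are
-- dropped only when the final expansion is collected.

module _ {a b} {A : Set a} {B : Set b} where

  map-unique : ∀ {xs} (f : A → B) (g : B → A) → (∀ {x} → x ∈ xs → g (f x) ≡ x) →
               Unique xs → Unique (map f xs)
  map-unique {xs} f g gf xs! = Unique.map⁻ {f = g} (subst Unique
    (sym (trans (sym (map-∘ xs)) (map-id-local (All.tabulate gf)))) xs!)

  -- Without duplicates, having the same elements already makes two lists permutations of each
  -- other. All the counting arguments pass through this.
  bijection⇒↭ : ∀ {xs ys} (f : A → B) (g : B → A) → Unique xs → Unique ys →
                (∀ {x} → x ∈ xs → f x ∈ ys × g (f x) ≡ x) →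
                (∀ {y} → y ∈ ys → g y ∈ xs × f (g y) ≡ y) → map f xs ↭ ys
  bijection⇒↭ {xs} f g xs! ys! to from =
    ∼bag⇒↭ (unique∧set⇒bag (map-unique f g (proj₂ ∘ to) xs!) ys! (mk⇔
      (λ p → let x , x∈ , eq = ∈-map⁻ f p in subst (_∈ _) (sym eq) (proj₁ (to x∈)))
      (λ p → subst (_∈ _) (proj₂ (from p)) (∈-map⁺ f (proj₁ (from p))))))

module _ {a b} {A : Set a} {B : Set b} where

  concatMap-unique : ∀ {xs} {f : A → List B} → Unique xs → (∀ {x} → x ∈ xs → Unique (f x)) →
    (∀ {x x′ y} → x ∈ xs → x′ ∈ xs → y ∈ f x → y ∈ f x′ → x ≡ x′) → Unique (concatMap f xs)
  concatMap-unique {[]} _ _ _ = []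
  concatMap-unique {x ∷ xs} {f} (x∉ ∷ xs!) f! disjoint =
    Unique.++⁺ (f! (here refl))
      (concatMap-unique xs! (f! ∘ there) (λ p q → disjoint (there p) (there q)))
      λ (p , q) → let x′ , x′∈ , q′ = ∈-concatMap⁻′ q in
        All.lookup x∉ x′∈ (disjoint (here refl) (there x′∈) p q′)
    where
    ∈-concatMap⁻′ : ∀ {y} → y ∈ concatMap f xs → ∃[ z ] z ∈ xs × y ∈ f z
    ∈-concatMap⁻′ q = find (∈-concatMap⁻ f q)

module _ {a b} {A : Set a} {B : Set b} where

  pairs : List A → (A → List B) → List (A × B)
  pairs xs f = concatMap (λ x → map (x ,_) (f x)) xs

  ∈-pairs⁺ : ∀ {xs f x y} → x ∈ xs → y ∈ f x → (x , y) ∈ pairs xs f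
  ∈-pairs⁺ {f = f} x∈ y∈ =
    ∈-concatMap⁺ (λ x → map (x ,_) (f x)) (lose x∈ (∈-map⁺ _ y∈))

  ∈-pairs⁻ : ∀ xs f {x y} → (x , y) ∈ pairs xs f → x ∈ xs × y ∈ f x
  ∈-pairs⁻ xs f p with x , x∈ , q ← find (∈-concatMap⁻ (λ x → map (x ,_) (f x)) {xs} p)
                      with y , y∈ , refl ← ∈-map⁻ _ q = x∈ , y∈

  pairs-unique : ∀ {xs f} → Unique xs → (∀ x → Unique (f x)) → Unique (pairs xs f)
  pairs-unique xs! f! = concatMap-unique xs!
    (λ {x} _ → Unique.map⁺ (λ eq → cong proj₂ eq) (f! x))
    λ _ _ p q → let _ , _ , eq = ∈-map⁻ _ p ; _ , _ , eq′ = ∈-map⁻ _ q in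
      trans (sym (cong proj₁ eq)) (cong proj₁ eq′)

module FiniteSums {c ℓ} (K : CommutativeRing c ℓ) where

  open CommutativeRing K hiding (zero; refl; sym; trans) public
  open CommutativeRing K using () renaming (refl to ≈-refl; sym to ≈-sym; trans to ≈-trans) public
  open RingProperties ring public
  open CommutativeSemigroupProperties +-commutativeSemigroup public
    using () renaming (interchange to +-interchange; x∙yz≈y∙xz to x+yz≈y+xz)
  open Sums rawRing public
  open Mult +-monoid public using () renaming (_×_ to _·_)
  open import Relation.Binary.Reasoning.Setoid setoid public

  module _ {a} {A : Set a} where

    ∑-cong : ∀ {f g} (xs : List A) → (∀ {x} → x ∈ xs → f x ≈ g x) → ∑ xs f ≈ ∑ xs g
    ∑-cong []       h = ≈-refl
    ∑-cong (x ∷ xs) h = +-cong (h (here refl)) (∑-cong xs (h ∘ there))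

    ∑-cong-ext : ∀ {f g} (xs : List A) → (∀ x → f x ≈ g x) → ∑ xs f ≈ ∑ xs g
    ∑-cong-ext xs h = ∑-cong xs (λ {x} _ → h x)

    ∑-zero : ∀ {f} (xs : List A) → (∀ {x} → x ∈ xs → f x ≈ 0#) → ∑ xs f ≈ 0#
    ∑-zero []       h = ≈-refl
    ∑-zero (x ∷ xs) h =
      ≈-trans (+-cong (h (here refl)) (∑-zero xs (h ∘ there))) (+-identityˡ 0#)

    ∑-++ : ∀ xs ys (f : A → Carrier) → ∑ (xs ++ ys) f ≈ ∑ xs f + ∑ ys f
    ∑-++ []       ys f = ≈-sym (+-identityˡ _)
    ∑-++ (x ∷ xs) ys f = ≈-trans (+-congˡ (∑-++ xs ys f)) (≈-sym (+-assoc _ _ _))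

    ∑-+ : ∀ xs (f g : A → Carrier) → ∑ xs (λ x → f x + g x) ≈ ∑ xs f + ∑ xs g
    ∑-+ []       f g = ≈-sym (+-identityˡ _)
    ∑-+ (x ∷ xs) f g = ≈-trans (+-congˡ (∑-+ xs f g)) (+-interchange _ _ _ _)

    ∑-neg : ∀ xs (f : A → Carrier) → ∑ xs (λ x → - f x) ≈ - ∑ xs f
    ∑-neg []       f = ≈-sym -0#≈0#
    ∑-neg (x ∷ xs) f = ≈-trans (+-congˡ (∑-neg xs f)) (-‿+-comm _ _)

    *-distribʳ-∑ : ∀ xs y (f : A → Carrier) → ∑ xs f * y ≈ ∑ xs (λ x → f x * y)
    *-distribʳ-∑ []       y f = zeroˡ y
    *-distribʳ-∑ (x ∷ xs) y f = ≈-trans (distribʳ _ _ _) (+-congˡ (*-distribʳ-∑ xs y f))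

    ∑-↭ : ∀ {xs ys} (f : A → Carrier) → xs ↭ ys → ∑ xs f ≈ ∑ ys f
    ∑-↭ f ↭.refl         = ≈-refl
    ∑-↭ f (↭.prep x p)   = +-congˡ (∑-↭ f p)
    ∑-↭ f (↭.swap x y p) = ≈-trans (+-congˡ (+-congˡ (∑-↭ f p))) (x+yz≈y+xz _ _ _)
    ∑-↭ f (↭.trans p q)  = ≈-trans (∑-↭ f p) (∑-↭ f q)

    ∑-const : ∀ (xs : List A) y → ∑ xs (λ _ → y) ≈ length xs · y
    ∑-const []       y = ≈-refl
    ∑-const (x ∷ xs) y = +-congˡ (∑-const xs y)

    ∑-filter : ∀ {p} {P : Pred A p} (P? : Decidable P) xs (f : A → Carrier) →
               ∑ (filter P? xs) f ≈ ∑ xs (λ x → if does (P? x) then f x else 0#)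
    ∑-filter P? []       f = ≈-refl
    ∑-filter P? (x ∷ xs) f with does (P? x)
    ... | true  = +-congˡ (∑-filter P? xs f)
    ... | false = ≈-trans (∑-filter P? xs f) (≈-sym (+-identityˡ _))

  module _ {a b} {A : Set a} {B : Set b} where

    ∑-map : ∀ (g : A → B) xs f → ∑ (map g xs) f ≡ ∑ xs (f ∘ g)
    ∑-map g xs f = cong (foldr _+_ 0#) (sym (map-∘ xs))

    ∑-concatMap : ∀ (g : A → List B) xs f → ∑ (concatMap g xs) f ≈ ∑ xs (λ x → ∑ (g x) f)
    ∑-concatMap g []       f = ≈-refl
    ∑-concatMap g (x ∷ xs) f =
      ≈-trans (∑-++ (g x) (concatMap g xs) f) (+-congˡ (∑-concatMap g xs f))

    ∑-comm : ∀ (xs : List A) (ys : List B) (f : A → B → Carrier) →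
             ∑ xs (λ x → ∑ ys (f x)) ≈ ∑ ys (λ y → ∑ xs (λ x → f x y))
    ∑-comm []       ys f = ≈-sym (∑-zero ys (λ _ → ≈-refl))
    ∑-comm (x ∷ xs) ys f = ≈-trans (+-congˡ (∑-comm xs ys f)) (≈-sym (∑-+ ys _ _))

    ∑-bij : ∀ {xs : List A} {ys : List B} {F G} (f : A → B) (g : B → A) →
            Unique xs → Unique ys →
            (∀ {x} → x ∈ xs → f x ∈ ys × g (f x) ≡ x) →
            (∀ {y} → y ∈ ys → g y ∈ xs × f (g y) ≡ y) →
            (∀ {x} → x ∈ xs → F x ≈ G (f x)) → ∑ xs F ≈ ∑ ys G
    ∑-bij {xs} {ys} {F} {G} f g xs! ys! to from F≈G = begin
      ∑ xs F          ≈⟨ ∑-cong xs F≈G ⟩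
      ∑ xs (G ∘ f)    ≡⟨ ∑-map f xs G ⟨
      ∑ (map f xs) G  ≈⟨ ∑-↭ G (bijection⇒↭ f g xs! ys! to from) ⟩
      ∑ ys G          ∎

  module _ {a b} {A : Set a} {B : Set b} where

    ∑-pairs : ∀ xs (g : A → List B) (f : A × B → Carrier) →
              ∑ (pairs xs g) f ≈ ∑ xs (λ x → ∑ (g x) (λ y → f (x , y)))
    ∑-pairs xs g f = ≈-trans (∑-concatMap _ xs f)
      (∑-cong-ext xs λ x → reflexive (∑-map (x ,_) (g x) f))

  module _ {a} {A : Set a} where

    ∑-single : ∀ {x₀ : A} {xs f} → Unique xs → x₀ ∈ xs →
               (∀ {x} → x ∈ xs → ¬ x ≡ x₀ → f x ≈ 0#) → ∑ xs f ≈ f x₀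
    ∑-single {xs = x ∷ xs} {f} (x∉ ∷ xs!) (here refl) h = ≈-trans
      (+-congˡ (∑-zero xs (λ p → h (there p) λ eq → All.lookup x∉ p (sym eq)))) (+-identityʳ _)
    ∑-single (x∉ ∷ xs!) (there p) h = ≈-trans
      (+-cong (h (here refl) (All.lookup x∉ p)) (∑-single xs! p (h ∘ there))) (+-identityˡ _)

  if-cong : ∀ b {x y} → x ≈ y → (if b then x else 0#) ≈ (if b then y else 0#)
  if-cong true  p = p
  if-cong false p = ≈-refl

  upTo-suc : ∀ n → upTo (suc n) ≡ 0 ∷ map suc (upTo n)
  upTo-suc n = cong (0 ∷_) (sym (map-applyUpTo id suc n))

  ∑-upTo-suc : ∀ n f → ∑ (upTo (suc n)) f ≈ f 0 + ∑ (upTo n) (f ∘ suc)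
  ∑-upTo-suc n f = reflexive (trans (cong (λ xs → ∑ xs f) (upTo-suc n))
    (cong (f 0 +_) (∑-map suc (upTo n) f)))

  ∑-upTo-last : ∀ n f → ∑ (upTo (suc n)) f ≈ ∑ (upTo n) f + f n
  ∑-upTo-last n f = begin
    ∑ (upTo (suc n)) f      ≡⟨ cong (λ xs → ∑ xs f) (sym (applyUpTo-∷ʳ id n)) ⟩
    ∑ (upTo n ∷ʳ n) f       ≈⟨ ∑-++ (upTo n) [ n ] f ⟩
    ∑ (upTo n) f + (f n + 0#) ≈⟨ +-congˡ (+-identityʳ _) ⟩
    ∑ (upTo n) f + f n      ∎

  ∑-upTo-reverse : ∀ n f → ∑≤ n f ≈ ∑≤ n (λ i → f (n ∸ i))
  ∑-upTo-reverse zero    f = ≈-refl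
  ∑-upTo-reverse (suc n) f = begin
    ∑ (upTo (2 ℕ.+ n)) f                       ≈⟨ ∑-upTo-last (suc n) f ⟩
    ∑≤ n f + f (suc n)                         ≈⟨ +-comm _ _ ⟩
    f (suc n) + ∑≤ n f                         ≈⟨ +-congˡ (∑-upTo-reverse n f) ⟩
    f (suc n) + ∑≤ n (λ i → f (n ∸ i))         ≈⟨ ∑-upTo-suc (suc n) (λ i → f (suc n ∸ i)) ⟨
    ∑≤ (suc n) (λ i → f (suc n ∸ i))           ∎

-- Ribbons as words

-- east: the next letter lies to the left in the same row, hence is weakly
-- smaller; north: it is the lower of two cells in a column.
data Direction : Set where
  east north : Direction

-- The two conditions are complementary by definition, so that an unconstrained pair of consecutive
-- letters splits into the two directions by a Boolean case distinction.
follows : Direction → ℕ → ℕ → Bool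
follows east  x y = y <ᵇ suc x
follows north x y = not (y <ᵇ suc x)

replicate-snoc : ∀ m (u : List Direction) →
  replicate m east ++ east ∷ u ≡ replicate (suc m) east ++ u
replicate-snoc zero    u = refl
replicate-snoc (suc m) u = cong (east ∷_) (replicate-snoc m u)

-- Products of multivariate power series

module SeriesProperties {c ℓ} (K : CommutativeRing c ℓ) where

  open FiniteSums K
  open MultivariateSeries rawRing public

  SameLength : List ℕ → List ℕ → Set
  SameLength α β = length α ≡ length β

  -- A product evaluates its factors only at exponent vectors as long as `α`. The restriction
  -- matters because the series of ribbons sum over the letters below the length of their argument.
  mulˢ-cong : ∀ {f f′ g g′} α →
    (∀ β → SameLength β α → f β ≈ f′ β) → (∀ β → SameLength β α → g β ≈ g′ β) →
    mulˢ f g α ≈ mulˢ f′ g′ α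
  mulˢ-cong []      p q = *-cong (p [] refl) (q [] refl)
  mulˢ-cong (a ∷ α) p q = ∑-cong-ext (upTo (suc a)) λ i → mulˢ-cong α
    (λ β e → p _ (cong suc e)) (λ β e → q _ (cong suc e))

  mulˢ-congʳ : ∀ {f g g′} α → (∀ β → SameLength β α → g β ≈ g′ β) → mulˢ f g α ≈ mulˢ f g′ α
  mulˢ-congʳ α = mulˢ-cong α (λ _ _ → ≈-refl)

  mulˢ-congˡ : ∀ {f f′ g} α → (∀ β → SameLength β α → f β ≈ f′ β) → mulˢ f g α ≈ mulˢ f′ g α
  mulˢ-congˡ α p = mulˢ-cong α p (λ _ _ → ≈-refl)

  mulˢ-distribˡ : ∀ f g h α → mulˢ f (λ β → g β + h β) α ≈ mulˢ f g α + mulˢ f h α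
  mulˢ-distribˡ f g h []      = distribˡ _ _ _
  mulˢ-distribˡ f g h (a ∷ α) = ≈-trans
    (∑-cong-ext (upTo (suc a)) λ i → mulˢ-distribˡ _ _ _ α) (∑-+ (upTo (suc a)) _ _)

  mulˢ-distribʳ : ∀ f g h α → mulˢ (λ β → g β + h β) f α ≈ mulˢ g f α + mulˢ h f α
  mulˢ-distribʳ f g h []      = distribʳ _ _ _
  mulˢ-distribʳ f g h (a ∷ α) = ≈-trans
    (∑-cong-ext (upTo (suc a)) λ i → mulˢ-distribʳ _ _ _ α) (∑-+ (upTo (suc a)) _ _)

  mulˢ-zeroʳ : ∀ f {g} α → (∀ β → g β ≈ 0#) → mulˢ f g α ≈ 0#
  mulˢ-zeroʳ f []      p = ≈-trans (*-congˡ (p [])) (zeroʳ _)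
  mulˢ-zeroʳ f (a ∷ α) p = ∑-zero (upTo (suc a)) λ _ → mulˢ-zeroʳ _ α (λ _ → p _)

  mulˢ-zeroˡ : ∀ {f} g α → (∀ β → f β ≈ 0#) → mulˢ f g α ≈ 0#
  mulˢ-zeroˡ g []      p = ≈-trans (*-congʳ (p [])) (zeroˡ _)
  mulˢ-zeroˡ g (a ∷ α) p = ∑-zero (upTo (suc a)) λ _ → mulˢ-zeroˡ _ α (λ _ → p _)

  mulˢ-negʳ : ∀ f g α → mulˢ f (λ β → - g β) α ≈ - mulˢ f g α
  mulˢ-negʳ f g []      = ≈-sym (-‿distribʳ-* _ _)
  mulˢ-negʳ f g (a ∷ α) = ≈-trans
    (∑-cong-ext (upTo (suc a)) λ i → mulˢ-negʳ _ _ α) (∑-neg (upTo (suc a)) _)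

  mulˢ-∑ʳ : ∀ {a} {A : Set a} f (xs : List A) (g : A → Series) α →
            mulˢ f (λ β → ∑ xs λ x → g x β) α ≈ ∑ xs λ x → mulˢ f (g x) α
  mulˢ-∑ʳ f []       g α = mulˢ-zeroʳ f α (λ _ → ≈-refl)
  mulˢ-∑ʳ f (x ∷ xs) g α = ≈-trans (mulˢ-distribˡ f (g x) _ α) (+-congˡ (mulˢ-∑ʳ f xs g α))

  mulˢ-∑ˡ : ∀ {a} {A : Set a} f (xs : List A) (g : A → Series) α →
            mulˢ (λ β → ∑ xs λ x → g x β) f α ≈ ∑ xs λ x → mulˢ (g x) f α
  mulˢ-∑ˡ f []       g α = mulˢ-zeroˡ f α (λ _ → ≈-refl)
  mulˢ-∑ˡ f (x ∷ xs) g α = ≈-trans (mulˢ-distribʳ f (g x) _ α) (+-congˡ (mulˢ-∑ˡ f xs g α))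

  mulˢ-identityʳ : ∀ f α → mulˢ f (completeHomogeneous 0) α ≈ f α
  mulˢ-identityʳ f []      = *-identityʳ _
  mulˢ-identityʳ f (a ∷ α) = begin
    ∑≤ a F              ≈⟨ ∑-upTo-reverse a F ⟩
    ∑≤ a (F ∘ (a ∸_))   ≈⟨ ∑-upTo-suc a _ ⟩
    F a + ∑ (upTo a) (λ i → F (a ∸ suc i)) ≈⟨ +-cong
      (≈-trans (mulˢ-congʳ α (λ β _ → reflexive
        (cong (λ i → completeHomogeneous 0 (i ∷ β)) (ℕ.n∸n≡0 a)))) (mulˢ-identityʳ _ α))
      (∑-zero (upTo a) λ {i} i∈ → mulˢ-zeroʳ _ α λ β → vanish i (∈-upTo⁻ i∈) β) ⟩
    f (a ∷ α) + 0#      ≈⟨ +-identityʳ _ ⟩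
    f (a ∷ α)           ∎
    where
    F = λ i → mulˢ (f ∘ (i ∷_)) (completeHomogeneous 0 ∘ (a ∸ i ∷_)) α
    vanish : ∀ i → i ℕ.< a → ∀ β → completeHomogeneous 0 (a ∸ (a ∸ suc i) ∷ β) ≈ 0#
    vanish i i<a β = reflexive (cong (λ j → completeHomogeneous 0 (j ∷ β)) (ℕ.m∸[m∸n]≡n i<a))

  mulˢ-identityˡ : ∀ f α → mulˢ (completeHomogeneous 0) f α ≈ f α
  mulˢ-identityˡ f []      = *-identityˡ _
  mulˢ-identityˡ f (a ∷ α) = begin
    ∑≤ a F ≈⟨ ∑-upTo-suc a F ⟩
    F 0 + ∑ (upTo a) (F ∘ suc) ≈⟨ +-cong (mulˢ-identityˡ _ α)
      (∑-zero (upTo a) λ _ → mulˢ-zeroˡ _ α λ _ → ≈-refl) ⟩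
    f (a ∷ α) + 0# ≈⟨ +-identityʳ _ ⟩
    f (a ∷ α)      ∎
    where
    F = λ i → mulˢ (completeHomogeneous 0 ∘ (i ∷_)) (f ∘ (a ∸ i ∷_)) α

  -- multiplication by the variable with index x
  shift : ℕ → Series → Series
  shift _       f []          = 0#
  shift zero    f (zero ∷ α)  = 0#
  shift zero    f (suc a ∷ α) = f (a ∷ α)
  shift (suc x) f (a ∷ α)     = shift x (f ∘ (a ∷_)) α

  shift-cong : ∀ {f g} x α → (∀ β → SameLength β α → f β ≈ g β) → shift x f α ≈ shift x g α
  shift-cong x       []          p = ≈-refl
  shift-cong zero    (zero ∷ α)  p = ≈-refl
  shift-cong zero    (suc a ∷ α) p = p (a ∷ α) refl
  shift-cong (suc x) (a ∷ α)     p = shift-cong x α (λ β e → p _ (cong suc e))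

  shift-+ : ∀ f g x α → shift x (λ β → f β + g β) α ≈ shift x f α + shift x g α
  shift-+ f g x       []          = ≈-sym (+-identityˡ 0#)
  shift-+ f g zero    (zero ∷ α)  = ≈-sym (+-identityˡ 0#)
  shift-+ f g zero    (suc a ∷ α) = ≈-refl
  shift-+ f g (suc x) (a ∷ α)     = shift-+ _ _ x α

  shift-zero : ∀ {f} x α → (∀ β → f β ≈ 0#) → shift x f α ≈ 0#
  shift-zero x       []          p = ≈-refl
  shift-zero zero    (zero ∷ α)  p = ≈-refl
  shift-zero zero    (suc a ∷ α) p = p _
  shift-zero (suc x) (a ∷ α)     p = shift-zero x α (λ _ → p _)

  shift-∑ : ∀ {a} {A : Set a} (xs : List A) (f : A → Series) x α →
            shift x (λ β → ∑ xs λ y → f y β) α ≈ ∑ xs λ y → shift x (f y) α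
  shift-∑ []       f x α = shift-zero x α (λ _ → ≈-refl)
  shift-∑ (y ∷ xs) f x α = ≈-trans (shift-+ (f y) _ x α) (+-congˡ (shift-∑ xs f x α))

  shift-overflow : ∀ f x α → length α ℕ.≤ x → shift x f α ≈ 0#
  shift-overflow f x       []      _       = ≈-refl
  shift-overflow f (suc x) (a ∷ α) (s≤s p) = shift-overflow _ x α p

  mulˢ-shiftʳ : ∀ f g x α → mulˢ f (shift x g) α ≈ shift x (mulˢ f g) α
  mulˢ-shiftʳ f g x       []          = zeroʳ _
  mulˢ-shiftʳ f g zero    (zero ∷ α)  =
    ≈-trans (+-identityʳ _) (mulˢ-zeroʳ _ α λ _ → ≈-refl)
  mulˢ-shiftʳ f g zero    (suc a ∷ α) = begin
    ∑≤ (suc a) F      ≈⟨ ∑-upTo-last (suc a) F ⟩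
    ∑≤ a F + F (suc a) ≈⟨ +-cong
      (∑-cong (upTo (suc a)) λ {i} i∈ → mulˢ-congʳ α λ β _ → reflexive
        (cong (λ j → shift 0 g (j ∷ β)) (ℕ.+-∸-assoc 1 (ℕ.s≤s⁻¹ (∈-upTo⁻ i∈)))))
      (mulˢ-zeroʳ _ α λ β → reflexive (cong (λ j → shift 0 g (j ∷ β)) (ℕ.n∸n≡0 a))) ⟩
    mulˢ f g (a ∷ α) + 0# ≈⟨ +-identityʳ _ ⟩
    mulˢ f g (a ∷ α)  ∎
    where
    F = λ i → mulˢ (f ∘ (i ∷_)) (shift 0 g ∘ (suc a ∸ i ∷_)) α
  mulˢ-shiftʳ f g (suc x) (a ∷ α) = ≈-trans
    (∑-cong-ext (upTo (suc a)) λ i → mulˢ-shiftʳ _ _ x α)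
    (≈-sym (shift-∑ (upTo (suc a)) _ x α))

-- The series of a ribbon and its product with a row

module RibbonSeries {c ℓ} (K : CommutativeRing c ℓ) where

  open FiniteSums K
  open SeriesProperties K

  -- The generating series of the words with given first letter and steps,
  -- that is of the fillings of a ribbon read from its north-east end.
  mutual
    ribbonFrom : List Direction → ℕ → Series
    ribbonFrom []      x = shift x (completeHomogeneous 0)
    ribbonFrom (s ∷ u) x = shift x (ribbonAfter s x u)

    ribbonAfter : Direction → ℕ → List Direction → Series
    ribbonAfter s x u β =
      ∑ (upTo (length β)) λ y → if follows s x y then ribbonFrom u y β else 0#

  ribbon : List Direction → Series
  ribbon u α = ∑ (upTo (length α)) λ x → ribbonFrom u x α

  ribbonAfter-split : ∀ x u β → ribbonAfter north x u β + ribbonAfter east x u β ≈ ribbon u β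
  ribbonAfter-split x u β = ≈-trans (≈-sym (∑-+ (upTo (length β)) _ _))
    (∑-cong-ext (upTo (length β)) λ y → cases (y <ᵇ suc x) _)
    where
    cases : ∀ b z → (if not b then z else 0#) + (if b then z else 0#) ≈ z
    cases true  z = +-identityˡ z
    cases false z = +-identityʳ z

  private
    if-+ : ∀ b x y → (if b then x + y else 0#) ≈ (if b then x else 0#) + (if b then y else 0#)
    if-+ true  x y = ≈-refl
    if-+ false x y = ≈-sym (+-identityˡ 0#)

    mulˢ-if : ∀ b f g α →
      mulˢ f (λ β → if b then g β else 0#) α ≈ (if b then mulˢ f g α else 0#)
    mulˢ-if true  f g α = ≈-refl
    mulˢ-if false f g α = mulˢ-zeroʳ f α (λ _ → ≈-refl)

  -- Induction along the row: its first letter is a common factor of all terms. Once a single letter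
  -- `x` is left, the first letter of `u` is either greater than `x` or not, which gives the two
  -- gluings.
  ribbonFrom-* : ∀ u m x α → mulˢ (ribbon u) (ribbonFrom (replicate m east) x) α ≈
    ribbonFrom (replicate m east ++ north ∷ u) x α + ribbonFrom (replicate m east ++ east ∷ u) x α
  ribbonFrom-* u zero x α = begin
    mulˢ (ribbon u) (shift x (completeHomogeneous 0)) α  ≈⟨ mulˢ-shiftʳ _ _ x α ⟩
    shift x (mulˢ (ribbon u) (completeHomogeneous 0)) α
      ≈⟨ shift-cong x α (λ β _ → ≈-trans (mulˢ-identityʳ (ribbon u) β)
           (≈-sym (ribbonAfter-split x u β))) ⟩
    shift x (λ β → ribbonAfter north x u β + ribbonAfter east x u β) α ≈⟨ shift-+ _ _ x α ⟩
    ribbonFrom (north ∷ u) x α + ribbonFrom (east ∷ u) x α ∎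
  ribbonFrom-* u (suc m) x α = begin
    mulˢ r (shift x (ribbonAfter east x e)) α           ≈⟨ mulˢ-shiftʳ _ _ x α ⟩
    shift x (mulˢ r (ribbonAfter east x e)) α           ≈⟨ shift-cong x α (λ β _ → step β) ⟩
    shift x (λ β → ribbonAfter east x n β + ribbonAfter east x e′ β) α ≈⟨ shift-+ _ _ x α ⟩
    ribbonFrom (east ∷ n) x α + ribbonFrom (east ∷ e′) x α ∎
    where
    r  = ribbon u
    e  = replicate m east
    n  = e ++ north ∷ u
    e′ = e ++ east ∷ u
    step : ∀ β → mulˢ r (ribbonAfter east x e) β ≈ ribbonAfter east x n β + ribbonAfter east x e′ β
    step β = begin
      mulˢ r (ribbonAfter east x e) β
        ≈⟨ mulˢ-congʳ β (λ β′ eq → reflexive (cong (λ l → ∑ (upTo l) λ y →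
             if follows east x y then ribbonFrom e y β′ else 0#) eq)) ⟩
      mulˢ r (λ β′ → ∑ (upTo (length β)) λ y → if follows east x y then ribbonFrom e y β′ else 0#) β
        ≈⟨ mulˢ-∑ʳ r (upTo (length β)) _ β ⟩
      (∑ (upTo (length β)) λ y → mulˢ r (λ β′ → if follows east x y then ribbonFrom e y β′ else 0#) β)
        ≈⟨ ∑-cong-ext (upTo (length β)) (λ y → ≈-trans (mulˢ-if (follows east x y) _ _ β)
             (≈-trans (if-cong (follows east x y) (ribbonFrom-* u m y β))
               (if-+ (follows east x y) _ _))) ⟩
      (∑ (upTo (length β)) λ y → (if follows east x y then ribbonFrom n y β else 0#) +
                                 (if follows east x y then ribbonFrom e′ y β else 0#))
        ≈⟨ ∑-+ (upTo (length β)) _ _ ⟩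
      ribbonAfter east x n β + ribbonAfter east x e′ β ∎

  ribbon-*-row : ∀ u m α → mulˢ (ribbon u) (ribbon (replicate m east)) α ≈
    ribbon (replicate m east ++ north ∷ u) α + ribbon (replicate m east ++ east ∷ u) α
  ribbon-*-row u m α = begin
    mulˢ (ribbon u) (ribbon (replicate m east)) α
      ≈⟨ mulˢ-congʳ α (λ β eq → reflexive (cong (λ l → ∑ (upTo l) λ x →
           ribbonFrom (replicate m east) x β) eq)) ⟩
    mulˢ (ribbon u) (λ β → ∑ (upTo (length α)) λ x → ribbonFrom (replicate m east) x β) α
      ≈⟨ mulˢ-∑ʳ (ribbon u) (upTo (length α)) _ α ⟩
    (∑ (upTo (length α)) λ x → mulˢ (ribbon u) (ribbonFrom (replicate m east) x) α)
      ≈⟨ ∑-cong-ext (upTo (length α)) (λ x → ribbonFrom-* u m x α) ⟩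
    _ ≈⟨ ∑-+ (upTo (length α)) _ _ ⟩
    ribbon (replicate m east ++ north ∷ u) α + ribbon (replicate m east ++ east ∷ u) α ∎

  private
    -- the monomials in the first j variables whose degree satisfies P
    monomials : ℕ → (ℕ → Bool) → Series
    monomials j P α = if (ℕ.sum (drop j α) ≡ᵇ 0) ∧ P (ℕ.sum α) then 1# else 0#

    -- Either the variable with index `j` is absent, or one copy of it is taken out, which lowers
    -- the degree by one. The predicate on the degree is arbitrary so that it can absorb the
    -- exponents of variables already passed.
    monomials-suc : ∀ j P α →
      monomials (suc j) P α ≈ monomials j P α + shift j (monomials (suc j) (P ∘ suc)) α
    monomials-suc zero    P []          = ≈-sym (+-identityʳ _)
    monomials-suc (suc j) P []          = ≈-sym (+-identityʳ _)
    monomials-suc zero    P (zero ∷ α)  = ≈-sym (+-identityʳ _)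
    monomials-suc zero    P (suc a ∷ α) = ≈-sym (+-identityˡ _)
    monomials-suc (suc j) P (a ∷ α)     = ≈-trans (monomials-suc j (P ∘ (a ℕ.+_)) α)
      (+-congˡ (shift-cong j α λ β _ → reflexive (cong
        (λ d → if (ℕ.sum (drop (suc j) β) ≡ᵇ 0) ∧ P d then 1# else 0#) (ℕ.+-suc a (ℕ.sum β)))))

    -- Sorts the monomials of positive degree by the greatest variable that occurs.
    monomials-∑ : ∀ N m α →
      ∑ (upTo N) (λ y → shift y (monomials (suc y) (_≡ᵇ m)) α) ≈ monomials N (_≡ᵇ suc m) α
    monomials-∑ zero    m α = empty (ℕ.sum α)
      where
      empty : ∀ d → 0# ≈ (if (d ≡ᵇ 0) ∧ (d ≡ᵇ suc m) then 1# else 0#)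
      empty zero    = ≈-refl
      empty (suc d) = ≈-refl
    monomials-∑ (suc N) m α = begin
      _ ≈⟨ ∑-upTo-last N _ ⟩
      _ ≈⟨ +-congʳ (monomials-∑ N m α) ⟩
      monomials N (_≡ᵇ suc m) α + shift N (monomials (suc N) (_≡ᵇ m)) α
        ≈⟨ monomials-suc N (_≡ᵇ suc m) α ⟨
      monomials (suc N) (_≡ᵇ suc m) α ∎

    monomials-0 : ∀ j α → monomials j (_≡ᵇ 0) α ≈ completeHomogeneous 0 α
    monomials-0 zero    α          = cases (ℕ.sum α)
      where
      cases : ∀ d → (if (d ≡ᵇ 0) ∧ (d ≡ᵇ 0) then 1# else 0#) ≈ (if d ≡ᵇ 0 then 1# else 0#)
      cases zero    = ≈-refl
      cases (suc d) = ≈-refl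
    monomials-0 (suc j) []          = ≈-refl
    monomials-0 (suc j) (zero ∷ α)  = monomials-0 j α
    monomials-0 (suc j) (suc a ∷ α) = cases (ℕ.sum (drop j α) ≡ᵇ 0)
      where
      cases : ∀ b → (if b ∧ false then 1# else 0#) ≈ 0#
      cases true  = ≈-refl
      cases false = ≈-refl

    monomials-all : ∀ P α → monomials (length α) P α ≡ (if P (ℕ.sum α) then 1# else 0#)
    monomials-all P []      = refl
    monomials-all P (a ∷ α) = monomials-all (P ∘ (a ℕ.+_)) α

    -- The letter is bounded by the number of variables and by the letter before it. Neither bound
    -- implies the other, but letters from `L` on contribute nothing.
    ∑-restrict : ∀ L x (F : ℕ → Carrier) → (∀ y → L ℕ.≤ y → F y ≈ 0#) →
      ∑ (upTo L) (λ y → if y <ᵇ suc x then F y else 0#) ≈ ∑ (upTo (suc x)) F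
    ∑-restrict zero    x       F h = ≈-sym (∑-zero (upTo (suc x)) (λ _ → h _ z≤n))
    ∑-restrict (suc L) zero    F h = ≈-trans (∑-upTo-suc L _)
      (+-congˡ (∑-zero (upTo L) λ _ → ≈-refl))
    ∑-restrict (suc L) (suc x) F h = begin
      _ ≈⟨ ∑-upTo-suc L _ ⟩
      F 0 + ∑ (upTo L) (λ y → if y <ᵇ suc x then F (suc y) else 0#)
        ≈⟨ +-congˡ (∑-restrict L x (F ∘ suc) (λ y p → h (suc y) (s≤s p))) ⟩
      F 0 + ∑ (upTo (suc x)) (F ∘ suc) ≈⟨ ∑-upTo-suc (suc x) F ⟨
      ∑ (upTo (2 ℕ.+ x)) F ∎

    -- A weakly decreasing word is determined by its content, so what follows the first letter `x`
    -- is an arbitrary monomial in the variables up to `x`.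
    rowFrom : ∀ m x α →
      ribbonFrom (replicate m east) x α ≈ shift x (monomials (suc x) (_≡ᵇ m)) α
    rowFrom zero    x α = shift-cong x α λ β _ → ≈-sym (monomials-0 (suc x) β)
    rowFrom (suc m) x α = shift-cong x α λ β _ → begin
      ribbonAfter east x (replicate m east) β
        ≈⟨ ∑-restrict (length β) x _ (λ y p → ≈-trans (rowFrom m y β) (shift-overflow _ y β p)) ⟩
      ∑ (upTo (suc x)) (λ y → ribbonFrom (replicate m east) y β)
        ≈⟨ ∑-cong-ext (upTo (suc x)) (λ y → rowFrom m y β) ⟩
      ∑ (upTo (suc x)) (λ y → shift y (monomials (suc y) (_≡ᵇ m)) β)
        ≈⟨ monomials-∑ (suc x) m β ⟩
      monomials (suc x) (_≡ᵇ suc m) β ∎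

  ribbon-row : ∀ m α → ribbon (replicate m east) α ≈ completeHomogeneous (suc m) α
  ribbon-row m α = begin
    ribbon (replicate m east) α  ≈⟨ ∑-cong-ext (upTo (length α)) (λ x → rowFrom m x α) ⟩
    _                            ≈⟨ monomials-∑ (length α) m α ⟩
    monomials (length α) (_≡ᵇ suc m) α ≡⟨ monomials-all (_≡ᵇ suc m) α ⟩
    completeHomogeneous (suc m) α ∎

  -- The product of a ribbon with a row glues the row to the north-east end,
  -- in the two possible ways.
  ribbon-*-h : ∀ u m α → mulˢ (ribbon u) (completeHomogeneous (suc m)) α ≈
    ribbon (replicate m east ++ north ∷ u) α + ribbon (replicate m east ++ east ∷ u) α
  ribbon-*-h u m α = ≈-trans (mulˢ-congʳ α λ β _ → ≈-sym (ribbon-row m β)) (ribbon-*-row u m α)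

-- The functional equation

mutual
  -- the step sequences of length d built from the blocks "east" and
  -- "east, north", with j blocks of the second kind
  steps : ℕ → ℕ → List (List Direction)
  steps zero    zero    = [] ∷ []
  steps zero    (suc j) = []
  steps (suc d) j       = map (east ∷_) (steps d j) ++ blocks d j

  blocks : ℕ → ℕ → List (List Direction)
  blocks (suc d) (suc j) = map (λ u → east ∷ north ∷ u) (steps d j)
  blocks _       _       = []

steps-empty : ∀ d j → d ℕ.< 2 ℕ.* j → steps d j ≡ []
steps-empty zero          (suc j) p = refl
steps-empty (suc zero)    (suc j) p = refl
steps-empty (suc (suc d)) (suc j) p
  rewrite steps-empty (suc d) (suc j) (ℕ.<⇒≤ p)
        | steps-empty d j (ℕ.s≤s⁻¹ (ℕ.s≤s⁻¹ (subst (2 ℕ.+ d ℕ.<_) (cong suc (ℕ.+-suc j _)) p)))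
  = refl

-- Coefficient sequences in t and weighted sums over step sequences

module Coefficients {c ℓ} (K : CommutativeRing c ℓ) where

  open FiniteSums K
  private module CM = CommutativeMonoidSolver +-commutativeMonoid

  Sequence : Set c
  Sequence = ℕ → Carrier

  δ : Carrier → Sequence
  δ x zero    = x
  δ x (suc _) = 0#

  -- multiplication by t ^ m
  τ : ℕ → Sequence → Sequence
  τ zero    f k       = f k
  τ (suc m) f zero    = 0#
  τ (suc m) f (suc k) = τ m f k

  δ-cong : ∀ {x y} k → x ≈ y → δ x k ≈ δ y k
  δ-cong zero    p = p
  δ-cong (suc k) p = ≈-refl

  δ-+ : ∀ x y k → δ (x + y) k ≈ δ x k + δ y k
  δ-+ x y zero    = ≈-refl
  δ-+ x y (suc k) = ≈-sym (+-identityˡ 0#)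

  τ-cong : ∀ {f g} m k → (∀ k → f k ≈ g k) → τ m f k ≈ τ m g k
  τ-cong zero    k       p = p k
  τ-cong (suc m) zero    p = ≈-refl
  τ-cong (suc m) (suc k) p = τ-cong m k p

  τ-+ : ∀ f g m k → τ m (λ k → f k + g k) k ≈ τ m f k + τ m g k
  τ-+ f g zero    k       = ≈-refl
  τ-+ f g (suc m) zero    = ≈-sym (+-identityˡ 0#)
  τ-+ f g (suc m) (suc k) = τ-+ f g m k

  τ-zero : ∀ {f} m k → (∀ k → f k ≈ 0#) → τ m f k ≈ 0#
  τ-zero zero    k       p = p k
  τ-zero (suc m) zero    p = ≈-refl
  τ-zero (suc m) (suc k) p = τ-zero m k p

  τ-∑ : ∀ {a} {A : Set a} (xs : List A) (f : A → Sequence) m k →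
        τ m (λ k → ∑ xs λ x → f x k) k ≈ ∑ xs λ x → τ m (f x) k
  τ-∑ []       f m k = τ-zero m k (λ _ → ≈-refl)
  τ-∑ (x ∷ xs) f m k = ≈-trans (τ-+ (f x) _ m k) (+-congˡ (τ-∑ xs f m k))

  τ-τ : ∀ f m k → τ m (τ 1 f) k ≈ τ (suc m) f k
  τ-τ f zero    k       = ≈-refl
  τ-τ f (suc m) zero    = ≈-refl
  τ-τ f (suc m) (suc k) = τ-τ f m k

  τ-τ′ : ∀ f m k → τ 1 (τ m f) k ≈ τ (suc m) f k
  τ-τ′ f m zero    = ≈-refl
  τ-τ′ f m (suc k) = ≈-refl

  private
    rearrange₀ : ∀ a τa b → (a + 0#) + (τa + b) ≈ (τa + 0#) + (a + b)
    rearrange₀ = CM.solve 3 (λ a τa b → ((a ⊕ CM.id) ⊕ (τa ⊕ b)) ⊜ ((τa ⊕ CM.id) ⊕ (a ⊕ b))) ≈-refl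
      where open CM using (_⊕_; _⊜_)

    rearrangeˡ : ∀ A p q S p′ r → (A + ((p + q) + S)) + (p′ + r) ≈ (A + S) + (((p + p′) + r) + q)
    rearrangeˡ = CM.solve 6 (λ A p q S p′ r →
      ((A ⊕ ((p ⊕ q) ⊕ S)) ⊕ (p′ ⊕ r)) ⊜ ((A ⊕ S) ⊕ (((p ⊕ p′) ⊕ r) ⊕ q))) ≈-refl
      where open CM using (_⊕_; _⊜_)

    rearrangeʳ : ∀ A T a p q b → (A + T) + (((a + p) + b) + q) ≈ (A + ((p + q) + T)) + (a + b)
    rearrangeʳ = CM.solve 6 (λ A T a p q b →
      ((A ⊕ T) ⊕ (((a ⊕ p) ⊕ b) ⊕ q)) ⊜ ((A ⊕ ((p ⊕ q) ⊕ T)) ⊕ (a ⊕ b))) ≈-refl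
      where open CM using (_⊕_; _⊜_)

  -- If aᵢ₊₁ = (1 + t) aᵢ + t bᵢ, then
  --   (1 - t) a_N + ∑ᵢ (t^(N - i) - t) (aᵢ + bᵢ₊₁) = (1 - t^(N + 1)) a₀ + t (1 - t^N) b₀;
  -- all negative terms are moved to the other side.
  telescope : ∀ N (a b : ℕ → Sequence) →
    (∀ i k → i ℕ.< N → a (suc i) k ≈ (a i k + τ 1 (a i) k) + τ 1 (b i) k) → ∀ k →
    (a N k + ∑ (upTo N) (λ i → τ (N ∸ i) (a i) k + τ (N ∸ i) (b (suc i)) k))
      + (τ (suc N) (a 0) k + τ (suc N) (b 0) k) ≈
    (τ 1 (a N) k + ∑ (upTo N) (λ i → τ 1 (a i) k + τ 1 (b (suc i)) k))
      + (a 0 k + τ 1 (b 0) k)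
  telescope zero    a b rec k = rearrange₀ _ _ _
  telescope (suc N) a b rec k = begin
    (A + ∑ (upTo (suc N)) F) + (τ (2 ℕ.+ N) (a 0) k + τ (2 ℕ.+ N) (b 0) k)
      ≈⟨ +-congʳ (+-congˡ (∑-upTo-suc N F)) ⟩
    (A + (F 0 + S)) + (τ (2 ℕ.+ N) (a 0) k + τ (2 ℕ.+ N) (b 0) k)
      ≈⟨ rearrangeˡ _ _ _ _ _ _ ⟩
    (A + S) + (((τ (suc N) (a 0) k + τ (2 ℕ.+ N) (a 0) k) + τ (2 ℕ.+ N) (b 0) k) + τ (suc N) (b 1) k)
      ≈⟨ +-congˡ (+-congʳ expand) ⟨
    (A + S) + (τ (suc N) (a 1) k + τ (suc N) (b 1) k)
      -- The identity for the sequences from index 1 on. The recurrence is used twice: on the left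
      -- for `a 1` multiplied by t^(N + 1), on the right for `a 1` itself.
      ≈⟨ telescope N (a ∘ suc) (b ∘ suc) (λ i k p → rec (suc i) k (s≤s p)) k ⟩
    (τ 1 (a (suc N)) k + T′) + (a 1 k + τ 1 (b 1) k)
      ≈⟨ +-congˡ (+-congʳ (rec 0 k (s≤s z≤n))) ⟩
    (τ 1 (a (suc N)) k + T′) + (((a 0 k + τ 1 (a 0) k) + τ 1 (b 0) k) + τ 1 (b 1) k)
      ≈⟨ rearrangeʳ _ _ _ _ _ _ ⟩
    (τ 1 (a (suc N)) k + (G 0 + T′)) + (a 0 k + τ 1 (b 0) k)
      ≈⟨ +-congʳ (+-congˡ (∑-upTo-suc N G)) ⟨
    (τ 1 (a (suc N)) k + ∑ (upTo (suc N)) G) + (a 0 k + τ 1 (b 0) k) ∎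
    where
    A = a (suc N) k
    F = λ i → τ (suc N ∸ i) (a i) k + τ (suc N ∸ i) (b (suc i)) k
    G = λ i → τ 1 (a i) k + τ 1 (b (suc i)) k
    S = ∑ (upTo N) (F ∘ suc)
    T′ = ∑ (upTo N) (G ∘ suc)
    expand : τ (suc N) (a 1) k ≈
      (τ (suc N) (a 0) k + τ (2 ℕ.+ N) (a 0) k) + τ (2 ℕ.+ N) (b 0) k
    expand = begin
      τ (suc N) (a 1) k ≈⟨ τ-cong (suc N) k (λ k → rec 0 k (s≤s z≤n)) ⟩
      _ ≈⟨ τ-+ _ _ (suc N) k ⟩
      _ ≈⟨ +-cong (τ-+ _ _ (suc N) k) (τ-τ (b 0) (suc N) k) ⟩
      _ ≈⟨ +-congʳ (+-congˡ (τ-τ (a 0) (suc N) k)) ⟩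
      _ ∎

  -- x (1 + t) ^ e
  binomial : ℕ → Carrier → Sequence
  binomial zero    x   = δ x
  binomial (suc e) x k = binomial e x k + τ 1 (binomial e x) k

  binomial-cong : ∀ {x y} e k → x ≈ y → binomial e x k ≈ binomial e y k
  binomial-cong zero    k p = δ-cong k p
  binomial-cong (suc e) k p =
    +-cong (binomial-cong e k p) (τ-cong 1 k (λ k → binomial-cong e k p))

  binomial-+ : ∀ x y e k → binomial e (x + y) k ≈ binomial e x k + binomial e y k
  binomial-+ x y zero    k = δ-+ x y k
  binomial-+ x y (suc e) k = ≈-trans
    (+-cong (binomial-+ x y e k)
      (≈-trans (τ-cong 1 k (binomial-+ x y e)) (τ-+ _ _ 1 k)))
    (+-interchange _ _ _ _)

  binomial-zero : ∀ e k {x} → x ≈ 0# → binomial e x k ≈ 0#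
  binomial-zero zero    zero    p = p
  binomial-zero zero    (suc k) p = ≈-refl
  binomial-zero (suc e) k       p = ≈-trans
    (+-cong (binomial-zero e k p) (τ-zero 1 k (λ k → binomial-zero e k p))) (+-identityˡ 0#)

  -- the sum of φ over all step sequences of length d, where an east step has
  -- weight 1 + t unless it begins a block "east, north", which has weight t
  mutual
    weighted : ℕ → (List Direction → Carrier) → Sequence
    weighted zero    φ   = δ (φ [])
    weighted (suc d) φ k =
      (weighted d (φ ∘ (east ∷_)) k + τ 1 (weighted d (φ ∘ (east ∷_))) k)
        + τ 1 (weighted⁻ d (λ u → φ (east ∷ north ∷ u))) k

    -- Accounts for the second step of a block "east, north"; with no step left after the first, the
    -- block does not fit.
    weighted⁻ : ℕ → (List Direction → Carrier) → Sequence
    weighted⁻ zero    φ _ = 0#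
    weighted⁻ (suc d) φ   = weighted d φ

  mutual
    weighted-cong : ∀ {φ ψ} d k → (∀ u → φ u ≈ ψ u) → weighted d φ k ≈ weighted d ψ k
    weighted-cong zero    k p = δ-cong k (p [])
    weighted-cong (suc d) k p = +-cong
      (+-cong (weighted-cong d k (p ∘ _)) (τ-cong 1 k λ k → weighted-cong d k (p ∘ _)))
      (τ-cong 1 k λ k → weighted⁻-cong d k (p ∘ _))

    weighted⁻-cong : ∀ {φ ψ} d k → (∀ u → φ u ≈ ψ u) → weighted⁻ d φ k ≈ weighted⁻ d ψ k
    weighted⁻-cong zero    k p = ≈-refl
    weighted⁻-cong (suc d) k p = weighted-cong d k p

  mutual
    weighted-+ : ∀ φ ψ d k → weighted d (λ u → φ u + ψ u) k ≈ weighted d φ k + weighted d ψ k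
    weighted-+ φ ψ zero    k = δ-+ _ _ k
    weighted-+ φ ψ (suc d) k = ≈-trans
      (+-cong
        (≈-trans (+-cong (weighted-+ _ _ d k)
          (≈-trans (τ-cong 1 k (weighted-+ _ _ d)) (τ-+ _ _ 1 k))) (+-interchange _ _ _ _))
        (≈-trans (τ-cong 1 k (weighted⁻-+ _ _ d)) (τ-+ _ _ 1 k)))
      (+-interchange _ _ _ _)

    weighted⁻-+ : ∀ φ ψ d k → weighted⁻ d (λ u → φ u + ψ u) k ≈ weighted⁻ d φ k + weighted⁻ d ψ k
    weighted⁻-+ φ ψ zero    k = ≈-sym (+-identityˡ 0#)
    weighted⁻-+ φ ψ (suc d) k = weighted-+ φ ψ d k

  -- Sorts the step sequences by the number `j` of blocks "east, north"; the other d - 2j blocks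
  -- contribute the power of 1 + t. The bound says that every `j` with 2j ≤ d is at most `J`. As an
  -- inequality it survives the passage to `d` with the same `J` and to d - 1 with `J` lowered by
  -- one.
  weighted≈binomials : ∀ d J → d ℕ.< 2 ℕ.* suc J → ∀ φ k →
    ∑≤ J (λ j → τ j (binomial (d ∸ 2 ℕ.* j) (∑ (steps d j) φ)) k) ≈ weighted d φ k
  weighted≈binomials zero J p φ k = begin
    _ ≈⟨ ∑-upTo-suc J _ ⟩
    δ (φ [] + 0#) k + ∑ (upTo J) (λ j →
      τ (suc j) (binomial (0 ∸ 2 ℕ.* suc j) 0#) k)
      ≈⟨ +-cong (δ-cong k (+-identityʳ _))
           (∑-zero (upTo J) λ {j} _ → τ-zero (suc j) k λ k → binomial-zero (0 ∸ 2 ℕ.* suc j) k ≈-refl) ⟩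
    δ (φ []) k + 0# ≈⟨ +-identityʳ _ ⟩
    δ (φ []) k ∎
  weighted≈binomials (suc d) J p φ k = begin
    ∑≤ J (λ j → τ j (binomial (suc d ∸ 2 ℕ.* j) (∑ (steps (suc d) j) φ)) k)
      ≈⟨ ∑-cong-ext (upTo (suc J)) split ⟩
    ∑≤ J (λ j → (E j k + τ 1 (E j) k) + B j k)
      ≈⟨ ∑-+ (upTo (suc J)) _ _ ⟩
    ∑≤ J (λ j → E j k + τ 1 (E j) k) + ∑≤ J (λ j → B j k)
      ≈⟨ +-cong (∑-+ (upTo (suc J)) _ _) (secondSum d J p) ⟩
    (∑≤ J (λ j → E j k) + ∑≤ J (λ j → τ 1 (E j) k)) + τ 1 (weighted⁻ d φᴺ) k
      ≈⟨ +-congʳ (+-cong (IH k) (≈-trans (≈-sym (τ-∑ (upTo (suc J)) E 1 k)) (τ-cong 1 k IH))) ⟩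
    weighted (suc d) φ k ∎
    where
    φᴱ = φ ∘ (east ∷_)
    φᴺ = λ u → φ (east ∷ north ∷ u)
    E = λ j → τ j (binomial (d ∸ 2 ℕ.* j) (∑ (steps d j) φᴱ))
    B = λ j → τ j (binomial (suc d ∸ 2 ℕ.* j) (∑ (blocks d j) φ))
    IH = weighted≈binomials d J (ℕ.<⇒≤ p) φᴱ

    firstPart : ∀ j → τ j (binomial (suc d ∸ 2 ℕ.* j) (∑ (steps d j) φᴱ)) k ≈ E j k + τ 1 (E j) k
    firstPart j with ℕ.≤-<-connex (2 ℕ.* j) d
    ... | inj₁ q = begin
      τ j (binomial (suc d ∸ 2 ℕ.* j) x) k
        ≡⟨ cong (λ e → τ j (binomial e x) k) (ℕ.+-∸-assoc 1 q) ⟩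
      τ j (binomial (suc (d ∸ 2 ℕ.* j)) x) k ≈⟨ τ-+ _ _ j k ⟩
      E j k + τ j (τ 1 (binomial (d ∸ 2 ℕ.* j) x)) k
        ≈⟨ +-congˡ (≈-trans (τ-τ _ j k) (≈-sym (τ-τ′ _ j k))) ⟩
      E j k + τ 1 (E j) k ∎
      where x = ∑ (steps d j) φᴱ
    -- Here both exponents are truncated to values that need not differ by one, but there is no
    -- sequence with so many blocks.
    ... | inj₂ q = ≈-trans (vanish (suc d ∸ 2 ℕ.* j) k) (≈-sym (≈-trans
      (+-cong (vanish (d ∸ 2 ℕ.* j) k) (τ-zero 1 k (vanish (d ∸ 2 ℕ.* j)))) (+-identityˡ 0#)))
      where
      vanish : ∀ e k → τ j (binomial e (∑ (steps d j) φᴱ)) k ≈ 0#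
      vanish e k = τ-zero j k λ k → binomial-zero e k
        (reflexive (cong (λ us → ∑ us φᴱ) (steps-empty d j q)))

    split : ∀ j → τ j (binomial (suc d ∸ 2 ℕ.* j) (∑ (steps (suc d) j) φ)) k ≈
                  (E j k + τ 1 (E j) k) + B j k
    split j = begin
      _ ≈⟨ τ-cong j k (λ k → ≈-trans
             (binomial-cong (suc d ∸ 2 ℕ.* j) k
               (≈-trans (∑-++ (map (east ∷_) (steps d j)) (blocks d j) φ)
                 (+-congʳ (reflexive (∑-map (east ∷_) (steps d j) φ)))))
             (binomial-+ _ _ (suc d ∸ 2 ℕ.* j) k)) ⟩
      _ ≈⟨ τ-+ _ _ j k ⟩
      _ ≈⟨ +-congʳ (firstPart j) ⟩
      _ ∎

    secondSum : ∀ d J → suc d ℕ.< 2 ℕ.* suc J →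
      ∑≤ J (λ j → τ j (binomial (suc d ∸ 2 ℕ.* j) (∑ (blocks d j) φ)) k) ≈
      τ 1 (weighted⁻ d φᴺ) k
    secondSum zero J _ = ≈-trans
      (∑-zero (upTo (suc J)) λ {j} _ → τ-zero j k λ k → binomial-zero (1 ∸ 2 ℕ.* j) k ≈-refl)
      (≈-sym (τ-zero 1 k λ _ → ≈-refl))
    secondSum (suc d) zero (s≤s (s≤s ()))
    secondSum (suc d) (suc J) p = begin
      _ ≈⟨ ∑-upTo-suc (suc J) _ ⟩
      _ ≈⟨ +-cong (binomial-zero (2 ℕ.+ d) k ≈-refl) (∑-cong-ext (upTo (suc J)) term) ⟩
      0# + ∑≤ J (λ j → τ 1 (τ j (binomial (d ∸ 2 ℕ.* j) (∑ (steps d j) φᴺ))) k)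
        ≈⟨ +-identityˡ _ ⟩
      _ ≈⟨ τ-∑ (upTo (suc J)) _ 1 k ⟨
      _ ≈⟨ τ-cong 1 k (weighted≈binomials d J
             (ℕ.s≤s⁻¹ (ℕ.s≤s⁻¹ (subst (2 ℕ.+ d ℕ.<_) (cong suc (ℕ.+-suc (suc J) _)) p))) φᴺ) ⟩
      _ ∎
      where
      term : ∀ j → τ (suc j) (binomial (2 ℕ.+ d ∸ 2 ℕ.* suc j) (∑ (blocks (suc d) (suc j)) φ)) k ≈
                   τ 1 (τ j (binomial (d ∸ 2 ℕ.* j) (∑ (steps d j) φᴺ))) k
      term j = begin
        _ ≡⟨ cong (λ e → τ (suc j) (binomial (suc d ∸ e) (∑ (blocks (suc d) (suc j)) φ)) k)
               (ℕ.+-suc j (j ℕ.+ 0)) ⟩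
        _ ≡⟨ cong (λ x → τ (suc j) (binomial (d ∸ 2 ℕ.* j) x) k) (∑-map _ (steps d j) φ) ⟩
        _ ≈⟨ τ-τ′ _ j k ⟨
        _ ∎

-- The equation for Q, coefficient by coefficient

module PolynomialCoefficients {c ℓ₁ ℓ₂} (K : CommutativeRing c ℓ₁)
                              (_≤_ : Rel (CommutativeRing.Carrier K) ℓ₂) where

  open FiniteSums K
  open SeriesProperties K
  open RibbonSeries K
  open Coefficients K
  module SF = SymmetricFunctions rawRing _≤_
  open SF using (coeff; addᴾ; mulᴾ)
  open RawSemiringOps SF.Poly.rawSemiring using (_^_)
  private
    module CM = CommutativeMonoidSolver +-commutativeMonoid
    h = completeHomogeneous

  coeff-+ : ∀ p q k α → coeff (addᴾ p q) k α ≈ coeff p k α + coeff q k α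
  coeff-+ []      q       k       α = ≈-sym (+-identityˡ _)
  coeff-+ (a ∷ p) []      k       α = ≈-sym (+-identityʳ _)
  coeff-+ (a ∷ p) (b ∷ q) zero    α = ≈-refl
  coeff-+ (a ∷ p) (b ∷ q) (suc k) α = coeff-+ p q k α

  coeff-neg : ∀ p k α → coeff (SF.Poly.- p) k α ≈ - coeff p k α
  coeff-neg []      k       α = ≈-sym -0#≈0#
  coeff-neg (a ∷ p) zero    α = ≈-refl
  coeff-neg (a ∷ p) (suc k) α = coeff-neg p k α

  coeff-scale : ∀ f p k α → coeff (map (mulˢ f) p) k α ≈ mulˢ f (coeff p k) α
  coeff-scale f []      k       α = ≈-sym (mulˢ-zeroʳ f α (λ _ → ≈-refl))
  coeff-scale f (a ∷ p) zero    α = ≈-refl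
  coeff-scale f (a ∷ p) (suc k) α = coeff-scale f p k α

  coeff-* : ∀ p q k α →
    coeff (mulᴾ p q) k α ≈ ∑≤ k λ i → mulˢ (coeff p i) (coeff q (k ∸ i)) α
  coeff-* []      q k       α = ≈-sym (∑-zero (upTo (suc k)) λ _ → mulˢ-zeroˡ _ α λ _ → ≈-refl)
  coeff-* (a ∷ p) q zero    α = ≈-trans (coeff-+ (map (mulˢ a) q) _ 0 α)
    (+-congʳ (coeff-scale a q 0 α))
  coeff-* (a ∷ p) q (suc k) α = begin
    coeff (mulᴾ (a ∷ p) q) (suc k) α ≈⟨ coeff-+ (map (mulˢ a) q) _ (suc k) α ⟩
    coeff (map (mulˢ a) q) (suc k) α + coeff (mulᴾ p q) k α
      ≈⟨ +-cong (coeff-scale a q (suc k) α) (coeff-* p q k α) ⟩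
    _ ≈⟨ ∑-upTo-suc (suc k) _ ⟨
    _ ∎

  coeff-∑ : ∀ {a} {A : Set a} (xs : List A) f k α →
    coeff (Sums.∑ SF.polynomialRing xs f) k α ≈ ∑ xs λ x → coeff (f x) k α
  coeff-∑ []       f k α = ≈-refl
  coeff-∑ (x ∷ xs) f k α = ≈-trans (coeff-+ (f x) _ k α) (+-congˡ (coeff-∑ xs f k α))

  -- `τ m (δ (f β))` is the coefficient sequence of the monomial f t^m, and the sum over `i` is the
  -- Cauchy product in t.
  convolution-monomialʳ : ∀ (q : ℕ → Series) m f k α →
    ∑≤ k (λ i → mulˢ (q i) (λ β → τ m (δ (f β)) (k ∸ i)) α) ≈ τ m (λ k → mulˢ (q k) f α) k
  convolution-monomialʳ q zero f k α = begin
    _ ≈⟨ ∑-upTo-last k _ ⟩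
    _ ≈⟨ +-cong (∑-zero (upTo k) λ {i} i∈ → mulˢ-zeroʳ _ α λ β →
           reflexive (cong (δ (f β)) (sym (ℕ.suc-pred (k ∸ i) {{ℕ.>-nonZero (ℕ.m<n⇒0<n∸m (∈-upTo⁻ i∈))}}))))
         (mulˢ-congʳ α λ β _ → reflexive (cong (δ (f β)) (ℕ.n∸n≡0 k))) ⟩
    _ ≈⟨ +-identityˡ _ ⟩
    _ ∎
  convolution-monomialʳ q (suc m) f zero    α =
    ≈-trans (+-identityʳ _) (mulˢ-zeroʳ _ α λ _ → ≈-refl)
  convolution-monomialʳ q (suc m) f (suc k) α = begin
    _ ≈⟨ ∑-upTo-last (suc k) _ ⟩
    _ ≈⟨ +-cong
      (∑-cong (upTo (suc k)) λ {i} i∈ → mulˢ-congʳ α λ β _ → reflexive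
        (cong (τ (suc m) (δ (f β))) (ℕ.+-∸-assoc 1 (ℕ.s≤s⁻¹ (∈-upTo⁻ i∈)))))
      (mulˢ-zeroʳ _ α λ β → reflexive (cong (τ (suc m) (δ (f β))) (ℕ.n∸n≡0 k))) ⟩
    _ ≈⟨ +-identityʳ _ ⟩
    _ ≈⟨ convolution-monomialʳ q m f k α ⟩
    _ ∎

  convolution-monomialˡ : ∀ (q : ℕ → Series) m f k α →
    ∑≤ k (λ i → mulˢ (λ β → τ m (δ (f β)) i) (q (k ∸ i)) α) ≈ τ m (λ k → mulˢ f (q k) α) k
  convolution-monomialˡ q zero f k α = begin
    _ ≈⟨ ∑-upTo-suc k _ ⟩
    _ ≈⟨ +-congˡ (∑-zero (upTo k) λ _ → mulˢ-zeroˡ _ α λ _ → ≈-refl) ⟩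
    _ ≈⟨ +-identityʳ _ ⟩
    _ ∎
  convolution-monomialˡ q (suc m) f zero    α =
    ≈-trans (+-identityʳ _) (mulˢ-zeroˡ _ α λ _ → ≈-refl)
  convolution-monomialˡ q (suc m) f (suc k) α = begin
    _ ≈⟨ ∑-upTo-suc (suc k) _ ⟩
    _ ≈⟨ +-cong (mulˢ-zeroˡ _ α λ _ → ≈-refl) (convolution-monomialˡ q m f k α) ⟩
    _ ≈⟨ +-identityˡ _ ⟩
    _ ∎

  coeff-const : ∀ f k α → coeff (SF.const f) k α ≈ δ (f α) k
  coeff-const f zero    α = ≈-refl
  coeff-const f (suc k) α = ≈-refl

  coeff-t : ∀ k α → coeff SF.t k α ≈ τ 1 (δ (h 0 α)) k
  coeff-t zero          α = ≈-refl
  coeff-t (suc zero)    α = ≈-refl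
  coeff-t (suc (suc k)) α = ≈-refl

  coeff-t* : ∀ p k α → coeff (mulᴾ SF.t p) k α ≈ τ 1 (λ k → coeff p k α) k
  coeff-t* p k α = begin
    coeff (mulᴾ SF.t p) k α ≈⟨ coeff-* SF.t p k α ⟩
    _ ≈⟨ ∑-cong-ext (upTo (suc k)) (λ i → mulˢ-congˡ α λ β _ → coeff-t i β) ⟩
    _ ≈⟨ convolution-monomialˡ (coeff p) 1 (h 0) k α ⟩
    _ ≈⟨ τ-cong 1 k (λ k → mulˢ-identityˡ (coeff p k) α) ⟩
    _ ∎

  coeff-t^ : ∀ m k α → coeff (SF.t ^ m) k α ≈ τ m (δ (h 0 α)) k
  coeff-t^ zero    k α = coeff-const (h 0) k α
  coeff-t^ (suc m) k α = begin
    _ ≈⟨ coeff-t* (SF.t ^ m) k α ⟩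
    _ ≈⟨ τ-cong 1 k (λ k → coeff-t^ m k α) ⟩
    _ ≈⟨ τ-τ′ _ m k ⟩
    _ ∎

  coeff-*const : ∀ p f k α → coeff (mulᴾ p (SF.const f)) k α ≈ mulˢ (coeff p k) f α
  coeff-*const p f k α = begin
    _ ≈⟨ coeff-* p (SF.const f) k α ⟩
    _ ≈⟨ ∑-cong-ext (upTo (suc k)) (λ i → mulˢ-congʳ α λ β _ → coeff-const f (k ∸ i) β) ⟩
    _ ≈⟨ convolution-monomialʳ (coeff p) 0 f k α ⟩
    _ ∎

  mulˢ-monomial : ∀ m f k α → mulˢ (λ β → τ m (δ (h 0 β)) k) f α ≈ τ m (δ (f α)) k
  mulˢ-monomial zero    f zero    α = mulˢ-identityˡ f α
  mulˢ-monomial zero    f (suc k) α = mulˢ-zeroˡ f α (λ _ → ≈-refl)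
  mulˢ-monomial (suc m) f zero    α = mulˢ-zeroˡ f α (λ _ → ≈-refl)
  mulˢ-monomial (suc m) f (suc k) α = mulˢ-monomial m f k α

  mulˢ-monomialʳ : ∀ m f k α → mulˢ f (λ β → τ m (δ (h 0 β)) k) α ≈ τ m (δ (f α)) k
  mulˢ-monomialʳ zero    f zero    α = mulˢ-identityʳ f α
  mulˢ-monomialʳ zero    f (suc k) α = mulˢ-zeroʳ f α (λ _ → ≈-refl)
  mulˢ-monomialʳ (suc m) f zero    α = mulˢ-zeroʳ f α (λ _ → ≈-refl)
  mulˢ-monomialʳ (suc m) f (suc k) α = mulˢ-monomialʳ m f k α

  coeff-t^*const : ∀ m f k α → coeff (mulᴾ (SF.t ^ m) (SF.const f)) k α ≈ τ m (δ (f α)) k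
  coeff-t^*const m f k α = begin
    _ ≈⟨ coeff-*const (SF.t ^ m) f k α ⟩
    _ ≈⟨ mulˢ-congˡ α (λ β _ → coeff-t^ m k β) ⟩
    _ ≈⟨ mulˢ-monomial m f k α ⟩
    _ ∎

  coeff-t*const : ∀ f k α → coeff (mulᴾ SF.t (SF.const f)) k α ≈ τ 1 (δ (f α)) k
  coeff-t*const f k α = ≈-trans (coeff-t* (SF.const f) k α) (τ-cong 1 k λ k → coeff-const f k α)

  coeff-binomial : ∀ f e k α →
    mulˢ f (coeff ((SF.Poly.1# SF.Poly.+ SF.t) ^ e) k) α ≈ binomial e (f α) k
  coeff-binomial f zero    k α =
    ≈-trans (mulˢ-congʳ α λ β _ → coeff-const (h 0) k β) (mulˢ-monomialʳ 0 f k α)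
  coeff-binomial f (suc e) k α = begin
    mulˢ f (coeff (mulᴾ p (p ^ e)) k) α ≈⟨ mulˢ-congʳ α (λ β _ → expand β) ⟩
    mulˢ f (λ β → coeff (p ^ e) k β + τ 1 (λ k → coeff (p ^ e) k β) k) α
      ≈⟨ mulˢ-distribˡ f _ _ α ⟩
    mulˢ f (coeff (p ^ e) k) α + mulˢ f (λ β → τ 1 (λ k → coeff (p ^ e) k β) k) α
      ≈⟨ +-cong (coeff-binomial f e k α) (second k) ⟩
    binomial (suc e) (f α) k ∎
    where
    p = SF.Poly.1# SF.Poly.+ SF.t
    expand : ∀ β → coeff (mulᴾ p (p ^ e)) k β ≈
                   coeff (p ^ e) k β + τ 1 (λ k → coeff (p ^ e) k β) k
    expand β = begin
      _ ≈⟨ coeff-* p (p ^ e) k β ⟩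
      _ ≈⟨ ∑-cong-ext (upTo (suc k)) (λ i → ≈-trans
             (mulˢ-congˡ β λ β _ → ≈-trans (coeff-+ SF.Poly.1# SF.t i β)
               (+-cong (coeff-const (h 0) i β) (coeff-t i β)))
             (mulˢ-distribʳ (coeff (p ^ e) (k ∸ i)) _ _ β)) ⟩
      _ ≈⟨ ∑-+ (upTo (suc k)) _ _ ⟩
      _ ≈⟨ +-cong (convolution-monomialˡ (coeff (p ^ e)) 0 (h 0) k β)
                  (convolution-monomialˡ (coeff (p ^ e)) 1 (h 0) k β) ⟩
      _ ≈⟨ +-cong (mulˢ-identityˡ _ β) (τ-cong 1 k λ k → mulˢ-identityˡ _ β) ⟩
      _ ∎
    second : ∀ k → mulˢ f (λ β → τ 1 (λ k → coeff (p ^ e) k β) k) α ≈ τ 1 (binomial e (f α)) k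
    second zero    = mulˢ-zeroʳ f α (λ _ → ≈-refl)
    second (suc k) = coeff-binomial f e k α

  coeff-γ-expansion : ∀ d g k α → coeff (SF.γ-expansion d g) k α ≈
    ∑≤ ⌊ d /2⌋ λ j → τ j (binomial (d ∸ 2 ℕ.* j) (g j α)) k
  coeff-γ-expansion d g k α = ≈-trans (coeff-∑ (upTo (suc ⌊ d /2⌋))
      (λ j → mulᴾ (mulᴾ (SF.const (g j)) (SF.t ^ j)) (p ^ (d ∸ 2 ℕ.* j))) k α)
    (∑-cong-ext (upTo (suc ⌊ d /2⌋)) λ j → begin
      _ ≈⟨ coeff-* (mulᴾ (SF.const (g j)) (SF.t ^ j)) (p ^ (d ∸ 2 ℕ.* j)) k α ⟩
      _ ≈⟨ ∑-cong-ext (upTo (suc k)) (λ i → mulˢ-congˡ α λ β _ → monomial j i β) ⟩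
      _ ≈⟨ convolution-monomialˡ (coeff (p ^ (d ∸ 2 ℕ.* j))) j (g j) k α ⟩
      _ ≈⟨ τ-cong j k (λ k → coeff-binomial (g j) (d ∸ 2 ℕ.* j) k α) ⟩
      _ ∎)
    where
    p = SF.Poly.1# SF.Poly.+ SF.t
    monomial : ∀ j i β → coeff (mulᴾ (SF.const (g j)) (SF.t ^ j)) i β ≈ τ j (δ (g j β)) i
    monomial j i β = begin
      _ ≈⟨ coeff-* (SF.const (g j)) (SF.t ^ j) i β ⟩
      _ ≈⟨ ∑-cong-ext (upTo (suc i)) (λ l → mulˢ-cong β
             (λ β _ → coeff-const (g j) l β) (λ β _ → coeff-t^ j (i ∸ l) β)) ⟩
      _ ≈⟨ convolution-monomialˡ (λ i β → τ j (δ (h 0 β)) i) 0 (g j) i β ⟩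
      _ ≈⟨ mulˢ-monomialʳ j (g j) i β ⟩
      _ ∎

  -- the coefficient of z ^ n t ^ k in Q (H(tz) - t H(z)) = (1 - t) H(z), with
  -- the negative terms moved to the other side
  Equation : (ℕ → ℕ → Series) → ℕ → ℕ → List ℕ → Set ℓ₁
  Equation q n k α =
    ∑≤ n (λ i → τ (n ∸ i) (λ k → mulˢ (q i k) (h (n ∸ i)) α) k) + τ 1 (δ (h n α)) k ≈
    ∑≤ n (λ i → τ 1 (λ k → mulˢ (q i k) (h (n ∸ i)) α) k) + δ (h n α) k

  private
    move : ∀ {a b x y} → a - b ≈ x - y → a + y ≈ b + x
    move {a} {b} {x} {y} eq = begin
      a + y                 ≈⟨ +-congʳ (+-identityʳ a) ⟨
      (a + 0#) + y          ≈⟨ +-congʳ (+-congˡ (-‿inverseˡ b)) ⟨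
      (a + (- b + b)) + y   ≈⟨ +-congʳ (+-assoc a (- b) b) ⟨
      ((a - b) + b) + y     ≈⟨ +-congʳ (+-congʳ eq) ⟩
      ((x - y) + b) + y     ≈⟨ CM.solve 4 (λ x y′ b y →
        ((((x ⊕ y′) ⊕ b) ⊕ y) ⊜ ((b ⊕ x) ⊕ (y′ ⊕ y)))) ≈-refl x (- y) b y ⟩
      (b + x) + (- y + y)   ≈⟨ +-congˡ (-‿inverseˡ y) ⟩
      (b + x) + 0#          ≈⟨ +-identityʳ _ ⟩
      b + x                 ∎
      where open CM using (_⊕_; _⊜_)

  IsQ⇒Equation : ∀ {Q} → SF.IsQ Q → ∀ n k α → Equation (λ i → coeff (Q i)) n k α
  IsQ⇒Equation {Q} isQ n k α = move (begin
    ∑≤ n A - ∑≤ n B ≈⟨ +-congˡ (∑-neg (upTo (suc n)) B) ⟨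
    ∑≤ n A + ∑≤ n (λ i → - B i) ≈⟨ ∑-+ (upTo (suc n)) _ _ ⟨
    ∑≤ n (λ i → A i - B i) ≈⟨ ∑-cong-ext (upTo (suc n)) lhs ⟨
    ∑≤ n (λ i → coeff (mulᴾ (Q i) (D (n ∸ i))) k α) ≈⟨ coeff-∑ (upTo (suc n)) (λ i → mulᴾ (Q i) (D (n ∸ i))) k α ⟨
    coeff ((Q SF.PS.* D) n) k α ≈⟨ SF.IsQ.generating-function isQ n k α ⟩
    coeff (((SF.PS.1# SF.PS.+ SF.PS.- SF.constant SF.t) SF.PS.* SF.H) n) k α ≈⟨ rhs ⟩
    δ (h n α) k - τ 1 (δ (h n α)) k ∎)
    where
    D = SF.rescale SF.t SF.H SF.PS.+ SF.PS.- (SF.constant SF.t SF.PS.* SF.H)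
    A = λ i → τ (n ∸ i) (λ k → mulˢ (coeff (Q i) k) (h (n ∸ i)) α) k
    B = λ i → τ 1 (λ k → mulˢ (coeff (Q i) k) (h (n ∸ i)) α) k

    tH : ∀ j k β → coeff ((SF.constant SF.t SF.PS.* SF.H) j) k β ≈ τ 1 (δ (h j β)) k
    tH j k β = begin
      _ ≈⟨ coeff-∑ (upTo (suc j)) (λ i → mulᴾ (SF.constant SF.t i) (SF.H (j ∸ i))) k β ⟩
      _ ≈⟨ ∑-upTo-suc j _ ⟩
      _ ≈⟨ +-cong (coeff-t*const (h j) k β) (∑-zero (upTo j) λ _ → ≈-refl) ⟩
      _ ≈⟨ +-identityʳ _ ⟩
      _ ∎

    coeff-D : ∀ j k β → coeff (D j) k β ≈ τ j (δ (h j β)) k - τ 1 (δ (h j β)) k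
    coeff-D j k β = ≈-trans (coeff-+ (mulᴾ (SF.t ^ j) (SF.H j)) _ k β)
      (+-cong (coeff-t^*const j (h j) k β)
        (≈-trans (coeff-neg ((SF.constant SF.t SF.PS.* SF.H) j) k β) (-‿cong (tH j k β))))

    lhs : ∀ i → coeff (mulᴾ (Q i) (D (n ∸ i))) k α ≈ A i - B i
    lhs i = begin
      _ ≈⟨ coeff-* (Q i) (D (n ∸ i)) k α ⟩
      _ ≈⟨ ∑-cong-ext (upTo (suc k)) (λ l → ≈-trans
             (mulˢ-congʳ α λ β _ → coeff-D (n ∸ i) (k ∸ l) β)
             (≈-trans (mulˢ-distribˡ (coeff (Q i) l) _ _ α)
               (+-congˡ (mulˢ-negʳ (coeff (Q i) l) _ α)))) ⟩
      _ ≈⟨ ∑-+ (upTo (suc k)) _ _ ⟩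
      _ ≈⟨ +-cong (convolution-monomialʳ (coeff (Q i)) (n ∸ i) (h (n ∸ i)) k α)
             (≈-trans (∑-neg (upTo (suc k)) _)
               (-‿cong (convolution-monomialʳ (coeff (Q i)) 1 (h (n ∸ i)) k α))) ⟩
      A i - B i ∎

    rhs : coeff (((SF.PS.1# SF.PS.+ SF.PS.- SF.constant SF.t) SF.PS.* SF.H) n) k α ≈
          δ (h n α) k - τ 1 (δ (h n α)) k
    rhs = begin
      _ ≈⟨ coeff-∑ (upTo (suc n)) (λ i → mulᴾ ((SF.PS.1# SF.PS.+ SF.PS.- SF.constant SF.t) i) (SF.H (n ∸ i))) k α ⟩
      _ ≈⟨ ∑-upTo-suc n _ ⟩
      _ ≈⟨ +-cong (coeff-*const (SF.Poly.1# SF.Poly.+ SF.Poly.- SF.t) (h n) k α)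
                  (∑-zero (upTo n) λ _ → ≈-refl) ⟩
      _ ≈⟨ +-identityʳ _ ⟩
      _ ≈⟨ mulˢ-congˡ α (λ β _ → ≈-trans (coeff-+ SF.Poly.1# (SF.Poly.- SF.t) k β)
             (+-cong (coeff-const (h 0) k β)
               (≈-trans (coeff-neg SF.t k β) (-‿cong (coeff-t k β))))) ⟩
      _ ≈⟨ mulˢ-distribʳ (h n) _ _ α ⟩
      _ ≈⟨ +-cong (mulˢ-monomial 0 (h n) k α)
             (≈-trans (mulˢ-negˡ (h n) _ α) (-‿cong (mulˢ-monomial 1 (h n) k α))) ⟩
      _ ∎
      where
      mulˢ-negˡ : ∀ f g α → mulˢ (λ β → - g β) f α ≈ - mulˢ g f α
      mulˢ-negˡ f g []      = ≈-sym (-‿distribˡ-* _ _)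
      mulˢ-negˡ f g (a ∷ α) = ≈-trans
        (∑-cong-ext (upTo (suc a)) λ i → mulˢ-negˡ _ _ α) (∑-neg (upTo (suc a)) _)

  -- In z-degree n the unknown enters as (1 - t) q_n, everything else being known from lower
  -- degrees. The factor is not invertible, but its constant term is 1: on the right-hand side q_n
  -- is multiplied by t, so its coefficient at t^k is expressed through the one at t^(k - 1). Hence
  -- the second recursion, on `k`.
  Equation-unique : ∀ {q q′} → (∀ n k α → Equation q n k α) → (∀ n k α → Equation q′ n k α) →
    ∀ n k α → q n k α ≈ q′ n k α
  Equation-unique {q} {q′} eq eq′ = <-rec _ λ n IH → byDegree n (λ i i<n k α → IH {i} i<n k α)
    where
    byDegree : ∀ n → (∀ i → i ℕ.< n → ∀ k α → q i k α ≈ q′ i k α) → ∀ k α → q n k α ≈ q′ n k α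
    byDegree n IH k α = +-cancelʳ (S + X) _ _ (begin
      q n k α + (S + X) ≈⟨ leading q ≈-refl ⟩
      L q + X           ≈⟨ eq n k α ⟩
      R q + Y           ≈⟨ R≈R k ⟩
      R q′ + Y          ≈⟨ eq′ n k α ⟨
      L q′ + X          ≈⟨ leading q′ S≈S ⟨
      q′ n k α + (S + X) ∎)
      where
      X = τ 1 (δ (h n α)) k
      Y = δ (h n α) k
      l = λ q i → τ (n ∸ i) (λ k → mulˢ (q i k) (h (n ∸ i)) α) k
      r = λ q k i → τ 1 (λ k → mulˢ (q i k) (h (n ∸ i)) α) k
      L = λ q → ∑≤ n (l q)
      R = λ q → ∑≤ n (r q k)
      S = ∑ (upTo n) (l q)
      S≈S : S ≈ ∑ (upTo n) (l q′)
      S≈S = ∑-cong (upTo n) λ {i} i∈ → τ-cong (n ∸ i) k λ k →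
        mulˢ-congˡ α λ β _ → IH i (∈-upTo⁻ i∈) k β
      leading : ∀ q → S ≈ ∑ (upTo n) (l q) → q n k α + (S + X) ≈ L q + X
      leading q p = begin
        q n k α + (S + X) ≈⟨ +-assoc _ _ _ ⟨
        (q n k α + S) + X ≈⟨ +-congʳ (+-comm _ _) ⟩
        (S + q n k α) + X ≈⟨ +-congʳ (+-cong p (≈-sym last≈)) ⟩
        (∑ (upTo n) (l q) + l q n) + X ≈⟨ +-congʳ (∑-upTo-last n (l q)) ⟨
        L q + X           ∎
        where
        last≈ : l q n ≈ q n k α
        last≈ rewrite ℕ.n∸n≡0 n = mulˢ-identityʳ (q n k) α
      R≈R : ∀ k → ∑≤ n (r q k) + δ (h n α) k ≈ ∑≤ n (r q′ k) + δ (h n α) k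
      R≈R zero    = ≈-refl
      R≈R (suc k) = +-congʳ (≈-trans (∑-upTo-last n _) (≈-trans (+-cong
        (∑-cong (upTo n) λ {i} i∈ → mulˢ-congˡ α λ β _ → IH i (∈-upTo⁻ i∈) k β)
        (mulˢ-congˡ α λ β _ → byDegree n IH k β)) (≈-sym (∑-upTo-last n _))))

  weighted-* : ∀ d f k (φ : List Direction → Series) α →
    mulˢ (λ β → weighted d (λ u → φ u β) k) f α ≈ weighted d (λ u → mulˢ (φ u) f α) k
  weighted-* zero          f zero    φ α = ≈-refl
  weighted-* zero          f (suc k) φ α = mulˢ-zeroˡ f α (λ _ → ≈-refl)
  weighted-* (suc d)       f k       φ α = begin
    _ ≈⟨ mulˢ-distribʳ f _ _ α ⟩
    _ ≈⟨ +-congʳ (mulˢ-distribʳ f _ _ α) ⟩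
    _ ≈⟨ +-cong (+-cong (weighted-* d f k _ α) (delayed k)) (delayed⁻ d k) ⟩
    _ ∎
    where
    delayed : ∀ k → mulˢ (λ β → τ 1 (weighted d (λ u → φ (east ∷ u) β)) k) f α ≈
                    τ 1 (weighted d (λ u → mulˢ (φ (east ∷ u)) f α)) k
    delayed zero    = mulˢ-zeroˡ f α (λ _ → ≈-refl)
    delayed (suc k) = weighted-* d f k _ α
    delayed⁻ : ∀ d k → mulˢ (λ β → τ 1 (weighted⁻ d (λ u → φ (east ∷ north ∷ u) β)) k) f α ≈
                       τ 1 (weighted⁻ d (λ u → mulˢ (φ (east ∷ north ∷ u)) f α)) k
    delayed⁻ d       zero    = mulˢ-zeroˡ f α (λ _ → ≈-refl)
    delayed⁻ zero    (suc k) = mulˢ-zeroˡ f α (λ _ → ≈-refl)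
    delayed⁻ (suc d) (suc k) = weighted-* d f k _ α

  -- The candidate for Q: a ribbon with n cells has n - 1 steps, and in degree 0 stands the constant
  -- 1.
  ribbonSum : ℕ → ℕ → Series
  ribbonSum zero    k α = δ (h 0 α) k
  ribbonSum (suc d) k α = weighted d (λ u → ribbon u α) k

  -- Multiplying the term of degree i + 1 by h_(N - i) glues a row to the ribbon in two ways, which
  -- gives `a i` plus `b (suc i)`. Splitting off the first block after the prefix of `a (suc i)`
  -- gives the recurrence required by `telescope`. At the two ends stand `a 0`, a single row, and
  -- `a N`, the sum of degree N + 1.
  ribbonSum-Equation : ∀ n k α → Equation ribbonSum n k α
  ribbonSum-Equation zero k α = begin
    (mulˢ (λ β → δ (h 0 β) k) (h 0) α + 0#) + τ 1 (δ (h 0 α)) k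
      ≈⟨ +-cong (≈-trans (+-identityʳ _) (mulˢ-monomial 0 (h 0) k α)) ≈-refl ⟩
    δ (h 0 α) k + τ 1 (δ (h 0 α)) k ≈⟨ +-comm _ _ ⟩
    τ 1 (δ (h 0 α)) k + δ (h 0 α) k
      ≈⟨ +-congʳ (≈-trans (+-identityʳ _) (τ-cong 1 k λ k → mulˢ-monomial 0 (h 0) k α)) ⟨
    _ ∎
  ribbonSum-Equation (suc N) k α = begin
    ∑≤ (suc N) lhs + τ 1 (δ (h (suc N) α)) k
      ≈⟨ +-congʳ (≈-trans (∑-upTo-suc (suc N) lhs) (+-cong
           (τ-cong (suc N) k λ k → mulˢ-monomial 0 (h (suc N)) k α)
           (≈-trans (∑-upTo-last N (lhs ∘ suc)) (+-cong (∑-cong (upTo N) innerˡ) lastˡ)))) ⟩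
    (T₀ + (S + A)) + U ≈⟨ CM.solve 4 (λ t s a u → (((t ⊕ (s ⊕ a)) ⊕ u) ⊜ (((a ⊕ s) ⊕ t) ⊕ u)))
                            ≈-refl T₀ S A U ⟩
    ((A + S) + T₀) + U ≈⟨ +-congʳ (+-congˡ (≈-trans
      (+-cong (τ-cong (suc N) k a₀) (τ-zero (suc N) k λ _ → ≈-refl)) (+-identityʳ _))) ⟨
    ((A + S) + (τ (suc N) (a 0) k + τ (suc N) (b 0) k)) + U ≈⟨ +-congʳ (telescope N a b rec k) ⟩
    ((τ 1 (a N) k + S′) + (a 0 k + τ 1 (b 0) k)) + U
      ≈⟨ +-congʳ (+-congˡ (≈-trans (+-cong (a₀ k) (τ-zero 1 k λ _ → ≈-refl)) (+-identityʳ _))) ⟩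
    ((τ 1 (a N) k + S′) + V) + U ≈⟨ CM.solve 4 (λ t s v u →
      (((t ⊕ s) ⊕ v) ⊕ u) ⊜ ((u ⊕ (s ⊕ t)) ⊕ v)) ≈-refl (τ 1 (a N) k) S′ V U ⟩
    (U + (S′ + τ 1 (a N) k)) + V
      ≈⟨ +-congʳ (≈-trans (∑-upTo-suc (suc N) rhs) (+-cong
           (τ-cong 1 k λ k → mulˢ-monomial 0 (h (suc N)) k α)
           (≈-trans (∑-upTo-last N (rhs ∘ suc)) (+-cong (∑-cong (upTo N) innerʳ) lastʳ)))) ⟨
    ∑≤ (suc N) rhs + δ (h (suc N) α) k ∎
    where
    open CM using (_⊕_; _⊜_)
    lhs = λ i → τ (suc N ∸ i) (λ k → mulˢ (ribbonSum i k) (h (suc N ∸ i)) α) k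
    rhs = λ i → τ 1 (λ k → mulˢ (ribbonSum i k) (h (suc N ∸ i)) α) k
    -- All these ribbons have N + 1 cells. They start with N - i forced east steps, which carry no
    -- weight; in `b i` the prefix ends at a north step.
    a b : ℕ → Sequence
    a i = weighted i λ u → ribbon (replicate (N ∸ i) east ++ u) α
    b i = weighted⁻ i λ u → ribbon (replicate (N ∸ i) east ++ north ∷ u) α
    A  = a N k
    S  = ∑ (upTo N) λ i → τ (N ∸ i) (a i) k + τ (N ∸ i) (b (suc i)) k
    S′ = ∑ (upTo N) λ i → τ 1 (a i) k + τ 1 (b (suc i)) k
    T₀ = τ (suc N) (δ (h (suc N) α)) k
    U  = τ 1 (δ (h (suc N) α)) k
    V  = δ (h (suc N) α) k

    prefix : ∀ {i} → i ℕ.< N → ∀ u →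
      replicate (N ∸ suc i) east ++ east ∷ u ≡ replicate (N ∸ i) east ++ u
    prefix {i} p u = trans (replicate-snoc (N ∸ suc i) u)
      (cong (λ m → replicate m east ++ u) (sym (ℕ.+-∸-assoc 1 p)))

    rec : ∀ i k → i ℕ.< N → a (suc i) k ≈ (a i k + τ 1 (a i) k) + τ 1 (b i) k
    rec i k p = +-cong (+-cong (weighted-cong i k eq) (τ-cong 1 k λ k → weighted-cong i k eq))
      (τ-cong 1 k λ k → weighted⁻-cong i k λ u → eq (north ∷ u))
      where
      eq : ∀ u → ribbon (replicate (N ∸ suc i) east ++ east ∷ u) α ≈
                 ribbon (replicate (N ∸ i) east ++ u) α
      eq u = reflexive (cong (λ v → ribbon v α) (prefix p u))

    a₀ : ∀ k → a 0 k ≈ δ (h (suc N) α) k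
    a₀ k = δ-cong k (≈-trans (reflexive (cong (λ v → ribbon v α) (++-identityʳ (replicate N east))))
      (ribbon-row N α))

    product : ∀ i → i ℕ.< N → ∀ k →
      mulˢ (ribbonSum (suc i) k) (h (N ∸ i)) α ≈ a i k + b (suc i) k
    product i p k = begin
      _ ≈⟨ weighted-* i (h (N ∸ i)) k ribbon α ⟩
      _ ≈⟨ weighted-cong i k (λ u → ≈-trans
             (reflexive (cong (λ m → mulˢ (ribbon u) (h m) α) (ℕ.+-∸-assoc 1 p)))
             (ribbon-*-h u (N ∸ suc i) α)) ⟩
      _ ≈⟨ weighted-+ _ _ i k ⟩
      _ ≈⟨ +-comm _ _ ⟩
      _ ≈⟨ +-congʳ (weighted-cong i k λ u → reflexive (cong (λ v → ribbon v α) (prefix p u))) ⟩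
      _ ∎

    innerˡ : ∀ {i} → i ∈ upTo N → lhs (suc i) ≈ τ (N ∸ i) (a i) k + τ (N ∸ i) (b (suc i)) k
    innerˡ {i} i∈ = ≈-trans (τ-cong (N ∸ i) k (product i (∈-upTo⁻ i∈))) (τ-+ _ _ (N ∸ i) k)
    innerʳ : ∀ {i} → i ∈ upTo N → rhs (suc i) ≈ τ 1 (a i) k + τ 1 (b (suc i)) k
    innerʳ {i} i∈ = ≈-trans (τ-cong 1 k (product i (∈-upTo⁻ i∈))) (τ-+ _ _ 1 k)

    a-last : ∀ k → mulˢ (ribbonSum (suc N) k) (h (N ∸ N)) α ≈ a N k
    a-last k rewrite ℕ.n∸n≡0 N = mulˢ-identityʳ (ribbonSum (suc N) k) α
    lastˡ : lhs (suc N) ≈ A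
    lastˡ = ≈-trans (reflexive (cong (λ m → τ m (λ k → mulˢ (ribbonSum (suc N) k) (h (N ∸ N)) α) k)
      (ℕ.n∸n≡0 N))) (a-last k)
    lastʳ : rhs (suc N) ≈ τ 1 (a N) k
    lastʳ = τ-cong 1 k a-last

  IsQ⇒ribbonSum : ∀ {Q} → SF.IsQ Q → ∀ n k α → coeff (Q n) k α ≈ ribbonSum n k α
  IsQ⇒ribbonSum isQ = Equation-unique (IsQ⇒Equation isQ) ribbonSum-Equation

-- Tableaux, row by row

module _ {a} {A : Set a} where

  ∈-words⁻ : ∀ {xs : List A} n {w} → w ∈ words xs n → length w ≡ n × All (_∈ xs) w
  ∈-words⁻ zero    (here refl) = refl , []
  ∈-words⁻ {xs} (suc n) w∈ with x , v , x∈ , v∈ , refl ← ∈-cartesianProductWith⁻ _∷_ xs (words xs n) w∈ =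
    cong suc (proj₁ (∈-words⁻ n v∈)) , x∈ ∷ proj₂ (∈-words⁻ n v∈)

  ∈-words⁺ : ∀ {xs : List A} {w} → All (_∈ xs) w → w ∈ words xs (length w)
  ∈-words⁺ []          = here refl
  ∈-words⁺ (x∈ ∷ w∈) = ∈-cartesianProductWith⁺ _∷_ x∈ (∈-words⁺ w∈)

  words-unique : ∀ {xs : List A} n → Unique xs → Unique (words xs n)
  words-unique zero    xs! = [] ∷ []
  words-unique (suc n) xs! = Unique.cartesianProductWith⁺ _∷_ ∷-injective xs! (words-unique n xs!)

module _ {a b p} {A : Set a} {B : Set b} {P : Pred B p} (P? : Decidable P) where

  filter-map : ∀ (f : A → B) xs → filter P? (map f xs) ≡ map f (filter (P? ∘ f) xs)
  filter-map f []       = refl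
  filter-map f (x ∷ xs) with does (P? (f x))
  ... | true  = cong (f x ∷_) (filter-map f xs)
  ... | false = filter-map f xs

map-replicate-local : ∀ {f : ℕ → ℕ} {x xs} → All (λ y → f y ≡ x) xs → map f xs ≡ replicate (length xs) x
map-replicate-local []       = refl
map-replicate-local (p ∷ ps) = cong₂ _∷_ p (map-replicate-local ps)

content-[] : ∀ L → content L [] ≡ replicate L 0
content-[] L = trans (map-replicate-local (All.universal (λ _ → refl) (upTo L)))
  (cong (λ n → replicate n 0) (length-upTo L))

sum-replicate-0 : ∀ n → ℕ.sum (replicate n 0) ≡ 0
sum-replicate-0 zero    = refl
sum-replicate-0 (suc n) = sum-replicate-0 n

range : ℕ → ℕ → List ℕ
range k zero    = []
range k (suc n) = k ∷ range (suc k) n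

applyUpTo-range : ∀ f k n → (∀ i → f i ≡ k ℕ.+ i) → applyUpTo f n ≡ range k n
applyUpTo-range f k zero    eq = refl
applyUpTo-range f k (suc n) eq = cong₂ _∷_ (trans (eq 0) (ℕ.+-identityʳ k))
  (applyUpTo-range (f ∘ suc) (suc k) n (λ i → trans (eq (suc i)) (ℕ.+-suc k i)))

range-≥ : ∀ {b k} n → b ≤ k → All (b ≤_) (range k n)
range-≥ zero    p = []
range-≥ (suc n) p = p ∷ range-≥ n (ℕ.m≤n⇒m≤1+n p)

filter-range : ∀ b k n → k ≤ b → filter (b ℕ.≤?_) (range k n) ≡ range b (k ℕ.+ n ∸ b)
filter-range b k n k≤b with ℕ.m≤n⇒m<n∨m≡n k≤b
... | inj₂ refl = trans (filter-all (b ℕ.≤?_) (range-≥ n ℕ.≤-refl))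
                    (cong (range b) (sym (ℕ.m+n∸m≡n b n)))
filter-range b k zero    k≤b | inj₁ k<b = cong (range b)
  (sym (ℕ.m≤n⇒m∸n≡0 (subst (_≤ b) (sym (ℕ.+-identityʳ k)) k≤b)))
filter-range b k (suc n) k≤b | inj₁ k<b =
  trans (filter-reject (b ℕ.≤?_) (ℕ.<⇒≱ k<b))
    (trans (filter-range b (suc k) n k<b) (cong (λ l → range b (l ∸ b)) (sym (ℕ.+-suc k n))))

filter-upTo : ∀ b a → filter (b ℕ.≤?_) (upTo a) ≡ range b (a ∸ b)
filter-upTo b a = trans (cong (filter (b ℕ.≤?_)) (applyUpTo-range id 0 a (λ _ → refl)))
  (filter-range b 0 a z≤n)

-- the pairs (first column, one past the last column), row by row
rows : List ℕ → List ℕ → List (ℕ × ℕ)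
rows []      i       = []
rows (a ∷ o) []      = (0 , a) ∷ rows o []
rows (a ∷ o) (b ∷ i) = (b , a) ∷ rows o i

width : ℕ × ℕ → ℕ
width (b , a) = a ∸ b

cellsFrom : ℕ → List (ℕ × ℕ) → List Cell
cellsFrom d []              = []
cellsFrom d (p@(b , _) ∷ ps) = map (d ,_) (range b (width p)) ++ cellsFrom (suc d) ps

module _ where
  private
    cellsOf : ℕ → List ℕ → List ℕ → List Cell
    cellsOf d o i = concatMap
      (λ r → map (d ℕ.+ r ,_) (filter (part i r ℕ.≤?_) (upTo (part o r)))) (upTo (length o))

    cellsOf-∷ : ∀ d a o i j → (∀ r → part i (suc r) ≡ part j r) →
      cellsOf d (a ∷ o) i ≡ map (d ,_) (range (part i 0) (a ∸ part i 0)) ++ cellsOf (suc d) o j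
    cellsOf-∷ d a o i j eq = cong₂ _++_
      (cong₂ (λ e → map (e ,_)) (ℕ.+-identityʳ d) (filter-upTo (part i 0) a))
      (trans (cong (concatMap _) (sym (map-applyUpTo id suc (length o))))
        (trans (concatMap-map _ suc (upTo (length o))) (concatMap-cong (λ r → cong₂
          (λ e b → map (e ,_) (filter (b ℕ.≤?_) (upTo (part o r))))
          (ℕ.+-suc d r) (eq r)) (upTo (length o)))))

    cellsOf-rows : ∀ d o i → cellsOf d o i ≡ cellsFrom d (rows o i)
    cellsOf-rows d []      i       = refl
    cellsOf-rows d (a ∷ o) []      = trans (cellsOf-∷ d a o [] [] (λ _ → refl))
      (cong (map (d ,_) (range 0 a) ++_) (cellsOf-rows (suc d) o []))
    cellsOf-rows d (a ∷ o) (b ∷ i) = trans (cellsOf-∷ d a o (b ∷ i) i (λ _ → refl))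
      (cong (map (d ,_) (range b (a ∸ b)) ++_) (cellsOf-rows (suc d) o i))

  cells-rows : ∀ o i → cells (o / i) ≡ cellsFrom 0 (rows o i)
  cells-rows = cellsOf-rows 0

length-range : ∀ k n → length (range k n) ≡ n
length-range k zero    = refl
length-range k (suc n) = cong suc (length-range (suc k) n)

length-cellsFrom : ∀ d ps → length (cellsFrom d ps) ≡ ℕ.sum (map width ps)
length-cellsFrom d []       = refl
length-cellsFrom d (p ∷ ps) = trans (length-++ (map (d ,_) (range (proj₁ p) (width p))))
  (cong₂ ℕ._+_ (trans (length-map _ (range (proj₁ p) (width p))) (length-range _ (width p)))
    (length-cellsFrom (suc d) ps))

rowFill : ℕ → ℕ → List ℕ → Tableau
rowFill d k []      = []
rowFill d k (x ∷ r) = ((d , k) , x) ∷ rowFill d (suc k) r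

-- the rows ρ with first columns bs, from row d on
fillFrom : ℕ → List ℕ → List (List ℕ) → Tableau
fillFrom d []       ρ       = []
fillFrom d (b ∷ bs) []      = []
fillFrom d (b ∷ bs) (r ∷ ρ) = rowFill d b r ++ fillFrom (suc d) bs ρ

zip-fillFrom : ∀ d ps ρ → map length ρ ≡ map width ps →
  zip (cellsFrom d ps) (concat ρ) ≡ fillFrom d (map proj₁ ps) ρ
zip-fillFrom d []             ρ       eq = refl
zip-fillFrom d (p@(b , _) ∷ ps) (r ∷ ρ) eq with eq₁ , eq₂ ← ∷-injective eq =
  trans (zip-row b (width p) r eq₁) (cong (rowFill d b r ++_) (zip-fillFrom (suc d) ps ρ eq₂))
  where
  zip-row : ∀ {ys : List Cell} {w : List ℕ} b n r → length r ≡ n →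
    zip (map (d ,_) (range b n) ++ ys) (r ++ w) ≡ rowFill d b r ++ zip ys w
  zip-row b zero    []      refl = refl
  zip-row b (suc n) (x ∷ r) eq   = cong (_ ∷_) (zip-row (suc b) n r (ℕ.suc-injective eq))

Compatible : Cell × ℕ → Cell × ℕ → Set
Compatible (x , a) (y , b) = (right x ≡ y → a ≤ b) × (below x ≡ y → a < b)

Semistandard : Tableau → Set
Semistandard T = ∀ {p q} → p ∈ T → q ∈ T → Compatible p q

isSemistandard⁻ : ∀ {T} → IsSemistandard T → Semistandard T
isSemistandard⁻ ss p∈ q∈ = All.lookup (All.lookup ss p∈) q∈

isSemistandard⁺ : ∀ {T} → Semistandard T → IsSemistandard T
isSemistandard⁺ ss = All.tabulate λ p∈ → All.tabulate λ q∈ → ss p∈ q∈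

rowFill-row : ∀ d k r {x a} → (x , a) ∈ rowFill d k r → proj₁ x ≡ d
rowFill-row d k (_ ∷ r) (here refl) = refl
rowFill-row d k (_ ∷ r) (there p)   = rowFill-row d (suc k) r p

rowFill-≥ : ∀ d k r {x a} → (x , a) ∈ rowFill d k r → k ≤ proj₂ x
rowFill-≥ d k (_ ∷ r) (here refl) = ℕ.≤-refl
rowFill-≥ d k (_ ∷ r) (there p)   = ℕ.<⇒≤ (rowFill-≥ d (suc k) r p)

fillFrom-≥ : ∀ d bs ρ {x a} → (x , a) ∈ fillFrom d bs ρ → d ≤ proj₁ x
fillFrom-≥ d (b ∷ bs) (r ∷ ρ) p with ∈-++⁻ (rowFill d b r) p
... | inj₁ q = ℕ.≤-reflexive (sym (rowFill-row d b r q))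
... | inj₂ q = ℕ.<⇒≤ (fillFrom-≥ (suc d) bs ρ q)

row-semistandard⁺ : ∀ d k r → Linked _≤_ r → Semistandard (rowFill d k r)
row-semistandard⁺ d k r lk {p} {q} p∈ q∈ =
  (λ e → weak k r lk p∈ (subst (λ y → (y , proj₂ q) ∈ rowFill d k r) (sym e) q∈)) ,
  λ e → ⊥-elim (ℕ.1+n≢n (trans (cong suc (sym (rowFill-row d k r p∈)))
    (trans (cong proj₁ e) (rowFill-row d k r q∈))))
  where
  weak : ∀ k r → Linked _≤_ r → ∀ {x a b} →
    (x , a) ∈ rowFill d k r → (right x , b) ∈ rowFill d k r → a ≤ b
  weak k (x ∷ r)     lk       (there p)   (here e)    = ⊥-elim (ℕ.1+n≰n
    (ℕ.≤-trans (rowFill-≥ d (suc k) r p)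
      (ℕ.≤-trans (ℕ.n≤1+n _) (ℕ.≤-reflexive (cong (proj₂ ∘ proj₁) e)))))
  weak k (x ∷ y ∷ r) (h ∷ lk) (here refl) (there (here refl)) = h
  weak k (x ∷ y ∷ r) (h ∷ lk) (here refl) (there (there q)) =
    ⊥-elim (ℕ.1+n≰n (rowFill-≥ d (2 ℕ.+ k) r q))
  weak k (x ∷ r)     lk       (there p)   (there q)   = weak (suc k) r (Linked.tail lk) p q

row-semistandard⁻ : ∀ d k r → Semistandard (rowFill d k r) → Linked _≤_ r
row-semistandard⁻ d k []          ss = []
row-semistandard⁻ d k (x ∷ [])    ss = [-]
row-semistandard⁻ d k (x ∷ y ∷ r) ss =
  proj₁ (ss (here refl) (there (here refl))) refl ∷
  row-semistandard⁻ d (suc k) (y ∷ r) (λ p q → ss (there p) (there q))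

-- Phrased through filled cells because the two rows may start in different columns.
ColumnStrict : ℕ → ℕ → List ℕ → ℕ → List ℕ → Set
ColumnStrict d k r k′ r′ = ∀ {c x y} →
  ((d , c) , x) ∈ rowFill d k r → ((suc d , c) , y) ∈ rowFill (suc d) k′ r′ → x < y

RowWise : ℕ → List ℕ → List (List ℕ) → Set
RowWise d (b ∷ b′ ∷ bs) (r ∷ r′ ∷ ρ) =
  Linked _≤_ r × ColumnStrict d b r b′ r′ × RowWise (suc d) (b′ ∷ bs) (r′ ∷ ρ)
RowWise d (b ∷ bs)      (r ∷ ρ)      = Linked _≤_ r
RowWise d bs            ρ            = ⊤

private
  compatible-rows : ∀ {x a y b} → suc (proj₁ x) < proj₁ y → Compatible (x , a) (y , b)
  compatible-rows lt =
    (λ e → ⊥-elim (ℕ.<-irrefl (cong proj₁ e) (ℕ.<⇒≤ lt))) ,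
    (λ e → ⊥-elim (ℕ.<-irrefl (cong proj₁ e) lt))

  compatible-below : ∀ {x a y b} → proj₁ y < proj₁ x → Compatible (x , a) (y , b)
  compatible-below lt =
    (λ e → ⊥-elim (ℕ.<-irrefl (sym (cong proj₁ e)) lt)) ,
    (λ e → ⊥-elim (ℕ.<-irrefl (sym (cong proj₁ e)) (ℕ.m≤n⇒m≤1+n lt)))

-- Cells two or more rows apart are never neighbours, and no condition leads from a cell to one
-- above it. So the new row is compared with itself and with the next row only.
semistandard-∷ : ∀ d b r b′ r′ bs ρ → Linked _≤_ r → ColumnStrict d b r b′ r′ →
  Semistandard (fillFrom (suc d) (b′ ∷ bs) (r′ ∷ ρ)) →
  Semistandard (fillFrom d (b ∷ b′ ∷ bs) (r ∷ r′ ∷ ρ))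
semistandard-∷ d b r b′ r′ bs ρ lk col ss {p} {q} p∈ q∈
  with ∈-++⁻ (rowFill d b r) p∈ | ∈-++⁻ (rowFill d b r) q∈
... | inj₁ p∈ | inj₁ q∈ = row-semistandard⁺ d b r lk p∈ q∈
... | inj₂ p∈ | inj₂ q∈ = ss p∈ q∈
... | inj₂ p∈ | inj₁ q∈ = compatible-below
  (subst (_< _) (sym (rowFill-row d b r q∈)) (fillFrom-≥ (suc d) (b′ ∷ bs) (r′ ∷ ρ) p∈))
... | inj₁ p∈ | inj₂ q∈ with ∈-++⁻ (rowFill (suc d) b′ r′) q∈
...   | inj₂ q∈ = compatible-rows (subst (λ e → suc e < _) (sym (rowFill-row d b r p∈))
                    (fillFrom-≥ (2 ℕ.+ d) bs ρ q∈))
...   | inj₁ q∈ =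
  (λ e → ⊥-elim (ℕ.1+n≢n (trans (sym (rowFill-row (suc d) b′ r′ q∈))
    (trans (sym (cong proj₁ e)) (rowFill-row d b r p∈))))) ,
  λ { refl → column (rowFill-row d b r p∈) p∈ q∈ }
  where
  column : ∀ {e c x y} → e ≡ d → ((e , c) , x) ∈ rowFill d b r →
    ((suc e , c) , y) ∈ rowFill (suc d) b′ r′ → x < y
  column refl = col

rowWise⁺ : ∀ d bs ρ → length bs ≡ length ρ → RowWise d bs ρ → Semistandard (fillFrom d bs ρ)
rowWise⁺ d (b ∷ [])      (r ∷ [])     len lk p∈ q∈ =
  row-semistandard⁺ d b r lk
    (subst (_ ∈_) (++-identityʳ (rowFill d b r)) p∈)
    (subst (_ ∈_) (++-identityʳ (rowFill d b r)) q∈)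
rowWise⁺ d (b ∷ b′ ∷ bs) (r ∷ r′ ∷ ρ) len (lk , col , rest) =
  semistandard-∷ d b r b′ r′ bs ρ lk col
    (rowWise⁺ (suc d) (b′ ∷ bs) (r′ ∷ ρ) (ℕ.suc-injective len) rest)

rowWise⁻ : ∀ d bs ρ → length bs ≡ length ρ → Semistandard (fillFrom d bs ρ) → RowWise d bs ρ
rowWise⁻ d []            []           len ss = tt
rowWise⁻ d (b ∷ [])      (r ∷ [])     len ss = row-semistandard⁻ d b r
  (λ p q → ss (∈-++⁺ˡ p) (∈-++⁺ˡ q))
rowWise⁻ d (b ∷ b′ ∷ bs) (r ∷ r′ ∷ ρ) len ss =
  row-semistandard⁻ d b r (λ p q → ss (∈-++⁺ˡ p) (∈-++⁺ˡ q)) ,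
  (λ p q → proj₂ (ss (∈-++⁺ˡ p) (∈-++⁺ʳ (rowFill d b r) (∈-++⁺ˡ q))) refl) ,
  rowWise⁻ (suc d) (b′ ∷ bs) (r′ ∷ ρ) (ℕ.suc-injective len)
    (λ p q → ss (∈-++⁺ʳ (rowFill d b r) p) (∈-++⁺ʳ (rowFill d b r) q))

chunk : List ℕ → List ℕ → List (List ℕ)
chunk []      w = []
chunk (l ∷ ls) w = take l w ∷ chunk ls (drop l w)

concat-chunk : ∀ ls w → length w ≡ ℕ.sum ls → concat (chunk ls w) ≡ w
concat-chunk []       []      eq = refl
concat-chunk (l ∷ ls) w       eq = trans
  (cong (take l w ++_) (concat-chunk ls (drop l w) (trans (length-drop l w)
    (trans (cong (_∸ l) eq) (ℕ.m+n∸m≡n l _)))))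
  (take++drop≡id l w)

map-length-chunk : ∀ ls w → length w ≡ ℕ.sum ls → map length (chunk ls w) ≡ ls
map-length-chunk []       w eq = refl
map-length-chunk (l ∷ ls) w eq = cong₂ _∷_
  (trans (length-take l w) (ℕ.m≤n⇒m⊓n≡m (subst (l ≤_) (sym eq) (ℕ.m≤m+n l _))))
  (map-length-chunk ls (drop l w) (trans (length-drop l w)
    (trans (cong (_∸ l) eq) (ℕ.m+n∸m≡n l _))))

chunk-concat : ∀ ρ → chunk (map length ρ) (concat ρ) ≡ ρ
chunk-concat []      = refl
chunk-concat (r ∷ ρ) = cong₂ _∷_ (take-++ r) (trans (cong (chunk _) (drop-++ r)) (chunk-concat ρ))
  where
  take-++ : ∀ (r : List ℕ) {w} → take (length r) (r ++ w) ≡ r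
  take-++ []      = refl
  take-++ (x ∷ r) = cong (x ∷_) (take-++ r)
  drop-++ : ∀ (r : List ℕ) {w} → drop (length r) (r ++ w) ≡ w
  drop-++ []      = refl
  drop-++ (x ∷ r) = drop-++ r

length-concat : ∀ (ρ : List (List ℕ)) → length (concat ρ) ≡ ℕ.sum (map length ρ)
length-concat []      = refl
length-concat (r ∷ ρ) = trans (length-++ r) (cong (length r ℕ.+_) (length-concat ρ))

record Filling (ps : List (ℕ × ℕ)) (α : List ℕ) (ρ : List (List ℕ)) : Set where
  constructor filling
  field
    shape   : map length ρ ≡ map width ps
    letters : All (_< length α) (concat ρ)
    weight  : content (length α) (concat ρ) ≡ α
    rowWise : RowWise 0 (map proj₁ ps) ρ

hasContent? : ∀ α → Decidable (λ w → content (length α) w ≡ α)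
hasContent? α w = List-≡-dec ℕ._≟_ (content (length α) w) α

-- Built from the same words as `tableaux`, so that the two lists have equal lengths; the separate
-- rows are what the bijections act on.
fillings : SkewDiagram → List ℕ → List (List (List ℕ))
fillings D α = map (chunk (map width (rows (outer D) (inner D))))
  (filter (λ w → isSemistandard? (zip (cells D) w))
    (filter (hasContent? α) (words (upTo (length α)) (size D))))

length-fillings : ∀ D α → length (tableaux D α) ≡ length (fillings D α)
length-fillings D α = trans
  (cong length (filter-map isSemistandard? (zip (cells D)) ws))
  (trans (length-map (zip (cells D)) ws′) (sym (length-map _ ws′)))
  where
  ws  = filter (hasContent? α) (words (upTo (length α)) (size D))
  ws′ = filter (λ w → isSemistandard? (zip (cells D) w)) ws

module _ (D : SkewDiagram) (α : List ℕ) where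
  private
    ps = rows (outer D) (inner D)
    ws = filter (λ w → isSemistandard? (zip (cells D) w))
      (filter (hasContent? α) (words (upTo (length α)) (size D)))

  size-rows : size D ≡ ℕ.sum (map width ps)
  size-rows = trans (cong length (cells-rows (outer D) (inner D))) (length-cellsFrom 0 ps)

  private
    ∈-ws⁻ : ∀ {w} → w ∈ ws → length w ≡ ℕ.sum (map width ps) × All (_< length α) w ×
      content (length α) w ≡ α × IsSemistandard (zip (cells D) w)
    ∈-ws⁻ w∈ =
      let v∈ , ss = ∈-filter⁻ (λ w → isSemistandard? (zip (cells D) w))
                      {xs = filter (hasContent? α) (words (upTo (length α)) (size D))} w∈
          u∈ , co = ∈-filter⁻ (hasContent? α) {xs = words (upTo (length α)) (size D)} v∈
          len , al = ∈-words⁻ (size D) u∈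
      in trans len size-rows , All.map ∈-upTo⁻ al , co , ss

    length-shape : ∀ {ρ : List (List ℕ)} → map length ρ ≡ map width ps → length (map proj₁ ps) ≡ length ρ
    length-shape {ρ} eq = trans (length-map proj₁ ps) (trans (sym (length-map width ps))
      (trans (cong length (sym eq)) (length-map length ρ)))

    fill-eq : ∀ {ρ : List (List ℕ)} → map length ρ ≡ map width ps →
      zip (cells D) (concat ρ) ≡ fillFrom 0 (map proj₁ ps) ρ
    fill-eq {ρ} eq = trans (cong (λ cs → zip cs (concat ρ)) (cells-rows (outer D) (inner D)))
      (zip-fillFrom 0 ps ρ eq)

  fillings-unique : Unique (fillings D α)
  fillings-unique = map-unique (chunk (map width ps)) concat
    (λ {w} w∈ → concat-chunk (map width ps) w (proj₁ (∈-ws⁻ w∈)))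
    (Unique.filter⁺ (λ w → isSemistandard? (zip (cells D) w))
      (Unique.filter⁺ (hasContent? α) (words-unique (size D) (Unique.upTo⁺ (length α)))))

  ∈-fillings⁻ : ∀ {ρ} → ρ ∈ fillings D α → Filling ps α ρ
  ∈-fillings⁻ {ρ} ρ∈ with w , w∈ , refl ← ∈-map⁻ (chunk (map width ps)) ρ∈
                     with len , al , co , ss ← ∈-ws⁻ w∈ = filling shape
    (subst (All _) (sym eq) al)
    (trans (cong (content (length α)) eq) co)
    (rowWise⁻ 0 (map proj₁ ps) _ (length-shape shape)
      (subst Semistandard (trans (cong (zip (cells D)) (sym eq)) (fill-eq shape))
        (isSemistandard⁻ ss)))
    where
    eq = concat-chunk (map width ps) w len
    shape = map-length-chunk (map width ps) w len

  ∈-fillings⁺ : ∀ {ρ} → Filling ps α ρ → ρ ∈ fillings D α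
  ∈-fillings⁺ {ρ} (filling shape al co rw) = subst (_∈ fillings D α)
    (trans (cong (λ ls → chunk ls (concat ρ)) (sym shape)) (chunk-concat ρ))
    (∈-map⁺ (chunk (map width ps)) (∈-filter⁺ (λ w → isSemistandard? (zip (cells D) w))
      (∈-filter⁺ (hasContent? α)
        (subst (λ n → concat ρ ∈ words (upTo (length α)) n)
          (trans (length-concat ρ) (trans (cong ℕ.sum shape) (sym size-rows)))
          (∈-words⁺ (All.map ∈-upTo⁺ al)))
        co)
      (isSemistandard⁺ (subst Semistandard (sym (fill-eq shape))
        (rowWise⁺ 0 (map proj₁ ps) ρ (length-shape shape) rw)))))

-- Horizontal strips

Decreasing : List ℕ → Set
Decreasing = Linked ℕ._≥_

-- κ / λs is a horizontal strip; κ may have one row more than λs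
Strip : List ℕ → List ℕ → Set
Strip []       []          = ⊤
Strip []       (k ∷ [])    = ⊤
Strip []       (_ ∷ _ ∷ _) = ⊥
Strip (_ ∷ _)  []          = ⊥
Strip (l ∷ λs) (k ∷ κ)     = l ≤ k × part κ 0 ≤ l × Strip λs κ

strip? : ∀ λs κ → Dec (Strip λs κ)
strip? []       []          = yes tt
strip? []       (k ∷ [])    = yes tt
strip? []       (_ ∷ _ ∷ _) = no λ ()
strip? (_ ∷ _)  []          = no λ ()
strip? (l ∷ λs) (k ∷ κ)     = (l ℕ.≤? k) ×-dec (part κ 0 ℕ.≤? l) ×-dec strip? λs κ

all≤sum : ∀ xs → All (_< suc (ℕ.sum xs)) xs
all≤sum []       = []
all≤sum (x ∷ xs) = s≤s (ℕ.m≤m+n x _) ∷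
  All.map (λ p → ℕ.<-≤-trans p (s≤s (ℕ.m≤n+m _ x))) (all≤sum xs)

removal? : ∀ b λs → Decidable (λ μ → Strip μ λs × ℕ.sum μ ℕ.+ b ≡ ℕ.sum λs)
removal? b λs μ = strip? μ λs ×-dec (ℕ.sum μ ℕ.+ b ℕ.≟ ℕ.sum λs)

addition? : ∀ m λs → Decidable (λ κ → Strip λs κ × ℕ.sum κ ≡ ℕ.sum λs ℕ.+ m)
addition? m λs κ = strip? λs κ ×-dec (ℕ.sum κ ℕ.≟ ℕ.sum λs ℕ.+ m)

-- Removing a strip keeps the number of rows, zeros being allowed, and adding one creates exactly
-- one row, possibly empty. Each strip is thus listed once. The bound on the entries only makes the
-- search finite.
removals : ℕ → List ℕ → List (List ℕ)
removals b λs = filter (removal? b λs)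
  (words (upTo (suc (ℕ.sum λs))) (length λs))

additions : ℕ → List ℕ → List (List ℕ)
additions m λs = filter (addition? m λs)
  (words (upTo (suc (ℕ.sum λs ℕ.+ m))) (suc (length λs)))

removals-unique : ∀ b λs → Unique (removals b λs)
removals-unique b λs = Unique.filter⁺ (removal? b λs) (words-unique (length λs) (Unique.upTo⁺ (suc (ℕ.sum λs))))

additions-unique : ∀ m λs → Unique (additions m λs)
additions-unique m λs = Unique.filter⁺ (addition? m λs) (words-unique (suc (length λs)) (Unique.upTo⁺ (suc (ℕ.sum λs ℕ.+ m))))

∈-removals⁻ : ∀ b λs {μ} → μ ∈ removals b λs →
  length μ ≡ length λs × Strip μ λs × ℕ.sum μ ℕ.+ b ≡ ℕ.sum λs
∈-removals⁻ b λs μ∈ =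
  let w∈ , st , eq = ∈-filter⁻ (removal? b λs)
                       {xs = words (upTo (suc (ℕ.sum λs))) (length λs)} μ∈
  in proj₁ (∈-words⁻ (length λs) w∈) , st , eq

∈-removals⁺ : ∀ b λs {μ} → length μ ≡ length λs → Strip μ λs → ℕ.sum μ ℕ.+ b ≡ ℕ.sum λs →
  μ ∈ removals b λs
∈-removals⁺ b λs {μ} len st eq =
  ∈-filter⁺ (removal? b λs)
    (subst (λ n → μ ∈ words (upTo (suc (ℕ.sum λs))) n) len
      (∈-words⁺ (All.map (λ p → ∈-upTo⁺ (ℕ.<-≤-trans p (s≤s sum≤))) (all≤sum μ))))
    (st , eq)
  where
  sum≤ : ℕ.sum μ ≤ ℕ.sum λs
  sum≤ = subst (ℕ.sum μ ≤_) eq (ℕ.m≤m+n _ b)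

∈-additions⁻ : ∀ m λs {κ} → κ ∈ additions m λs →
  length κ ≡ suc (length λs) × Strip λs κ × ℕ.sum κ ≡ ℕ.sum λs ℕ.+ m
∈-additions⁻ m λs κ∈ =
  let w∈ , st , eq = ∈-filter⁻ (addition? m λs)
                       {xs = words (upTo (suc (ℕ.sum λs ℕ.+ m))) (suc (length λs))} κ∈
  in proj₁ (∈-words⁻ (suc (length λs)) w∈) , st , eq

∈-additions⁺ : ∀ m λs {κ} → length κ ≡ suc (length λs) → Strip λs κ →
  ℕ.sum κ ≡ ℕ.sum λs ℕ.+ m → κ ∈ additions m λs
∈-additions⁺ m λs {κ} len st eq =
  ∈-filter⁺ (addition? m λs)
    (subst (λ n → κ ∈ words (upTo (suc (ℕ.sum λs ℕ.+ m))) n) len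
      (∈-words⁺ (All.map (λ p → ∈-upTo⁺ (ℕ.<-≤-trans p (s≤s (ℕ.≤-reflexive eq)))) (all≤sum κ))))
    (st , eq)

-- Tableaux of straight shape and their greatest letter

Above : List ℕ → List ℕ → Set
Above r       []       = ⊤
Above []      (_ ∷ _)  = ⊥
Above (x ∷ r) (y ∷ r′) = x < y × Above r r′

SST : List (List ℕ) → Set
SST []           = ⊤
SST (r ∷ [])     = Linked _≤_ r
SST (r ∷ r′ ∷ ρ) = Linked _≤_ r × Above r r′ × SST (r′ ∷ ρ)

columnStrict⇒above : ∀ d k r r′ → length r′ ≤ length r → ColumnStrict d k r k r′ → Above r r′
columnStrict⇒above d k r       []       len col = tt
columnStrict⇒above d k (x ∷ r) (y ∷ r′) (s≤s len) col =
  col (here refl) (here refl) , columnStrict⇒above d (suc k) r r′ len (λ p q → col (there p) (there q))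

above⇒columnStrict : ∀ d k r r′ → Above r r′ → ColumnStrict d k r k r′
above⇒columnStrict d k (x ∷ r) (y ∷ r′) (lt , ab) (here refl) (here refl) = lt
above⇒columnStrict d k (x ∷ r) (y ∷ r′) (lt , ab) (here refl) (there q)   =
  ⊥-elim (ℕ.1+n≰n (rowFill-≥ (suc d) (suc k) r′ q))
above⇒columnStrict d k (x ∷ r) (y ∷ r′) (lt , ab) (there p)   (here refl) =
  ⊥-elim (ℕ.1+n≰n (rowFill-≥ d (suc k) r p))
above⇒columnStrict d k (x ∷ r) (y ∷ r′) (lt , ab) (there p)   (there q)   =
  above⇒columnStrict d (suc k) r r′ ab p q

straight-widths : ∀ λs → map width (rows λs []) ≡ λs
straight-widths []       = refl
straight-widths (l ∷ λs) = cong (l ∷_) (straight-widths λs)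

rowWise⇒SST : ∀ d ρ → Decreasing (map length ρ) →
  RowWise d (map proj₁ (rows (map length ρ) [])) ρ → SST ρ
rowWise⇒SST d []           dec rw = tt
rowWise⇒SST d (r ∷ [])     dec rw = rw
rowWise⇒SST d (r ∷ r′ ∷ ρ) (len ∷ dec) (lk , col , rw) =
  lk , columnStrict⇒above d 0 r r′ len col , rowWise⇒SST (suc d) (r′ ∷ ρ) dec rw

SST⇒rowWise : ∀ d ρ → SST ρ → RowWise d (map proj₁ (rows (map length ρ) [])) ρ
SST⇒rowWise d []           ss = tt
SST⇒rowWise d (r ∷ [])     ss = ss
SST⇒rowWise d (r ∷ r′ ∷ ρ) (lk , ab , ss) =
  lk , above⇒columnStrict d 0 r r′ ab , SST⇒rowWise (suc d) (r′ ∷ ρ) ss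

SST-head : ∀ r ρ → SST (r ∷ ρ) → Linked _≤_ r
SST-head r []      ss       = ss
SST-head r (_ ∷ _) (lk , _) = lk

record SSYT (λs α : List ℕ) (ρ : List (List ℕ)) : Set where
  constructor ssyt
  field
    shape   : map length ρ ≡ λs
    letters : All (All (_< length α)) ρ
    weight  : content (length α) (concat ρ) ≡ α
    sst     : SST ρ

∈-straight⁻ : ∀ {λs α ρ} → Decreasing λs → ρ ∈ fillings (λs / []) α → SSYT λs α ρ
∈-straight⁻ {λs} {α} {ρ} dec ρ∈ with filling sh al co rw ← ∈-fillings⁻ (λs / []) α ρ∈ =
  ssyt shape (All.concat⁻ al) co (rowWise⇒SST 0 ρ (subst Decreasing (sym shape) dec)
    (subst (λ l → RowWise 0 (map proj₁ (rows l [])) ρ) (sym shape) rw))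
  where
  shape = trans sh (straight-widths λs)

∈-straight⁺ : ∀ {λs α ρ} → SSYT λs α ρ → ρ ∈ fillings (λs / []) α
∈-straight⁺ {λs} {α} {ρ} (ssyt shape al co ss) = ∈-fillings⁺ (λs / []) α (filling
  (trans shape (sym (straight-widths λs))) (All.concat⁺ al) co
  (subst (λ l → RowWise 0 (map proj₁ (rows l [])) ρ) shape (SST⇒rowWise 0 ρ ss)))

module _ (m : ℕ) where

  below-m : List ℕ → List ℕ
  below-m = filter (ℕ._<? m)

  private
    all≥ : ∀ {x r} → m ≤ x → Linked _≤_ (x ∷ r) → All (m ≤_) (x ∷ r)
    all≥ m≤x lk = All.map (ℕ.≤-trans m≤x) (ℕ.≤-refl ∷ All.tail (Linked.Linked⇒All ℕ.≤-trans ℕ.≤-refl lk))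

    none : ∀ {r} → All (m ≤_) r → below-m r ≡ []
    none al = filter-none (ℕ._<? m) (All.map ℕ.≤⇒≯ al)

    all-m : ∀ {r} → All (m ≤_) r → All (_< suc m) r → r ≡ replicate (length r) m
    all-m []       []       = refl
    all-m (p ∷ ps) (q ∷ qs) = cong₂ _∷_ (ℕ.≤-antisym (ℕ.s≤s⁻¹ q) p) (all-m ps qs)

  pad : ℕ → List ℕ → List ℕ
  pad l r = r ++ replicate (l ∸ length r) m

  row-split : ∀ r → Linked _≤_ r → All (_< suc m) r → pad (length r) (below-m r) ≡ r
  row-split []      lk al = refl
  row-split (x ∷ r) lk (p ∷ al) with x ℕ.<? m
  ... | yes x<m rewrite filter-accept (ℕ._<? m) {xs = r} x<m =
    cong (x ∷_) (row-split r (Linked.tail lk) al)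
  ... | no  x≮m rewrite none (all≥ (ℕ.≮⇒≥ x≮m) lk) = sym (all-m (all≥ (ℕ.≮⇒≥ x≮m) lk) (p ∷ al))

  below-m-pad : ∀ l r → All (_< m) r → below-m (pad l r) ≡ r
  below-m-pad l r al = trans (filter-++ (ℕ._<? m) r _)
    (trans (cong₂ _++_ (filter-all (ℕ._<? m) al)
      (filter-none (ℕ._<? m) (All.replicate⁺ (l ∸ length r) (ℕ.n≮n m)))) (++-identityʳ r))

  length-pad : ∀ l r → length r ≤ l → length (pad l r) ≡ l
  length-pad l r p = trans (length-++ r)
    (trans (cong (length r ℕ.+_) (length-replicate (l ∸ length r))) (ℕ.m+[n∸m]≡n p))

  pad-sorted : ∀ l r → Linked _≤_ r → All (_< m) r → Linked _≤_ (pad l r)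
  pad-sorted l r lk al = go r (l ∸ length r) lk al
    where
    constant : ∀ k → Linked _≤_ (replicate k m)
    constant zero          = []
    constant (suc zero)    = [-]
    constant (suc (suc k)) = ℕ.≤-refl ∷ constant (suc k)
    go : ∀ r k → Linked _≤_ r → All (_< m) r → Linked _≤_ (r ++ replicate k m)
    go []          k       lk       al       = constant k
    go (x ∷ [])    zero    lk       al       = [-]
    go (x ∷ [])    (suc k) lk       (p ∷ al) = ℕ.<⇒≤ p ∷ constant (suc k)
    go (x ∷ y ∷ r) k       (p ∷ lk) (_ ∷ al) = p ∷ go (y ∷ r) k lk al

  below-m-sorted : ∀ r → Linked _≤_ r → Linked _≤_ (below-m r)
  below-m-sorted r = Linked.filter⁺ (ℕ._<? m) ℕ.≤-trans

  -- An entry of `r` with an entry under it is less than that entry, which is at most `m`. So no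
  -- occurrence of `m` in `r` has a cell under it, and this is the condition of a horizontal strip.
  above-below-m : ∀ r s → Linked _≤_ s → All (_< suc m) s → Above r s →
    length s ≤ length (below-m r) × Above (below-m r) (below-m s)
  above-below-m r       []      lk al       ab = z≤n , tt
  above-below-m (x ∷ r) (y ∷ s) lk (p ∷ al) (lt , ab)
    rewrite filter-accept (ℕ._<? m) {xs = r} (ℕ.<-≤-trans lt (ℕ.s≤s⁻¹ p))
    with len , ab′ ← above-below-m r s (Linked.tail lk) al ab | y ℕ.<? m
  ... | yes y<m rewrite filter-accept (ℕ._<? m) {xs = s} y<m = s≤s len , lt , ab′
  ... | no  y≮m rewrite none (all≥ (ℕ.≮⇒≥ y≮m) lk) = s≤s len , tt

  -- Because `l′ ≤ length r`, each `m` appended to the lower row stands under a letter of `r`, not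
  -- under another `m`.
  above-pad : ∀ l l′ r s → All (_< m) r → Above r s → l′ ≤ length r → Above (pad l r) (pad l′ s)
  above-pad l l′ r s al ab len = go r s (l′ ∸ length s) al ab (bound r s ab len)
    where
    shorter : ∀ r s → Above r s → length s ≤ length r
    shorter r       []      ab       = z≤n
    shorter (x ∷ r) (y ∷ s) (_ , ab) = s≤s (shorter r s ab)
    bound : ∀ r s → Above r s → l′ ≤ length r → length s ℕ.+ (l′ ∸ length s) ≤ length r
    bound r s ab len with ℕ.≤-total l′ (length s)
    ... | inj₁ p rewrite ℕ.m≤n⇒m∸n≡0 p | ℕ.+-identityʳ (length s) = shorter r s ab
    ... | inj₂ p rewrite ℕ.m+[n∸m]≡n p = len
    go : ∀ {w} r s k → All (_< m) r → Above r s → length s ℕ.+ k ≤ length r →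
      Above (r ++ w) (s ++ replicate k m)
    go r       []      zero    al       ab        len       = tt
    go (x ∷ r) []      (suc k) (p ∷ al) ab        (s≤s len) = p , go r [] k al tt len
    go (x ∷ r) (y ∷ s) k       (_ ∷ al) (lt , ab) (s≤s len) = lt , go r s k al ab len

  SST-below-m : ∀ ρ → All (All (_< suc m)) ρ → SST ρ →
    SST (map below-m ρ) × Strip (map length (map below-m ρ)) (map length ρ)
  SST-below-m []           al ss = tt , tt
  SST-below-m (r ∷ [])     al ss = below-m-sorted r ss , length-filter (ℕ._<? m) r , z≤n , tt
  SST-below-m (r ∷ r′ ∷ ρ) (_ ∷ al) (lk , ab , ss)
    with ss′ , st ← SST-below-m (r′ ∷ ρ) al ss
       | len , ab′ ← above-below-m r r′ (SST-head r′ ρ ss) (All.head al) ab =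
    (below-m-sorted r lk , ab′ , ss′) , length-filter (ℕ._<? m) r , len , st

  padAll : List ℕ → List (List ℕ) → List (List ℕ)
  padAll = zipWith pad

  SST-pad : ∀ λs σ → All (All (_< m)) σ → length σ ≡ length λs →
    Strip (map length σ) λs → SST σ → SST (padAll λs σ)
  SST-pad []            []           al       len  st ss = tt
  SST-pad (l ∷ [])      (s ∷ [])     (a ∷ al) len  st ss = pad-sorted l s ss a
  SST-pad (l ∷ l′ ∷ λs) (s ∷ s′ ∷ σ) (a ∷ al) len  (_ , l′≤ , st) (lk , ab , ss) =
    pad-sorted l s lk a , above-pad l l′ s s′ a ab l′≤ ,
    SST-pad (l′ ∷ λs) (s′ ∷ σ) al (ℕ.suc-injective len) st ss

  padAll-below-m : ∀ ρ → All (All (_< suc m)) ρ → SST ρ →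
    padAll (map length ρ) (map below-m ρ) ≡ ρ
  padAll-below-m []           al       ss = refl
  padAll-below-m (r ∷ [])     (a ∷ al) ss = cong (_∷ []) (row-split r ss a)
  padAll-below-m (r ∷ r′ ∷ ρ) (a ∷ al) (lk , _ , ss) =
    cong₂ _∷_ (row-split r lk a) (padAll-below-m (r′ ∷ ρ) al ss)

  below-m-padAll : ∀ λs σ → length σ ≡ length λs → All (All (_< m)) σ →
    map below-m (padAll λs σ) ≡ σ
  below-m-padAll []       []      len al       = refl
  below-m-padAll (l ∷ λs) (s ∷ σ) len (a ∷ al) =
    cong₂ _∷_ (below-m-pad l s a) (below-m-padAll λs σ (ℕ.suc-injective len) al)

  length-padAll : ∀ λs σ → length σ ≡ length λs → Strip (map length σ) λs →
    map length (padAll λs σ) ≡ λs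
  length-padAll []       []      len st = refl
  length-padAll (l ∷ λs) (s ∷ σ) len (s≤l , _ , st) =
    cong₂ _∷_ (length-pad l s s≤l) (length-padAll λs σ (ℕ.suc-injective len) st)

  letters-padAll : ∀ λs σ → All (All (_< m)) σ → All (All (_< suc m)) (padAll λs σ)
  letters-padAll []       σ       al       = nil σ
    where
    nil : ∀ σ → All (All (_< suc m)) (padAll [] σ)
    nil []      = []
    nil (_ ∷ _) = []
  letters-padAll (l ∷ λs) []      al       = []
  letters-padAll (l ∷ λs) (s ∷ σ) (a ∷ al) =
    All.++⁺ (All.map ℕ.m<n⇒m<1+n a) (All.replicate⁺ (l ∸ length s) (ℕ.n<1+n m)) ∷
    letters-padAll λs σ al

  concat-below-m : ∀ ρ → concat (map below-m ρ) ≡ below-m (concat ρ)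
  concat-below-m []      = refl
  concat-below-m (r ∷ ρ) = trans (cong (below-m r ++_) (concat-below-m ρ))
    (sym (filter-++ (ℕ._<? m) r (concat ρ)))

  private
    count-cong : ∀ i w → i < m → count i (below-m w) ≡ count i w
    count-cong i []      i<m = refl
    count-cong i (x ∷ w) i<m with x ℕ.<? m
    ... | yes x<m rewrite filter-accept (ℕ._<? m) {xs = w} x<m with i ℕ.≟ x
    ...   | yes eq rewrite filter-accept (i ℕ.≟_) {xs = below-m w} eq
                         | filter-accept (i ℕ.≟_) {xs = w} eq = cong suc (count-cong i w i<m)
    ...   | no  ne rewrite filter-reject (i ℕ.≟_) {xs = below-m w} ne
                         | filter-reject (i ℕ.≟_) {xs = w} ne = count-cong i w i<m
    count-cong i (x ∷ w) i<m | no  x≮m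
      rewrite filter-reject (ℕ._<? m) {xs = w} x≮m
            | filter-reject (i ℕ.≟_) {xs = w} (λ eq → x≮m (subst (_< m) eq i<m)) = count-cong i w i<m

  length-below-m : ∀ w → All (_< suc m) w → length (below-m w) ℕ.+ count m w ≡ length w
  length-below-m []      []       = refl
  length-below-m (x ∷ w) (p ∷ al) with x ℕ.<? m
  ... | yes x<m rewrite filter-accept (ℕ._<? m) {xs = w} x<m
                      | filter-reject (m ℕ.≟_) {xs = w} (λ eq → ℕ.<-irrefl (sym eq) x<m) =
    cong suc (length-below-m w al)
  ... | no  x≮m rewrite filter-reject (ℕ._<? m) {xs = w} x≮m
                      | filter-accept (m ℕ.≟_) {xs = w} (ℕ.≤-antisym (ℕ.≮⇒≥ x≮m) (ℕ.s≤s⁻¹ p)) =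
    trans (ℕ.+-suc _ _) (cong suc (length-below-m w al))

  content-suc : ∀ w → content (suc m) w ≡ content m (below-m w) ∷ʳ count m w
  content-suc w = trans (cong (map (λ i → count i w)) (sym (applyUpTo-∷ʳ id m)))
    (trans (map-++ _ (upTo m) [ m ]) (cong (_∷ʳ count m w)
      (map-cong-local (All.tabulate λ {i} i∈ → sym (count-cong i w (∈-upTo⁻ i∈))))))

length-∷ʳ : ∀ (α : List ℕ) b → length (α ∷ʳ b) ≡ suc (length α)
length-∷ʳ []      b = refl
length-∷ʳ (a ∷ α) b = cong suc (length-∷ʳ α b)

sum-length : ∀ ρ λs → map length ρ ≡ λs → length (concat {A = ℕ} ρ) ≡ ℕ.sum λs
sum-length ρ λs eq = trans (length-concat ρ) (cong ℕ.sum eq)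

module _ (λs α : List ℕ) (b : ℕ) where
  private m = length α

  ssyt-below : ∀ {ρ} → SSYT λs (α ∷ʳ b) ρ →
    map length (map (below-m m) ρ) ∈ removals b λs ×
    SSYT (map length (map (below-m m) ρ)) α (map (below-m m) ρ) ×
    padAll m λs (map (below-m m) ρ) ≡ ρ
  ssyt-below {ρ} (ssyt refl al co ss) =
    ∈-removals⁺ b λs
      (trans (length-map length (map (below-m m) ρ)) (trans (length-map (below-m m) ρ)
        (sym (length-map length ρ))))
      (proj₂ restricted) sums ,
    ssyt refl (All.map⁺ (All.map (λ {r} _ → All.all-filter (ℕ._<? m) r) al′))
      (trans (cong (content m) (concat-below-m m ρ)) (proj₁ co′)) (proj₁ restricted) ,
    padAll-below-m m ρ al′ ss
    where
    al′ = subst (λ l → All (All (_< l)) ρ) (length-∷ʳ α b) al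
    restricted = SST-below-m m ρ al′ ss
    co′ = ∷ʳ-injective _ _ (trans (sym (content-suc m (concat ρ)))
      (trans (cong (λ l → content l (concat ρ)) (sym (length-∷ʳ α b))) co))
    sums : ℕ.sum (map length (map (below-m m) ρ)) ℕ.+ b ≡ ℕ.sum λs
    sums = trans (cong₂ ℕ._+_
        (trans (sym (length-concat (map (below-m m) ρ))) (cong length (concat-below-m m ρ)))
        (sym (proj₂ co′)))
      (trans (length-below-m m (concat ρ) (All.concat⁺ al′)) (length-concat ρ))

  ssyt-pad : ∀ {μ σ} → μ ∈ removals b λs → SSYT μ α σ →
    SSYT λs (α ∷ʳ b) (padAll m λs σ) × map (below-m m) (padAll m λs σ) ≡ σ
  ssyt-pad {_} {σ} μ∈ (ssyt refl al co ss)
    with len , st , eq ← ∈-removals⁻ b λs μ∈ =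
    ssyt shape (subst (λ l → All (All (_< l)) ρ) (sym (length-∷ʳ α b)) letters)
      (trans (cong (λ l → content l (concat ρ)) (length-∷ʳ α b))
        (trans (content-suc m (concat ρ)) (cong₂ _∷ʳ_
          (trans (cong (content m) cb) co) count≡b)))
      (SST-pad m λs σ al len′ st ss) , back
    where
    ρ = padAll m λs σ
    len′ = trans (sym (length-map length σ)) len
    shape = length-padAll m λs σ len′ st
    back = below-m-padAll m λs σ len′ al
    letters = letters-padAll m λs σ al
    cb : below-m m (concat ρ) ≡ concat σ
    cb = trans (sym (concat-below-m m ρ)) (cong concat back)
    count≡b : count m (concat ρ) ≡ b
    count≡b = ℕ.+-cancelˡ-≡ (ℕ.sum (map length σ)) _ _ (trans
      (cong (ℕ._+ count m (concat ρ)) (trans (sym (length-concat σ)) (cong length (sym cb))))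
      (trans (length-below-m m (concat ρ) (All.concat⁺ letters))
        (trans (sum-length ρ λs shape) (sym eq))))

strip-decreasing : ∀ {μ λs} → length μ ≡ length λs → Strip μ λs → Decreasing μ
strip-decreasing {[]}         {[]}         len st = []
strip-decreasing {m ∷ []}     {l ∷ []}     len st = [-]
strip-decreasing {m ∷ m′ ∷ μ} {l ∷ l′ ∷ λs} len (_ , l′≤m , st@(m′≤l′ , _)) =
  ℕ.≤-trans m′≤l′ l′≤m ∷ strip-decreasing (ℕ.suc-injective len) st

module SchurBranching {c ℓ₁ ℓ₂} (K : CommutativeRing c ℓ₁)
                      (_≤ᴷ_ : Rel (CommutativeRing.Carrier K) ℓ₂) where

  open FiniteSums K
  private module SF = SymmetricFunctions rawRing _≤ᴷ_

  skewSchur-∑ : ∀ D α → SF.skewSchur D α ≈ ∑ (fillings D α) (λ _ → 1#)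
  skewSchur-∑ D α = ≈-trans (reflexive (cong (_· 1#) (length-fillings D α)))
    (≈-sym (∑-const (fillings D α) 1#))

  -- The cells with the greatest letter, `length α`, form a horizontal strip of size `b`; without
  -- them a tableau in the remaining variables is left.
  schur-∷ʳ : ∀ {λs} → Decreasing λs → ∀ α b →
    SF.schur λs (α ∷ʳ b) ≈ ∑ (removals b λs) (λ μ → SF.schur μ α)
  schur-∷ʳ {λs} dec α b = begin
    SF.schur λs (α ∷ʳ b) ≈⟨ skewSchur-∑ (λs / []) (α ∷ʳ b) ⟩
    ∑ (fillings (λs / []) (α ∷ʳ b)) (λ _ → 1#)
      ≈⟨ ∑-bij (λ ρ → map length (map (below-m m) ρ) , map (below-m m) ρ)
               (λ (μ , σ) → padAll m λs σ)
               (fillings-unique (λs / []) (α ∷ʳ b))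
               (pairs-unique (removals-unique b λs) (λ μ → fillings-unique (μ / []) α))
               to from (λ _ → ≈-refl) ⟩
    ∑ (pairs (removals b λs) (λ μ → fillings (μ / []) α)) (λ _ → 1#)
      ≈⟨ ∑-pairs (removals b λs) _ _ ⟩
    ∑ (removals b λs) (λ μ → ∑ (fillings (μ / []) α) (λ _ → 1#))
      ≈⟨ ∑-cong-ext (removals b λs) (λ μ → ≈-sym (skewSchur-∑ (μ / []) α)) ⟩
    ∑ (removals b λs) (λ μ → SF.schur μ α) ∎
    where
    m = length α
    tableauxOf = λ μ → fillings (μ / []) α
    to : ∀ {ρ} → ρ ∈ fillings (λs / []) (α ∷ʳ b) →
      (map length (map (below-m m) ρ) , map (below-m m) ρ) ∈ pairs (removals b λs) tableauxOf ×
      padAll m λs (map (below-m m) ρ) ≡ ρ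
    to {ρ} ρ∈ with μ∈ , t , eq ← ssyt-below λs α b {ρ} (∈-straight⁻ {λs} {α ∷ʳ b} dec ρ∈) =
      ∈-pairs⁺ {f = tableauxOf} μ∈ (∈-straight⁺ {_} {α} t) , eq
    from : ∀ {p} → p ∈ pairs (removals b λs) tableauxOf →
      padAll m λs (proj₂ p) ∈ fillings (λs / []) (α ∷ʳ b) ×
      (map length (map (below-m m) (padAll m λs (proj₂ p))) ,
       map (below-m m) (padAll m λs (proj₂ p))) ≡ p
    from {μ , σ} p∈ with μ∈ , σ∈ ← ∈-pairs⁻ (removals b λs) tableauxOf p∈
                    with len , st , _ ← ∈-removals⁻ b λs μ∈
                    with t ← ∈-straight⁻ {μ} {α} (strip-decreasing len st) σ∈
                    with t′ , eq ← ssyt-pad λs α b μ∈ t =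
      ∈-straight⁺ {λs} {α ∷ʳ b} t′ ,
      cong₂ _,_ (trans (cong (map length) eq) (SSYT.shape t)) eq

-- The partitions κ with κ/λ and κ/ν horizontal strips have κᵢ₊₁ in the
-- intervals listed here, and those μ with λ/μ and ν/μ horizontal strips have μᵢ
-- in the same intervals.
intervals : List ℕ → List ℕ → List (ℕ × ℕ)
intervals (l ∷ λs) (n ∷ ν) = (part λs 0 ℕ.⊔ part ν 0 , l ℕ.⊓ n) ∷ intervals λs ν
intervals _        _       = []

Within : List (ℕ × ℕ) → List ℕ → Set
Within []               []       = ⊤
Within ((lo , hi) ∷ is) (x ∷ xs) = lo ≤ x × x ≤ hi × Within is xs
Within _                _        = ⊥

-- The toggle of a row in a Gelfand-Tsetlin pattern: each entry is reflected in the interval that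
-- the neighbouring rows allow.
reflect : List (ℕ × ℕ) → List ℕ → List ℕ
reflect ((lo , hi) ∷ is) (x ∷ xs) = (lo ℕ.+ hi ∸ x) ∷ reflect is xs
reflect _                _        = []

within-length : ∀ is xs → Within is xs → length xs ≡ length is
within-length []       []       w           = refl
within-length (_ ∷ is) (x ∷ xs) (_ , _ , w) = cong suc (within-length is xs w)

reflect-within : ∀ is xs → Within is xs → Within is (reflect is xs)
reflect-within []               []       w             = tt
reflect-within ((lo , hi) ∷ is) (x ∷ xs) (p , q , w) =
  subst (_≤ lo ℕ.+ hi ∸ x) (ℕ.m+n∸n≡m lo hi) (ℕ.∸-monoʳ-≤ (lo ℕ.+ hi) q) ,
  subst (lo ℕ.+ hi ∸ x ≤_) (ℕ.m+n∸m≡n lo hi) (ℕ.∸-monoʳ-≤ (lo ℕ.+ hi) p) ,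
  reflect-within is xs w

reflect-involutive : ∀ is xs → Within is xs → reflect is (reflect is xs) ≡ xs
reflect-involutive []               []       w           = refl
reflect-involutive ((lo , hi) ∷ is) (x ∷ xs) (_ , q , w) =
  cong₂ _∷_ (ℕ.m∸[m∸n]≡n (ℕ.≤-trans q (ℕ.m≤n+m hi lo))) (reflect-involutive is xs w)

endpoints : List (ℕ × ℕ) → ℕ
endpoints []               = 0
endpoints ((lo , hi) ∷ is) = (lo ℕ.+ hi) ℕ.+ endpoints is

sum-reflect : ∀ is xs → Within is xs → ℕ.sum (reflect is xs) ℕ.+ ℕ.sum xs ≡ endpoints is
sum-reflect []               []       w           = refl
sum-reflect ((lo , hi) ∷ is) (x ∷ xs) (_ , q , w) = trans
  (interchange (lo ℕ.+ hi ∸ x) (ℕ.sum (reflect is xs)) x (ℕ.sum xs))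
  (cong₂ ℕ._+_ (ℕ.m∸n+n≡m (ℕ.≤-trans q (ℕ.m≤n+m hi lo))) (sum-reflect is xs w))
  where
  interchange : ∀ a b c d → (a ℕ.+ b) ℕ.+ (c ℕ.+ d) ≡ (a ℕ.+ c) ℕ.+ (b ℕ.+ d)
  interchange = solve-∀

-- Each pair of parts gives its minimum to the interval with its own index and its maximum to the
-- interval before. Only the maximum of the first pair belongs to no interval and is added
-- separately.
endpoints-intervals : ∀ λs ν → length ν ≡ suc (length λs) →
  endpoints (intervals λs ν) ℕ.+ (part λs 0 ℕ.⊔ part ν 0) ≡ ℕ.sum λs ℕ.+ ℕ.sum ν
endpoints-intervals []       (n ∷ [])       len = sym (ℕ.+-identityʳ n)
endpoints-intervals (l ∷ λs) (n ∷ ν@(_ ∷ _)) len = trans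
  (shuffle (part λs 0 ℕ.⊔ part ν 0) (l ℕ.⊓ n) (endpoints (intervals λs ν)) (l ℕ.⊔ n))
  (trans (cong₂ ℕ._+_ (endpoints-intervals λs ν (ℕ.suc-injective len)) (min+max l n))
    (shuffle′ (ℕ.sum λs) (ℕ.sum ν) l n))
  where
  shuffle : ∀ a b c d → ((a ℕ.+ b) ℕ.+ c) ℕ.+ d ≡ (c ℕ.+ a) ℕ.+ (b ℕ.+ d)
  shuffle = solve-∀
  shuffle′ : ∀ a b c d → (a ℕ.+ b) ℕ.+ (c ℕ.+ d) ≡ (c ℕ.+ a) ℕ.+ (d ℕ.+ b)
  shuffle′ = solve-∀
  min+max : ∀ a b → (a ℕ.⊓ b) ℕ.+ (a ℕ.⊔ b) ≡ a ℕ.+ b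
  min+max a b with ℕ.≤-total a b
  ... | inj₁ p rewrite ℕ.m≤n⇒m⊓n≡m p | ℕ.m≤n⇒m⊔n≡n p = refl
  ... | inj₂ p rewrite ℕ.m≥n⇒m⊓n≡n p | ℕ.m≥n⇒m⊔n≡m p = ℕ.+-comm b a

strips-above⁻ : ∀ λs ν k κ → length ν ≡ suc (length λs) → Strip λs (k ∷ κ) → Strip ν (k ∷ κ) →
  part λs 0 ℕ.⊔ part ν 0 ≤ k × Within (intervals λs ν) κ
strips-above⁻ []       (n ∷ [])     k []       len st (p , _) = p , tt
strips-above⁻ (l ∷ λs) (n ∷ ν@(_ ∷ _)) k (k′ ∷ κ) len (p , q , st) (p′ , q′ , st′)
  with lo≤ , w ← strips-above⁻ λs ν k′ κ (ℕ.suc-injective len) st st′ =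
  ℕ.⊔-lub p p′ , lo≤ , ℕ.⊓-glb q q′ , w

strips-above⁺ : ∀ λs ν k κ → length ν ≡ suc (length λs) →
  part λs 0 ℕ.⊔ part ν 0 ≤ k → Within (intervals λs ν) κ → Strip λs (k ∷ κ) × Strip ν (k ∷ κ)
strips-above⁺ []       (n ∷ [])     k []       len p w = tt , p , z≤n , tt
strips-above⁺ (l ∷ λs) (n ∷ ν@(_ ∷ _)) k (k′ ∷ κ) len p (lo≤ , ≤hi , w)
  with st , st′ ← strips-above⁺ λs ν k′ κ (ℕ.suc-injective len) lo≤ w =
  (ℕ.m⊔n≤o⇒m≤o l n p , ℕ.m≤n⊓o⇒m≤n l n ≤hi , st) ,
  (ℕ.m⊔n≤o⇒n≤o l n p , ℕ.m≤n⊓o⇒m≤o l n ≤hi , st′)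

strips-below⁻ : ∀ λs ν μ → length ν ≡ suc (length λs) → length μ ≡ length λs →
  Strip μ λs → Strip μ ν → Within (intervals λs ν) μ
strips-below⁻ []       (n ∷ [])     []       len len′ st st′ = tt
strips-below⁻ (l ∷ λs) (n ∷ ν@(_ ∷ _)) (m ∷ μ) len len′ (p , q , st) (p′ , q′ , st′) =
  ℕ.⊔-lub q q′ , ℕ.⊓-glb p p′ ,
  strips-below⁻ λs ν μ (ℕ.suc-injective len) (ℕ.suc-injective len′) st st′

strips-below⁺ : ∀ λs ν μ → length ν ≡ suc (length λs) → Within (intervals λs ν) μ →
  Strip μ λs × Strip μ ν
strips-below⁺ []       (n ∷ [])     []       len w = tt , tt
strips-below⁺ (l ∷ λs) (n ∷ ν@(_ ∷ _)) (m ∷ μ) len (lo≤ , ≤hi , w)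
  with st , st′ ← strips-below⁺ λs ν μ (ℕ.suc-injective len) w =
  (ℕ.m≤n⊓o⇒m≤n l n ≤hi , ℕ.m⊔n≤o⇒m≤o (part λs 0) (part ν 0) lo≤ , st) ,
  (ℕ.m≤n⊓o⇒m≤o l n ≤hi , ℕ.m⊔n≤o⇒n≤o (part λs 0) (part ν 0) lo≤ , st′)

strip-sum : ∀ μ λs → Strip μ λs → ℕ.sum μ ≤ ℕ.sum λs
strip-sum []      λs       st           = z≤n
strip-sum (m ∷ μ) (l ∷ λs) (p , _ , st) = ℕ.+-mono-≤ p (strip-sum μ λs st)

length-intervals : ∀ λs ν → length ν ≡ suc (length λs) → length (intervals λs ν) ≡ length λs
length-intervals []       (n ∷ ν) len = refl
length-intervals (l ∷ λs) (n ∷ ν) len = cong suc (length-intervals λs ν (ℕ.suc-injective len))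

strip-decreasing⁺ : ∀ λs κ → length κ ≡ suc (length λs) → Strip λs κ → Decreasing κ
strip-decreasing⁺ []       (k ∷ [])     len st           = [-]
strip-decreasing⁺ (l ∷ λs) (k ∷ k′ ∷ κ) len (p , q , st) =
  ℕ.≤-trans q p ∷ strip-decreasing⁺ λs (k′ ∷ κ) (ℕ.suc-injective len) st

-- the horizontal strips that, together with j further cells, have size m
additions⁻ : ℕ → ℕ → List ℕ → List (List ℕ)
additions⁻ j m μ = if j ≤ᵇ m then additions (m ∸ j) μ else []

∈-additions⁻⁻ : ∀ j m μ {ν} → ν ∈ additions⁻ j m μ → j ≤ m × ν ∈ additions (m ∸ j) μ
∈-additions⁻⁻ j m μ ν∈ with j ≤ᵇ m in eq
... | true = ℕ.≤ᵇ⇒≤ j m (subst T (sym eq) tt) , ν∈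

∈-additions⁻⁺ : ∀ j m μ {ν} → j ≤ m → ν ∈ additions (m ∸ j) μ → ν ∈ additions⁻ j m μ
∈-additions⁻⁺ j m μ p ν∈ with j ≤ᵇ m | ℕ.≤⇒≤ᵇ p
... | true | _ = ν∈

additions⁻-unique : ∀ j m μ → Unique (additions⁻ j m μ)
additions⁻-unique j m μ with j ≤ᵇ m
... | true  = additions-unique (m ∸ j) μ
... | false = []

-- Adding a strip of size m and then removing one of size b can be done in as
-- many ways as removing one of size i and then adding one of size m - (b - i),
-- for some i: reflect all rows but the first in their intervals.
module LocalRule (b m : ℕ) (λs : List ℕ) where

  upDown : List (List ℕ × List ℕ)
  upDown = pairs (additions m λs) (removals b)

  removed : List (ℕ × List ℕ)
  removed = pairs (upTo (suc b)) (λ i → removals i λs)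

  downUp : List ((ℕ × List ℕ) × List ℕ)
  downUp = pairs removed (λ (i , μ) → additions⁻ (b ∸ i) m μ)

  forth : List ℕ × List ℕ → (ℕ × List ℕ) × List ℕ
  forth (κ , ν) = (ℕ.sum λs ∸ ℕ.sum μ , μ) , ν
    where μ = reflect (intervals λs ν) (drop 1 κ)

  -- The first row of κ is bounded only from below and has no counterpart in μ. Its excess over the
  -- bound takes up b - i, the number of cells by which the strip from μ to ν falls short of `m`.
  back : (ℕ × List ℕ) × List ℕ → List ℕ × List ℕ
  back ((i , μ) , ν) = ((part λs 0 ℕ.⊔ part ν 0) ℕ.+ (b ∸ i)) ∷ reflect (intervals λs ν) μ , ν

  upDown-unique : Unique upDown
  upDown-unique = pairs-unique (additions-unique m λs) (removals-unique b)

  downUp-unique : Unique downUp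
  downUp-unique = pairs-unique (pairs-unique (Unique.upTo⁺ (suc b)) (λ i → removals-unique i λs))
    (λ (i , μ) → additions⁻-unique (b ∸ i) m μ)

  private
    -- In these four balances `s` and `s′` are the sizes of μ and of κ without its first row `k`,
    -- `l` and `n` those of λ and ν, `e` is the sum of the endpoints and `M` the lower bound for
    -- `k`.
    lemma₁ : ∀ M j {s s′ e k n l} → s ℕ.+ s′ ≡ e → e ℕ.+ M ≡ l ℕ.+ n → n ℕ.+ b ≡ k ℕ.+ s′ → k ≡ M ℕ.+ j →
             s ℕ.+ b ≡ l ℕ.+ j
    lemma₁ M j {s} {s′} {e} {k} {n} {l} refl p q refl = ℕ.+-cancelˡ-≡ n _ _ (begin
      n ℕ.+ (s ℕ.+ b)           ≡⟨ a₁ n s b ⟩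
      s ℕ.+ (n ℕ.+ b)           ≡⟨ cong (s ℕ.+_) q ⟩
      s ℕ.+ ((M ℕ.+ j) ℕ.+ s′)    ≡⟨ a₂ s M j s′ ⟩
      ((s ℕ.+ s′) ℕ.+ M) ℕ.+ j    ≡⟨ cong (ℕ._+ j) p ⟩
      (l ℕ.+ n) ℕ.+ j           ≡⟨ a₃ l n j ⟩
      n ℕ.+ (l ℕ.+ j)           ∎)
      where
      open ≡-Reasoning
      a₁ : ∀ n s b → n ℕ.+ (s ℕ.+ b) ≡ s ℕ.+ (n ℕ.+ b)
      a₁ = solve-∀
      a₂ : ∀ s M j s′ → s ℕ.+ ((M ℕ.+ j) ℕ.+ s′) ≡ ((s ℕ.+ s′) ℕ.+ M) ℕ.+ j
      a₂ = solve-∀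
      a₃ : ∀ l n j → (l ℕ.+ n) ℕ.+ j ≡ n ℕ.+ (l ℕ.+ j)
      a₃ = solve-∀

    lemma₂ : ∀ i j {n l s} → n ℕ.+ (i ℕ.+ j) ≡ l ℕ.+ m → s ℕ.+ i ≡ l → n ℕ.+ j ≡ s ℕ.+ m
    lemma₂ i j {n} {l} {s} p refl = ℕ.+-cancelˡ-≡ i _ _ (begin
      i ℕ.+ (n ℕ.+ j) ≡⟨ a₁ i n j ⟩
      n ℕ.+ (i ℕ.+ j) ≡⟨ p ⟩
      (s ℕ.+ i) ℕ.+ m ≡⟨ a₂ s i m ⟩
      i ℕ.+ (s ℕ.+ m) ∎)
      where
      open ≡-Reasoning
      a₁ : ∀ i n j → i ℕ.+ (n ℕ.+ j) ≡ n ℕ.+ (i ℕ.+ j)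
      a₁ = solve-∀
      a₂ : ∀ s i m → (s ℕ.+ i) ℕ.+ m ≡ i ℕ.+ (s ℕ.+ m)
      a₂ = solve-∀

    lemma₃ : ∀ M j {s′ s e l n} → s′ ℕ.+ s ≡ e → e ℕ.+ M ≡ l ℕ.+ n → n ℕ.+ j ≡ s ℕ.+ m → (M ℕ.+ j) ℕ.+ s′ ≡ l ℕ.+ m
    lemma₃ M j {s′} {s} {e} {l} {n} refl p q = ℕ.+-cancelˡ-≡ s _ _ (begin
      s ℕ.+ ((M ℕ.+ j) ℕ.+ s′) ≡⟨ a₁ s M j s′ ⟩
      ((s′ ℕ.+ s) ℕ.+ M) ℕ.+ j ≡⟨ cong (ℕ._+ j) p ⟩
      (l ℕ.+ n) ℕ.+ j        ≡⟨ ℕ.+-assoc l n j ⟩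
      l ℕ.+ (n ℕ.+ j)        ≡⟨ cong (l ℕ.+_) q ⟩
      l ℕ.+ (s ℕ.+ m)        ≡⟨ a₂ l s m ⟩
      s ℕ.+ (l ℕ.+ m)        ∎)
      where
      open ≡-Reasoning
      a₁ : ∀ s M j s′ → s ℕ.+ ((M ℕ.+ j) ℕ.+ s′) ≡ ((s′ ℕ.+ s) ℕ.+ M) ℕ.+ j
      a₁ = solve-∀
      a₂ : ∀ l s m → l ℕ.+ (s ℕ.+ m) ≡ s ℕ.+ (l ℕ.+ m)
      a₂ = solve-∀

    lemma₄ : ∀ i j {n l s} → n ℕ.+ j ≡ s ℕ.+ m → s ℕ.+ i ≡ l → n ℕ.+ (i ℕ.+ j) ≡ l ℕ.+ m
    lemma₄ i j {n} {l} {s} p refl = begin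
      n ℕ.+ (i ℕ.+ j) ≡⟨ a₁ i n j ⟨
      i ℕ.+ (n ℕ.+ j) ≡⟨ cong (i ℕ.+_) p ⟩
      i ℕ.+ (s ℕ.+ m) ≡⟨ a₂ s i m ⟨
      (s ℕ.+ i) ℕ.+ m ∎
      where
      open ≡-Reasoning
      a₁ : ∀ i n j → i ℕ.+ (n ℕ.+ j) ≡ n ℕ.+ (i ℕ.+ j)
      a₁ = solve-∀
      a₂ : ∀ s i m → (s ℕ.+ i) ℕ.+ m ≡ i ℕ.+ (s ℕ.+ m)
      a₂ = solve-∀

  forth-∈ : ∀ {p} → p ∈ upDown → forth p ∈ downUp × back (forth p) ≡ p
  forth-∈ {κ , ν} p∈ with κ∈ , ν∈ ← ∈-pairs⁻ (additions m λs) (removals b) p∈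
                     with lenκ , λκ , sumκ ← ∈-additions⁻ m λs κ∈
                        | lenν , νκ , sumν ← ∈-removals⁻ b κ ν∈ = go κ lenκ λκ sumκ lenν νκ sumν
    where
    go : ∀ κ → length κ ≡ suc (length λs) → Strip λs κ → ℕ.sum κ ≡ ℕ.sum λs ℕ.+ m →
         length ν ≡ length κ → Strip ν κ → ℕ.sum ν ℕ.+ b ≡ ℕ.sum κ →
         forth (κ , ν) ∈ downUp × back (forth (κ , ν)) ≡ (κ , ν)
    go (k ∷ κ′) lenκ λκ sumκ lenν νκ sumν =
      ∈-pairs⁺ {f = λ (i , μ) → additions⁻ (b ∸ i) m μ}
        (∈-pairs⁺ {f = λ i → removals i λs} (∈-upTo⁺ (s≤s i≤b)) (∈-removals⁺ i λs lenμ (proj₁ below-strips) μ+i))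
        (∈-additions⁻⁺ (b ∸ i) m μ (subst (_≤ m) (sym b∸i) j≤m)
          (subst (λ j → ν ∈ additions (m ∸ j) μ) (sym b∸i)
            (∈-additions⁺ (m ∸ j) μ (trans len (cong suc (sym lenμ)))
              (proj₂ below-strips) sumν′))) ,
      cong (_, ν) (cong₂ _∷_ (trans (cong (M ℕ.+_) b∸i) (sym k≡)) (reflect-involutive is κ′ w))
      where
      len = trans lenν lenκ
      is = intervals λs ν
      M = part λs 0 ℕ.⊔ part ν 0
      above-strips = strips-above⁻ λs ν k κ′ len λκ νκ
      w = proj₂ above-strips
      μ = reflect is κ′
      w′ = reflect-within is κ′ w
      lenμ = trans (within-length is μ w′) (length-intervals λs ν len)
      below-strips = strips-below⁺ λs ν μ len w′
      j = k ∸ M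
      k≡ : k ≡ M ℕ.+ j
      k≡ = sym (ℕ.m+[n∸m]≡n (proj₁ above-strips))
      i = ℕ.sum λs ∸ ℕ.sum μ
      μ+i : ℕ.sum μ ℕ.+ i ≡ ℕ.sum λs
      μ+i = ℕ.m+[n∸m]≡n (strip-sum μ λs (proj₁ below-strips))
      b≡ : b ≡ i ℕ.+ j
      b≡ = ℕ.+-cancelˡ-≡ (ℕ.sum μ) _ _ (trans
        (lemma₁ M j (sum-reflect is κ′ w) (endpoints-intervals λs ν len) sumν k≡)
        (trans (cong (ℕ._+ j) (sym μ+i)) (ℕ.+-assoc (ℕ.sum μ) i j)))
      i≤b : i ≤ b
      i≤b = subst (i ≤_) (sym b≡) (ℕ.m≤m+n i j)
      b∸i : b ∸ i ≡ j
      b∸i = trans (cong (_∸ i) b≡) (ℕ.m+n∸m≡n i j)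
      ν+j : ℕ.sum ν ℕ.+ j ≡ ℕ.sum μ ℕ.+ m
      ν+j = lemma₂ i j (trans (cong (ℕ.sum ν ℕ.+_) (sym b≡)) (trans sumν sumκ)) μ+i
      j≤m : j ≤ m
      j≤m = ℕ.+-cancelˡ-≤ (ℕ.sum ν) j m (subst (_≤ ℕ.sum ν ℕ.+ m) (sym ν+j)
        (ℕ.+-monoˡ-≤ m (strip-sum μ ν (proj₂ below-strips))))
      sumν′ : ℕ.sum ν ≡ ℕ.sum μ ℕ.+ (m ∸ j)
      sumν′ = ℕ.+-cancelʳ-≡ j _ _ (trans ν+j (trans
        (cong (ℕ.sum μ ℕ.+_) (sym (ℕ.m∸n+n≡m j≤m))) (sym (ℕ.+-assoc (ℕ.sum μ) (m ∸ j) j))))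

  back-∈ : ∀ {p} → p ∈ downUp → back p ∈ upDown × forth (back p) ≡ p
  back-∈ {(i , μ) , ν} p∈
    with iμ∈ , ν∈′ ← ∈-pairs⁻ removed (λ (i , μ) → additions⁻ (b ∸ i) m μ) p∈
    with i∈ , μ∈ ← ∈-pairs⁻ (upTo (suc b)) (λ i → removals i λs) iμ∈
       | j≤m , ν∈ ← ∈-additions⁻⁻ (b ∸ i) m μ ν∈′
    with lenμ , μλ , sumμ ← ∈-removals⁻ i λs μ∈
       | lenν , μν , sumν ← ∈-additions⁻ (m ∸ (b ∸ i)) μ ν∈ =
    ∈-pairs⁺ {f = removals b}
      (∈-additions⁺ m λs (cong suc lenκ′) (proj₁ above-strips) sumκ)
      (∈-removals⁺ b κ (trans len (cong suc (sym lenκ′))) (proj₂ above-strips) sumν′) ,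
    trans (cong (λ μ → (ℕ.sum λs ∸ ℕ.sum μ , μ) , ν) inv)
      (cong (λ i → (i , μ) , ν) (trans (cong (_∸ ℕ.sum μ) (sym sumμ)) (ℕ.m+n∸m≡n (ℕ.sum μ) i)))
    where
    len = trans lenν (cong suc lenμ)
    is = intervals λs ν
    M = part λs 0 ℕ.⊔ part ν 0
    j = b ∸ i
    w = strips-below⁻ λs ν μ len lenμ μλ μν
    κ′ = reflect is μ
    κ = (M ℕ.+ j) ∷ κ′
    w′ = reflect-within is μ w
    lenκ′ = trans (within-length is κ′ w′) (length-intervals λs ν len)
    above-strips = strips-above⁺ λs ν (M ℕ.+ j) κ′ len (ℕ.m≤m+n M j) w′
    inv = reflect-involutive is μ w
    b≡ : i ℕ.+ j ≡ b
    b≡ = ℕ.m+[n∸m]≡n (ℕ.s≤s⁻¹ (∈-upTo⁻ i∈))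
    ν+j : ℕ.sum ν ℕ.+ j ≡ ℕ.sum μ ℕ.+ m
    ν+j = trans (cong (ℕ._+ j) sumν) (trans (ℕ.+-assoc (ℕ.sum μ) (m ∸ j) j)
      (cong (ℕ.sum μ ℕ.+_) (ℕ.m∸n+n≡m j≤m)))
    sumκ : ℕ.sum κ ≡ ℕ.sum λs ℕ.+ m
    sumκ = lemma₃ M j {s = ℕ.sum μ} (sum-reflect is μ w) (endpoints-intervals λs ν len) ν+j
    sumν′ : ℕ.sum ν ℕ.+ b ≡ ℕ.sum κ
    sumν′ = trans (cong (ℕ.sum ν ℕ.+_) (sym b≡)) (trans (lemma₄ i j ν+j sumμ) (sym sumκ))

sum-zero : ∀ xs → ℕ.sum xs ≡ 0 → xs ≡ replicate (length xs) 0
sum-zero []          eq = refl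
sum-zero (zero ∷ xs) eq = cong (0 ∷_) (sum-zero xs eq)

-- The Pieri rule

module Pieri {c ℓ₁ ℓ₂} (K : CommutativeRing c ℓ₁)
             (_≤ᴷ_ : Rel (CommutativeRing.Carrier K) ℓ₂) where

  open FiniteSums K
  open SeriesProperties K
  open SchurBranching K _≤ᴷ_
  private
    module SF = SymmetricFunctions rawRing _≤ᴷ_
    h = completeHomogeneous

  mulˢ-∷ʳ : ∀ f g α b → mulˢ f g (α ∷ʳ b) ≈
    ∑≤ b λ i → mulˢ (f ∘ (_∷ʳ i)) (g ∘ (_∷ʳ (b ∸ i))) α
  mulˢ-∷ʳ f g []      b = ≈-refl
  mulˢ-∷ʳ f g (a ∷ α) b = ≈-trans (∑-cong-ext (upTo (suc a)) λ i → mulˢ-∷ʳ _ _ α b)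
    (∑-comm (upTo (suc a)) (upTo (suc b)) _)

  h-∷ʳ : ∀ m α j → h m (α ∷ʳ j) ≡ (if j ≤ᵇ m then h (m ∸ j) α else 0#)
  h-∷ʳ m α j = trans
    (cong (λ s → if s ≡ᵇ m then 1# else 0#)
      (trans (ℕ.sum-++ α [ j ]) (trans (cong (ℕ.sum α ℕ.+_) (ℕ.+-identityʳ j)) (ℕ.+-comm _ j))))
    (go j m)
    where
    go : ∀ j m → (if j ℕ.+ ℕ.sum α ≡ᵇ m then 1# else 0#) ≡ (if j ≤ᵇ m then h (m ∸ j) α else 0#)
    go zero    m       = refl
    go (suc j) zero    = refl
    go (suc zero)    (suc m) = refl
    go (suc (suc j)) (suc m) = go (suc j) m

  schur-[] : ∀ λs → SF.schur λs [] ≈ (if ℕ.sum λs ≡ᵇ 0 then 1# else 0#)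
  schur-[] λs = ≈-trans (go (cells (λs / []))) (reflexive (cong (λ s → if s ≡ᵇ 0 then 1# else 0#)
    (trans (size-rows (λs / []) []) (cong ℕ.sum (straight-widths λs)))))
    where
    go : ∀ cs → length (filter isSemistandard? (map (zip cs)
           (filter (hasContent? []) (words (upTo 0) (length cs))))) · 1# ≈
         (if length cs ≡ᵇ 0 then 1# else 0#)
    go []       = +-identityʳ 1#
    go (_ ∷ cs) = ≈-refl

  private
    if-≡ᵇ : ∀ {n} → n ≡ 0 → (if n ≡ᵇ 0 then 1# else 0#) ≈ 1#
    if-≡ᵇ refl = ≈-refl

    -- Without variables a Schur function is 1 for a shape without cells and 0 for all others. The
    -- sum on the right can thus only contain the addition of no cell to a shape of zero rows.
    pieri-[] : ∀ λs m → SF.schur λs [] * h m [] ≈ ∑ (additions m λs) (λ κ → SF.schur κ [])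
    pieri-[] λs m = ≈-trans (*-congʳ (schur-[] λs)) (≈-trans (go m (ℕ.sum λs) refl)
      (≈-sym (∑-cong (additions m λs) (λ {κ} κ∈ → ≈-trans (schur-[] κ) (reflexive
        (cong (λ s → if s ≡ᵇ 0 then 1# else 0#) (proj₂ (proj₂ (∈-additions⁻ m λs κ∈)))))))))
      where
      value = λ s → if s ≡ᵇ 0 then 1# else 0#
      strip-zeros : ∀ n → Strip (replicate n 0) (replicate (suc n) 0)
      strip-zeros zero    = tt
      strip-zeros (suc n) = z≤n , z≤n , strip-zeros n
      nonzero : ∀ m s → ℕ.sum λs ≡ s → ¬ s ℕ.+ m ≡ 0 →
        0# ≈ ∑ (additions m λs) (λ _ → value (ℕ.sum λs ℕ.+ m))
      nonzero m s refl ne = ≈-sym (∑-zero (additions m λs) λ _ → vanish (ℕ.sum λs ℕ.+ m) ne)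
        where
        vanish : ∀ d → ¬ d ≡ 0 → value d ≈ 0#
        vanish zero    ne = ⊥-elim (ne refl)
        vanish (suc d) ne = ≈-refl
      go : ∀ m s → ℕ.sum λs ≡ s → value s * h m [] ≈
        ∑ (additions m λs) (λ _ → value (ℕ.sum λs ℕ.+ m))
      go m       (suc s) eq = ≈-trans (zeroˡ _) (nonzero m (suc s) eq λ ())
      go (suc m) zero    eq = ≈-trans (zeroʳ _) (nonzero (suc m) zero eq λ ())
      go zero    zero    eq = ≈-trans (*-identityʳ 1#) (≈-trans
        (≈-sym (if-≡ᵇ (trans (ℕ.+-identityʳ (ℕ.sum λs)) eq)))
        (≈-sym (∑-single (additions-unique 0 λs)
          (∈-additions⁺ 0 λs (cong suc (length-replicate (length λs)))
            (subst (λ l → Strip l (replicate (suc (length λs)) 0)) (sym (sum-zero λs eq))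
              (strip-zeros (length λs)))
            (trans (sum-replicate-0 (suc (length λs))) (sym (trans (ℕ.+-identityʳ _) eq))))
          λ {κ} κ∈ ne → ⊥-elim (ne (all-zero κ κ∈)))))
        where
        all-zero : ∀ κ → κ ∈ additions 0 λs → κ ≡ replicate (suc (length λs)) 0
        all-zero κ κ∈ = let len , _ , s = ∈-additions⁻ 0 λs κ∈ in
          trans (sum-zero κ (trans s (trans (ℕ.+-identityʳ _) eq))) (cong (λ n → replicate n 0) len)

  -- The exponent `b` of the last variable is shared between the two factors: `i` from the tableau
  -- and b - i from h_m. By the induction hypothesis the product becomes the sum over `downUp`,
  -- while branching the right-hand side gives the sum over `upDown`.
  pieri : ∀ {λs} → Decreasing λs → ∀ m α →
    mulˢ (SF.schur λs) (h m) α ≈ ∑ (additions m λs) (λ κ → SF.schur κ α)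
  pieri {λs} dec m α = go dec m (reverseView α)
    where
    go : ∀ {λs} → Decreasing λs → ∀ m {α} → Reverse α →
      mulˢ (SF.schur λs) (h m) α ≈ ∑ (additions m λs) (λ κ → SF.schur κ α)
    go {λs} dec m []            = pieri-[] λs m
    go {λs} dec m (α ∶ rev ∶ʳ b) = begin
      mulˢ (SF.schur λs) (h m) (α ∷ʳ b) ≈⟨ mulˢ-∷ʳ _ _ α b ⟩
      ∑≤ b (λ i → mulˢ (SF.schur λs ∘ (_∷ʳ i)) (h m ∘ (_∷ʳ (b ∸ i))) α)
        ≈⟨ ∑-cong-ext (upTo (suc b)) (λ i → ≈-trans
             (mulˢ-cong α (λ β _ → schur-∷ʳ dec β i) (λ β _ → reflexive (h-∷ʳ m β (b ∸ i))))
             (mulˢ-∑ˡ _ (removals i λs) SF.schur α)) ⟩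
      ∑≤ b (λ i → ∑ (removals i λs) λ μ →
        mulˢ (SF.schur μ) (λ β → if b ∸ i ≤ᵇ m then h (m ∸ (b ∸ i)) β else 0#) α)
        ≈⟨ ∑-cong-ext (upTo (suc b)) (λ i → ∑-cong (removals i λs) λ {μ} μ∈ →
             let len , st , _ = ∈-removals⁻ i λs μ∈ in
             step (strip-decreasing len st) (b ∸ i)) ⟩
      ∑≤ b (λ i → ∑ (removals i λs) λ μ → ∑ (additions⁻ (b ∸ i) m μ) λ ν → SF.schur ν α)
        ≈⟨ ∑-pairs (upTo (suc b)) (λ i → removals i λs) _ ⟨
      ∑ removed (λ (i , μ) → ∑ (additions⁻ (b ∸ i) m μ) λ ν → SF.schur ν α)
        ≈⟨ ∑-pairs removed (λ (i , μ) → additions⁻ (b ∸ i) m μ) _ ⟨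
      ∑ downUp (λ (_ , ν) → SF.schur ν α)
        ≈⟨ ∑-bij forth back upDown-unique downUp-unique forth-∈ back-∈ (λ _ → ≈-refl) ⟨
      ∑ upDown (λ (_ , ν) → SF.schur ν α)
        ≈⟨ ∑-pairs (additions m λs) (removals b) _ ⟩
      ∑ (additions m λs) (λ κ → ∑ (removals b κ) λ ν → SF.schur ν α)
        ≈⟨ ∑-cong (additions m λs) (λ {κ} κ∈ → let len , st , _ = ∈-additions⁻ m λs κ∈ in
             ≈-sym (schur-∷ʳ (strip-decreasing⁺ λs κ len st) α b)) ⟩
      ∑ (additions m λs) (λ κ → SF.schur κ (α ∷ʳ b)) ∎
      where
      open LocalRule b m λs
      step : ∀ {μ} → Decreasing μ → ∀ j →
        mulˢ (SF.schur μ) (λ β → if j ≤ᵇ m then h (m ∸ j) β else 0#) α ≈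
        ∑ (additions⁻ j m μ) (λ ν → SF.schur ν α)
      step dec j with j ≤ᵇ m
      ... | true  = go dec (m ∸ j) rev
      ... | false = mulˢ-zeroʳ _ α (λ _ → ≈-refl)

-- Ribbons and standard tableaux

increment : ℕ → List ℕ → List ℕ
increment _       []      = []
increment zero    (n ∷ ν) = suc n ∷ ν
increment (suc i) (n ∷ ν) = n ∷ increment i ν

addable : ℕ → List ℕ → Bool
addable zero    ν = true
addable (suc i) ν = part ν (suc i) <ᵇ part ν i

-- The shapes obtained from ν by adding m cells one at a time, in weakly
-- decreasing rows less than i.
climb : ℕ → ℕ → List ℕ → List (List ℕ)
climb i       zero    ν = [ ν ]
climb zero    (suc m) ν = []
climb (suc i) (suc m) ν =
  (if addable i ν then climb (suc i) m (increment i ν) else []) ++ climb i (suc m) ν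

sum-increment : ∀ {i} ν → i < length ν → ℕ.sum (increment i ν) ≡ suc (ℕ.sum ν)
sum-increment {zero}  (n ∷ ν) p       = refl
sum-increment {suc i} (n ∷ ν) (s≤s p) =
  trans (cong (n ℕ.+_) (sum-increment ν p)) (ℕ.+-suc n _)

length-increment : ∀ i ν → length (increment i ν) ≡ length ν
length-increment i       []      = refl
length-increment zero    (n ∷ ν) = refl
length-increment (suc i) (n ∷ ν) = cong suc (length-increment i ν)

part-head : ∀ {n ν} → Decreasing (n ∷ ν) → part ν 0 ≤ n
part-head [-]     = z≤n
part-head (p ∷ _) = p

decreasing-∷ : ∀ {n ν} → part ν 0 ≤ n → Decreasing ν → Decreasing (n ∷ ν)
decreasing-∷ {ν = []}    p dec = [-]
decreasing-∷ {ν = _ ∷ _} p dec = p ∷ dec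

increment-decreasing : ∀ i {ν} → Decreasing ν → T (addable i ν) → Decreasing (increment i ν)
increment-decreasing i       {[]}    dec ad = []
increment-decreasing zero    {n ∷ ν} dec ad =
  decreasing-∷ (ℕ.m≤n⇒m≤1+n (part-head dec)) (Linked.tail dec)
increment-decreasing (suc zero)    {n ∷ []}     dec ad = [-]
increment-decreasing (suc zero)    {n ∷ n′ ∷ ν} dec ad =
  ℕ.<ᵇ⇒< n′ n ad ∷ increment-decreasing zero (Linked.tail dec) tt
increment-decreasing (suc (suc i)) {n ∷ []}     dec ad = [-]
increment-decreasing (suc (suc i)) {n ∷ n′ ∷ ν} (p ∷ dec) ad =
  p ∷ increment-decreasing (suc i) dec ad

-- κ / ν is a horizontal strip contained in the first i rows
StripTo : ℕ → List ℕ → List ℕ → Set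
StripTo zero    ν       κ       = ν ≡ κ
StripTo (suc i) (n ∷ ν) (k ∷ κ) = n ≤ k × part κ 0 ≤ n × StripTo i ν κ
StripTo (suc i) _       _       = ⊥

stripTo-refl : ∀ {i ν} → Decreasing ν → i ≤ length ν → StripTo i ν ν
stripTo-refl {zero}          dec p       = refl
stripTo-refl {suc i} {n ∷ ν} dec (s≤s p) =
  ℕ.≤-refl , part-head dec , stripTo-refl (Linked.tail dec) p

stripTo-suc : ∀ {i ν κ} → Decreasing ν → i < length ν → StripTo i ν κ → StripTo (suc i) ν κ
stripTo-suc {zero}  {n ∷ ν} {k ∷ κ} dec p       refl         = ℕ.≤-refl , part-head dec , refl
stripTo-suc {suc i} {n ∷ ν} {k ∷ κ} dec (s≤s p) (q , r , st) =
  q , r , stripTo-suc (Linked.tail dec) p st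

stripTo-increment : ∀ {i ν κ} → Decreasing ν → i < length ν →
  StripTo (suc i) (increment i ν) κ → StripTo (suc i) ν κ
stripTo-increment {zero}  {n ∷ ν} {k ∷ κ} dec p (q , r , refl) = ℕ.<⇒≤ q , part-head dec , refl
stripTo-increment {suc i} {n ∷ ν} {k ∷ κ} dec (s≤s p) (q , r , st) =
  q , r , stripTo-increment (Linked.tail dec) p st

-- Mirrors the recursion of `climb`: row `i` of κ equals that of ν or is longer. If it is longer, a
-- cell can be added there, as the strip condition keeps row `i` of κ within the row of ν above.
stripTo-cases : ∀ {i ν κ} → i < length ν → StripTo (suc i) ν κ →
  StripTo i ν κ ⊎ (T (addable i ν) × StripTo (suc i) (increment i ν) κ)
stripTo-cases {zero}  {n ∷ ν} {k ∷ κ} p (q , r , refl) with ℕ.m≤n⇒m<n∨m≡n q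
... | inj₁ n<k  = inj₂ (tt , n<k , ℕ.m≤n⇒m≤1+n r , refl)
... | inj₂ refl = inj₁ refl
stripTo-cases {suc i} {n ∷ ν} {k ∷ κ} (s≤s p) (q , r , st) with stripTo-cases {i} p st
... | inj₁ st′        = inj₁ (q , r , st′)
... | inj₂ (ad , st′) = inj₂ (lift i p r ad st′ , q , r , st′)
  where
  lift : ∀ i {ν κ} → i < length ν → part κ 0 ≤ n → T (addable i ν) →
    StripTo (suc i) (increment i ν) κ → T (addable (suc i) (n ∷ ν))
  lift zero    {n′ ∷ ν} {k′ ∷ κ} p r ad (q , _) = ℕ.<⇒<ᵇ (ℕ.≤-trans q r)
  lift (suc i) p r ad st = ad

stripTo-part : ∀ i {ν κ} → StripTo i ν κ → part κ i ≡ part ν i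
stripTo-part zero    refl = refl
stripTo-part (suc i) {n ∷ ν} {k ∷ κ} (_ , _ , st) = stripTo-part i st

stripTo-part-increment : ∀ i {ν κ} → i < length ν → StripTo (suc i) (increment i ν) κ →
  part ν i < part κ i
stripTo-part-increment zero    {n ∷ ν} {k ∷ κ} p       (q , _)      = q
stripTo-part-increment (suc i) {n ∷ ν} {k ∷ κ} (s≤s p) (_ , _ , st) = stripTo-part-increment i p st

stripTo-sum : ∀ i {ν κ} → StripTo i ν κ → ℕ.sum ν ≤ ℕ.sum κ
stripTo-sum zero    refl = ℕ.≤-refl
stripTo-sum (suc i) {n ∷ ν} {k ∷ κ} (p , _ , st) = ℕ.+-mono-≤ p (stripTo-sum i st)

stripTo-equal : ∀ i {ν κ} → StripTo i ν κ → ℕ.sum κ ≡ ℕ.sum ν → κ ≡ ν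
stripTo-equal zero    refl eq = refl
stripTo-equal (suc i) {n ∷ ν} {k ∷ κ} (p , _ , st) eq with ℕ.m≤n⇒m<n∨m≡n p
... | inj₂ refl = cong (n ∷_) (stripTo-equal i st (ℕ.+-cancelˡ-≡ n _ _ eq))
... | inj₁ n<k  = ⊥-elim (ℕ.<-irrefl (sym eq) (ℕ.+-mono-<-≤ n<k (stripTo-sum i st)))

∈-climb⁻ : ∀ i m {ν κ} → Decreasing ν → i ≤ length ν → κ ∈ climb i m ν →
  length κ ≡ length ν × StripTo i ν κ × ℕ.sum κ ≡ ℕ.sum ν ℕ.+ m
∈-climb⁻ i       zero    dec p (here refl) = refl , stripTo-refl dec p , sym (ℕ.+-identityʳ _)
∈-climb⁻ (suc i) (suc m) {ν} dec p κ∈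
  with addable i ν in eq
     | ∈-++⁻ (if addable i ν then climb (suc i) m (increment i ν) else []) κ∈
... | _     | inj₂ κ∈ with len , st , s ← ∈-climb⁻ i (suc m) dec (ℕ.<⇒≤ p) κ∈ =
  len , stripTo-suc dec p st , s
... | true  | inj₁ κ∈
  with len , st , s ← ∈-climb⁻ (suc i) m
         (increment-decreasing i dec (subst T (sym eq) tt))
         (subst (suc i ≤_) (sym (length-increment i ν)) p) κ∈ =
  trans len (length-increment i ν) , stripTo-increment dec p st ,
  trans s (trans (cong (ℕ._+ m) (sum-increment ν p)) (sym (ℕ.+-suc _ m)))

∈-climb⁺ : ∀ i m {ν κ} → i ≤ length ν → StripTo i ν κ → ℕ.sum κ ≡ ℕ.sum ν ℕ.+ m → κ ∈ climb i m ν
∈-climb⁺ i       zero    p st s = here (stripTo-equal i st (trans s (ℕ.+-identityʳ _)))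
∈-climb⁺ zero    (suc m) p refl s = ⊥-elim (ℕ.m≢1+m+n _ (trans s (ℕ.+-suc _ m)))
∈-climb⁺ (suc i) (suc m) {ν} p st s with stripTo-cases {i} p st
... | inj₁ st′ = ∈-++⁺ʳ (if addable i ν then climb (suc i) m (increment i ν) else [])
                   (∈-climb⁺ i (suc m) (ℕ.<⇒≤ p) st′ s)
... | inj₂ (ad , st′) with addable i ν
...   | true = ∈-++⁺ˡ (∈-climb⁺ (suc i) m (subst (suc i ≤_) (sym (length-increment i ν)) p) st′
                 (trans s (trans (ℕ.+-suc _ m) (cong (ℕ._+ m) (sym (sum-increment ν p))))))

-- The final length of row `i` tells the two alternatives of `climb` apart: it has grown in the
-- first and is unchanged in the second.
climb-unique : ∀ i m {ν} → Decreasing ν → i ≤ length ν → Unique (climb i m ν)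
climb-unique i       zero    dec p = [] ∷ []
climb-unique zero    (suc m) dec p = []
climb-unique (suc i) (suc m) {ν} dec p with addable i ν in eq
... | false = climb-unique i (suc m) dec (ℕ.<⇒≤ p)
... | true  = Unique.++⁺ (climb-unique (suc i) m dec′ p′) (climb-unique i (suc m) dec (ℕ.<⇒≤ p))
  λ (κ∈ , κ∈′) → ℕ.<-irrefl (sym (stripTo-part i (proj₁ (proj₂ (∈-climb⁻ i (suc m) dec (ℕ.<⇒≤ p) κ∈′)))))
    (stripTo-part-increment i p (proj₁ (proj₂ (∈-climb⁻ (suc i) m dec′ p′ κ∈))))
  where
  dec′ = increment-decreasing i dec (subst T (sym eq) tt)
  p′ = subst (suc i ≤_) (sym (length-increment i ν)) p

stripTo⇒strip : ∀ λs κ → StripTo (suc (length λs)) (λs ∷ʳ 0) κ → Strip λs κ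
stripTo⇒strip []       (k ∷ _) (_ , _ , refl) = tt
stripTo⇒strip (l ∷ λs) (k ∷ κ) (p , q , st)   = p , q , stripTo⇒strip λs κ st

strip⇒stripTo : ∀ λs κ → length κ ≡ suc (length λs) → Strip λs κ →
  StripTo (suc (length λs)) (λs ∷ʳ 0) κ
strip⇒stripTo []       (k ∷ [])     len st           = z≤n , z≤n , refl
strip⇒stripTo (l ∷ λs) (k ∷ κ)      len (p , q , st) =
  p , q , strip⇒stripTo λs κ (ℕ.suc-injective len) st

∷ʳ0-decreasing : ∀ {λs} → Decreasing λs → Decreasing (λs ∷ʳ 0)
∷ʳ0-decreasing []        = [-]
∷ʳ0-decreasing [-]       = z≤n ∷ [-]
∷ʳ0-decreasing (p ∷ dec) = p ∷ ∷ʳ0-decreasing dec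

sum-∷ʳ0 : ∀ λs → ℕ.sum (λs ∷ʳ 0) ≡ ℕ.sum λs
sum-∷ʳ0 λs = trans (ℕ.sum-++ λs [ 0 ]) (ℕ.+-identityʳ _)

part-∷ʳ0 : ∀ ν i → part (ν ∷ʳ 0) i ≡ part ν i
part-∷ʳ0 []      zero    = refl
part-∷ʳ0 []      (suc i) = refl
part-∷ʳ0 (n ∷ ν) zero    = refl
part-∷ʳ0 (n ∷ ν) (suc i) = part-∷ʳ0 ν i

addable-∷ʳ0 : ∀ i ν → addable i (ν ∷ʳ 0) ≡ addable i ν
addable-∷ʳ0 zero    ν = refl
addable-∷ʳ0 (suc i) ν = cong₂ _<ᵇ_ (part-∷ʳ0 ν (suc i)) (part-∷ʳ0 ν i)

increment-∷ʳ0 : ∀ i ν → i < length ν → increment i (ν ∷ʳ 0) ≡ increment i ν ∷ʳ 0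
increment-∷ʳ0 zero    (n ∷ ν) p       = refl
increment-∷ʳ0 (suc i) (n ∷ ν) (s≤s p) = cong (n ∷_) (increment-∷ʳ0 i ν p)

climb-∷ʳ0 : ∀ i m ν → i ≤ length ν → climb i m (ν ∷ʳ 0) ≡ map (_∷ʳ 0) (climb i m ν)
climb-∷ʳ0 i       zero    ν p = refl
climb-∷ʳ0 zero    (suc m) ν p = refl
climb-∷ʳ0 (suc i) (suc m) ν p rewrite addable-∷ʳ0 i ν | climb-∷ʳ0 i (suc m) ν (ℕ.<⇒≤ p)
  with addable i ν
... | false = refl
... | true  rewrite increment-∷ʳ0 i ν p
                  | climb-∷ʳ0 (suc i) m (increment i ν)
                      (subst (suc i ≤_) (sym (length-increment i ν)) p) =
  sym (map-++ (_∷ʳ 0) (climb (suc i) m (increment i ν)) (climb i (suc m) ν))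

-- A state is a shape with one plus the row of the last cell added to it.
-- moves k i lists the ways to add a cell in a row between i and i + k - 1.
moves : ℕ → ℕ → List ℕ → List (ℕ × List ℕ)
moves zero    i ν = []
moves (suc k) i ν =
  (if addable (k ℕ.+ i) ν then [ (suc (k ℕ.+ i) , increment (k ℕ.+ i) ν) ] else []) ++ moves k i ν

-- the standard Young tableaux with descents in the positions of the north
-- steps, each recorded by its final state
chains : List Direction → List (ℕ × List ℕ)
chains []          = [ (1 , [ 1 ]) ]
chains (east ∷ u)  = concatMap (λ (i , ν) → moves i 0 ν) (chains u)
chains (north ∷ u) = concatMap (λ (i , ν) → moves (suc (length ν) ∸ i) i (ν ∷ʳ 0)) (chains u)

record State (n : ℕ) (s : ℕ × List ℕ) : Set where
  constructor state
  field
    decreasing : Decreasing (proj₂ s)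
    row        : proj₁ s ≤ length (proj₂ s)
    total      : ℕ.sum (proj₂ s) ≡ n

moves-state : ∀ k i ν {n s} → Decreasing ν → ℕ.sum ν ≡ n → k ℕ.+ i ≤ length ν →
  s ∈ moves k i ν → State (suc n) s
moves-state (suc k) i ν dec sum p s∈
  with addable (k ℕ.+ i) ν in eq
     | ∈-++⁻ (if addable (k ℕ.+ i) ν then [ (suc (k ℕ.+ i) , increment (k ℕ.+ i) ν) ] else []) s∈
... | _    | inj₂ s∈ = moves-state k i ν dec sum (ℕ.<⇒≤ p) s∈
... | true | inj₁ (here refl) = state (increment-decreasing (k ℕ.+ i) dec (subst T (sym eq) tt))
  (subst (suc (k ℕ.+ i) ≤_) (sym (length-increment (k ℕ.+ i) ν)) p)
  (trans (sum-increment ν p) (cong suc sum))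

chains-state : ∀ u {s} → s ∈ chains u → State (suc (length u)) s
chains-state []         (here refl) = state [-] (s≤s z≤n) refl
chains-state (east ∷ u) s∈
  with (i , ν) , ν∈ , q ← find (∈-concatMap⁻ (λ (i , ν) → moves i 0 ν) {chains u} s∈)
  with state dec row sum ← chains-state u ν∈ =
  moves-state i 0 ν dec sum (subst (_≤ length ν) (sym (ℕ.+-identityʳ i)) row) q
chains-state (north ∷ u) s∈
  with (i , ν) , ν∈ , q ← find (∈-concatMap⁻
         (λ (i , ν) → moves (suc (length ν) ∸ i) i (ν ∷ʳ 0)) {chains u} s∈)
  with state dec row sum ← chains-state u ν∈ =
  moves-state (suc (length ν) ∸ i) i (ν ∷ʳ 0) (∷ʳ0-decreasing dec) (trans (sum-∷ʳ0 ν) sum)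
    (ℕ.≤-reflexive (trans (ℕ.m∸n+n≡m (ℕ.m≤n⇒m≤1+n row)) (sym (length-∷ʳ ν 0)))) q

-- The leading east steps form the top row of the ribbon, the one glued on last.
data LastRow : List Direction → Set where
  only : ∀ m → LastRow (replicate m east)
  upon : ∀ m u → LastRow (replicate m east ++ north ∷ u)

lastRow : ∀ u → LastRow u
lastRow []          = only 0
lastRow (north ∷ u) = upon 0 u
lastRow (east ∷ u) with lastRow u
... | only m   = only (suc m)
... | upon m v = upon (suc m) v

norths : List Direction → ℕ
norths []          = 0
norths (east ∷ u)  = norths u
norths (north ∷ u) = suc (norths u)

norths-replicate : ∀ m u → norths (replicate m east ++ u) ≡ norths u
norths-replicate zero    u = refl
norths-replicate (suc m) u = norths-replicate m u

positiveParts : List ℕ → List ℕ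
positiveParts = filter (0 ℕ.<?_)

cells-∷ʳ0 : ∀ λs → cells ((λs ∷ʳ 0) / []) ≡ cells (λs / [])
cells-∷ʳ0 λs = trans (cells-rows (λs ∷ʳ 0) []) (trans (go 0 λs) (sym (cells-rows λs [])))
  where
  go : ∀ d λs → cellsFrom d (rows (λs ∷ʳ 0) []) ≡ cellsFrom d (rows λs [])
  go d []       = refl
  go d (l ∷ λs) = cong (map (d ,_) (range 0 l) ++_) (go (suc d) λs)

cells-positiveParts : ∀ {λs} → Decreasing λs → cells (positiveParts λs / []) ≡ cells (λs / [])
cells-positiveParts {λs} dec =
  trans (cells-rows (positiveParts λs) []) (trans (go 0 dec) (sym (cells-rows λs [])))
  where
  zeros : ∀ d {λs} → Decreasing (0 ∷ λs) →
    cellsFrom d (rows (positiveParts λs) []) ≡ cellsFrom d (rows λs [])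
  zeros d {[]}     dec         = refl
  zeros d {0 ∷ λs} (p ∷ dec) = zeros′ d dec
    where
    zeros′ : ∀ d {λs} → Decreasing (0 ∷ λs) →
      cellsFrom d (rows (positiveParts λs) []) ≡ cellsFrom (suc d) (rows λs [])
    zeros′ d {[]}     dec       = refl
    zeros′ d {0 ∷ λs} (p ∷ dec) = trans (zeros′ d dec) (shift-zeros dec)
      where
      shift-zeros : ∀ {d λs} → Decreasing (0 ∷ λs) →
        cellsFrom d (rows λs []) ≡ cellsFrom (suc d) (rows λs [])
      shift-zeros {λs = []}     dec       = refl
      shift-zeros {λs = 0 ∷ λs} (p ∷ dec) = shift-zeros dec
  go : ∀ d {λs} → Decreasing λs → cellsFrom d (rows (positiveParts λs) []) ≡ cellsFrom d (rows λs [])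
  go d {[]}         dec = refl
  go d {zero ∷ λs}  dec = zeros d (z≤n ∷ dec)
  go d {suc l ∷ λs} dec = cong (map (d ,_) (range 0 (suc l)) ++_) (go (suc d) (Linked.tail dec))

module RibbonExpansion {c ℓ₁ ℓ₂} (K : CommutativeRing c ℓ₁)
                       (_≤ᴷ_ : Rel (CommutativeRing.Carrier K) ℓ₂) where

  open FiniteSums K
  open SeriesProperties K
  open RibbonSeries K
  open Pieri K _≤ᴷ_
  private
    module SF = SymmetricFunctions rawRing _≤ᴷ_
    h = completeHomogeneous

  -- Since only the cells of a diagram matter, zero rows can be appended and dropped without
  -- changing a Schur function.
  skewSchur-cells : ∀ D E → cells D ≡ cells E → ∀ α → SF.skewSchur D α ≡ SF.skewSchur E α
  skewSchur-cells D E eq α = cong (λ cs → length (filter isSemistandard? (map (zip cs)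
    (filter (hasContent? α) (words (upTo (length α)) (length cs))))) · 1#) eq

  schur-∅ : ∀ α → SF.schur [] α ≈ h 0 α
  schur-∅ α with hasContent? α []
  ... | yes eq = ≈-trans (+-identityʳ 1#) (reflexive (cong (λ s → if s ≡ᵇ 0 then 1# else 0#)
    (sym (trans (cong ℕ.sum (trans (sym eq) (content-[] (length α)))) (sum-replicate-0 (length α))))))
  ... | no  ne = nonzero (ℕ.sum α) refl
    where
    nonzero : ∀ s → ℕ.sum α ≡ s → 0# ≈ (if s ≡ᵇ 0 then 1# else 0#)
    nonzero zero    eq = ⊥-elim (ne (trans (content-[] (length α)) (sym (sum-zero α eq))))
    nonzero (suc s) eq = ≈-refl

  -- The cells of a horizontal strip can be added in weakly decreasing rows in exactly one order,
  -- from left to right. The appended 0 is the new row that the strip may open.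
  ∑-climb : ∀ {λs} → Decreasing λs → ∀ m F →
    ∑ (climb (suc (length λs)) m (λs ∷ʳ 0)) F ≈ ∑ (additions m λs) F
  ∑-climb {λs} dec m F = ∑-bij id id (climb-unique (suc (length λs)) m dec′ p) (additions-unique m λs)
    (λ κ∈ → let len , st , s = ∈-climb⁻ (suc (length λs)) m dec′ p κ∈ in
      ∈-additions⁺ m λs (trans len (length-∷ʳ λs 0)) (stripTo⇒strip λs _ st)
        (trans s (cong (ℕ._+ m) (sum-∷ʳ0 λs))) , refl)
    (λ κ∈ → let len , st , s = ∈-additions⁻ m λs κ∈ in
      ∈-climb⁺ (suc (length λs)) m p (strip⇒stripTo λs _ len st)
        (trans s (cong (ℕ._+ m) (sym (sum-∷ʳ0 λs)))) , refl)
    (λ _ → ≈-refl)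
    where
    dec′ = ∷ʳ0-decreasing dec
    p = ℕ.≤-reflexive (sym (length-∷ʳ λs 0))

  -- Sorts the climbs by the row of their first cell. When `i` is one plus the row of the cell added
  -- before, the first sum collects the climbs that begin with a descent.
  ∑-climb-moves : ∀ k i m ν F → ∑ (climb (k ℕ.+ i) (suc m) ν) F ≈
    ∑ (moves k i ν) (λ (j , ν′) → ∑ (climb j m ν′) F) + ∑ (climb i (suc m) ν) F
  ∑-climb-moves zero    i m ν F = ≈-sym (+-identityˡ _)
  ∑-climb-moves (suc k) i m ν F with addable (k ℕ.+ i) ν
  ... | false = ∑-climb-moves k i m ν F
  ... | true  = begin
    _ ≈⟨ ∑-++ (climb (suc (k ℕ.+ i)) m (increment (k ℕ.+ i) ν)) (climb (k ℕ.+ i) (suc m) ν) F ⟩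
    _ ≈⟨ +-congˡ (∑-climb-moves k i m ν F) ⟩
    _ ≈⟨ +-assoc _ _ _ ⟨
    _ ∎

  -- An east step puts the next cell weakly above the last one. So m east steps after the state (i,
  -- ν) add m cells in weakly decreasing rows less than `i`, which is a climb; `F` sees only the
  -- shape reached.
  ∑-chains-row : ∀ m u F → ∑ (chains (replicate m east ++ u)) (λ (_ , ν) → F ν) ≈
    ∑ (chains u) (λ (i , ν) → ∑ (climb i m ν) F)
  ∑-chains-row zero    u F = ∑-cong-ext (chains u) λ _ → ≈-sym (+-identityʳ _)
  ∑-chains-row (suc m) u F = begin
    _ ≡⟨ cong (λ v → ∑ (chains v) (λ (_ , ν) → F ν)) (replicate-snoc m u) ⟨
    _ ≈⟨ ∑-chains-row m (east ∷ u) F ⟩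
    _ ≈⟨ ∑-concatMap (λ (i , ν) → moves i 0 ν) (chains u) _ ⟩
    _ ≈⟨ ∑-cong-ext (chains u) (λ (i , ν) → ≈-sym (≈-trans
           (reflexive (cong (λ j → ∑ (climb j (suc m) ν) F) (sym (ℕ.+-identityʳ i))))
           (≈-trans (∑-climb-moves i 0 m ν F) (+-identityʳ _)))) ⟩
    _ ∎

  private
    Expands : List Direction → Set _
    Expands u = ∀ α → ribbon u α ≈ ∑ (chains u) (λ (_ , ν) → SF.schur ν α)

    expands-row : ∀ m → Expands (replicate m east)
    expands-row m α = begin
      ribbon (replicate m east) α ≈⟨ ribbon-row m α ⟩
      h (suc m) α                 ≈⟨ mulˢ-identityˡ (h (suc m)) α ⟨
      mulˢ (h 0) (h (suc m)) α    ≈⟨ mulˢ-congˡ α (λ β _ → schur-∅ β) ⟨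
      mulˢ (SF.schur []) (h (suc m)) α ≈⟨ pieri [] (suc m) α ⟩
      ∑ (additions (suc m) []) F  ≈⟨ ∑-climb [] (suc m) F ⟨
      ∑ (climb 1 m [ 1 ] ++ []) F ≡⟨ cong (λ xs → ∑ xs F) (++-identityʳ (climb 1 m [ 1 ])) ⟩
      ∑ (climb 1 m [ 1 ]) F       ≈⟨ +-identityʳ _ ⟨
      ∑ (chains []) (λ (i , ν) → ∑ (climb i m ν) F) ≈⟨ ∑-chains-row m [] F ⟨
      ∑ (chains (replicate m east ++ [])) (λ (_ , ν) → F ν)
        ≡⟨ cong (λ v → ∑ (chains v) (λ (_ , ν) → F ν)) (++-identityʳ (replicate m east)) ⟩
      ∑ (chains (replicate m east)) (λ (_ , ν) → F ν) ∎
      where F = λ ν → SF.schur ν α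

    -- Both the product of the ribbon `u` with h_(m+1) and its expansion by the Pieri rule split in
    -- two. The parts without a descent at the junction agree by the second hypothesis and are
    -- cancelled.
    expands-upon : ∀ m u → Expands u → Expands (replicate (suc m) east ++ u) →
      Expands (replicate m east ++ north ∷ u)
    expands-upon m u IH IH′ α = +-cancelʳ (ribbon e α) _ _ (begin
      ribbon (replicate m east ++ north ∷ u) α + ribbon e α ≈⟨ ribbon-*-h u m α ⟨
      mulˢ (ribbon u) (h (suc m)) α ≈⟨ mulˢ-congˡ α (λ β _ → IH β) ⟩
      mulˢ (λ β → ∑ (chains u) λ (_ , ν) → SF.schur ν β) (h (suc m)) α
        ≈⟨ mulˢ-∑ˡ _ (chains u) (λ (_ , ν) → SF.schur ν) α ⟩
      ∑ (chains u) (λ (_ , ν) → mulˢ (SF.schur ν) (h (suc m)) α)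
        ≈⟨ ∑-cong (chains u) (λ {s} s∈ → split s (chains-state u s∈)) ⟩
      ∑ (chains u) (λ (i , ν) →
        ∑ (moves (suc (length ν) ∸ i) i (ν ∷ʳ 0)) (λ (j , ν′) → ∑ (climb j m ν′) F) +
        ∑ (climb i (suc m) ν) F)
        ≈⟨ ∑-+ (chains u) _ _ ⟩
      _ ≈⟨ +-cong
        (≈-trans (≈-sym (∑-concatMap (λ (i , ν) → moves (suc (length ν) ∸ i) i (ν ∷ʳ 0)) (chains u) _))
          (≈-sym (∑-chains-row m (north ∷ u) F)))
        (≈-trans (≈-sym (∑-chains-row (suc m) u F)) (≈-trans (≈-sym (IH′ α))
          (reflexive (cong (λ v → ribbon v α) (sym (replicate-snoc m u)))))) ⟩
      ∑ (chains (replicate m east ++ north ∷ u)) (λ (_ , ν) → F ν) + ribbon e α ∎)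
      where
      F = λ ν → SF.schur ν α
      e = replicate m east ++ east ∷ u
      split : ∀ ((i , ν) : ℕ × List ℕ) → State (suc (length u)) (i , ν) →
        mulˢ (SF.schur ν) (h (suc m)) α ≈
        ∑ (moves (suc (length ν) ∸ i) i (ν ∷ʳ 0)) (λ (j , ν′) → ∑ (climb j m ν′) F) +
        ∑ (climb i (suc m) ν) F
      split (i , ν) (state dec row _) = begin
        mulˢ (SF.schur ν) (h (suc m)) α ≈⟨ pieri dec (suc m) α ⟩
        ∑ (additions (suc m) ν) F ≈⟨ ∑-climb dec (suc m) F ⟨
        ∑ (climb (suc (length ν)) (suc m) (ν ∷ʳ 0)) F
          ≡⟨ cong (λ j → ∑ (climb j (suc m) (ν ∷ʳ 0)) F) (ℕ.m∸n+n≡m (ℕ.m≤n⇒m≤1+n row)) ⟨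
        ∑ (climb (suc (length ν) ∸ i ℕ.+ i) (suc m) (ν ∷ʳ 0)) F
          ≈⟨ ∑-climb-moves (suc (length ν) ∸ i) i m (ν ∷ʳ 0) F ⟩
        -- These climbs stay in rows less than `i`, hence within the rows of `ν`, and never reach
        -- the appended zero row.
        _ ≈⟨ +-congˡ (begin
          ∑ (climb i (suc m) (ν ∷ʳ 0)) F ≡⟨ cong (λ xs → ∑ xs F) (climb-∷ʳ0 i (suc m) ν row) ⟩
          ∑ (map (_∷ʳ 0) (climb i (suc m) ν)) F ≡⟨ ∑-map (_∷ʳ 0) (climb i (suc m) ν) F ⟩
          ∑ (climb i (suc m) ν) (λ κ → F (κ ∷ʳ 0))
            ≈⟨ ∑-cong-ext (climb i (suc m) ν) (λ κ → reflexive (skewSchur-cells ((κ ∷ʳ 0) / []) (κ / []) (cells-∷ʳ0 κ) α)) ⟩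
          ∑ (climb i (suc m) ν) F ∎) ⟩
        _ ∎

    -- Recursion on the number of north steps instead of the length: the ribbon
    -- `replicate (suc m) east ++ v` to be cancelled has as many steps as `u`.
    expands : ∀ N u → norths u < N → Expands u
    expands (suc N) u p with lastRow u
    ... | only m   = expands-row m
    ... | upon m v = expands-upon m v (expands N v q)
          (expands N (replicate (suc m) east ++ v) (subst (_< N) (sym (norths-replicate m v)) q))
      where
      q : norths v < N
      q = ℕ.s≤s⁻¹ (subst (_< suc N) (norths-replicate m (north ∷ v)) p)

  ribbon-schur : ∀ u α → ribbon u α ≈ ∑ (chains u) (λ (_ , ν) → SF.schur ν α)
  ribbon-schur u = expands (suc (norths u)) u ℕ.≤-refl

-- Fillings of ribbons as explicit words

pattern? : List Direction → ℕ → List ℕ → Bool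
pattern? []      x []      = true
pattern? []      x (_ ∷ _) = false
pattern? (s ∷ u) x []      = false
pattern? (s ∷ u) x (y ∷ w) = follows s x y ∧ pattern? u y w

hasSteps : List Direction → List ℕ → Bool
hasSteps u []      = false
hasSteps u (x ∷ w) = pattern? u x w

content-∷ : ∀ L x w → x < L → content L (x ∷ w) ≡ increment x (content L w)
content-∷ L x w x<L = subst
  (λ is → map (λ i → count i (x ∷ w)) is ≡ increment x (map (λ i → count i w) is))
  (sym (applyUpTo-range id 0 L (λ _ → refl))) (go 0 L x refl x<L)
  where
  unchanged : ∀ {k} n → x < k →
    map (λ i → count i (x ∷ w)) (range k n) ≡ map (λ i → count i w) (range k n)
  unchanged zero    p = refl
  unchanged {k} (suc n) p = cong₂ _∷_
    (cong length (filter-reject (k ℕ.≟_) {xs = w} (λ eq → ℕ.<-irrefl (sym eq) p)))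
    (unchanged n (ℕ.m<n⇒m<1+n p))
  go : ∀ k n y → x ≡ k ℕ.+ y → y < n →
    map (λ i → count i (x ∷ w)) (range k n) ≡ increment y (map (λ i → count i w) (range k n))
  go k (suc n) zero    eq p = cong₂ _∷_
    (cong length (filter-accept (k ℕ.≟_) {xs = w} (sym (trans eq (ℕ.+-identityʳ k)))))
    (unchanged n (s≤s (ℕ.≤-reflexive (trans eq (ℕ.+-identityʳ k)))))
  go k (suc n) (suc y) eq (s≤s p) = cong₂ _∷_
    (cong length (filter-reject (k ℕ.≟_) {xs = w}
      (λ k≡x → ℕ.m≢1+m+n k (trans k≡x (trans eq (ℕ.+-suc k y))))))
    (go (suc k) n y (trans eq (ℕ.+-suc k y)) p)

length-content : ∀ L w → length (content L w) ≡ L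
length-content L w = trans (length-map _ (upTo L)) (length-upTo L)

content-↭ : ∀ L {v w} → v ↭ w → content L v ≡ content L w
content-↭ L p = map-cong (λ i → ↭-length (filter-↭ (i ℕ.≟_) p)) (upTo L)

ribbonWords : List Direction → List ℕ → List (List ℕ)
ribbonWords u α = filter (T? ∘ hasSteps u)
  (filter (hasContent? α) (words (upTo (length α)) (suc (length u))))

ribbonWords-unique : ∀ u α → Unique (ribbonWords u α)
ribbonWords-unique u α = Unique.filter⁺ (T? ∘ hasSteps u) (Unique.filter⁺ (hasContent? α)
  (words-unique (suc (length u)) (Unique.upTo⁺ (length α))))

∈-ribbonWords⁻ : ∀ u α {w} → w ∈ ribbonWords u α →
  length w ≡ suc (length u) × All (_< length α) w × content (length α) w ≡ α × T (hasSteps u w)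
∈-ribbonWords⁻ u α w∈ =
  let v∈ , p = ∈-filter⁻ (T? ∘ hasSteps u)
                 {xs = filter (hasContent? α) (words (upTo (length α)) (suc (length u)))} w∈
      u∈ , co = ∈-filter⁻ (hasContent? α) {xs = words (upTo (length α)) (suc (length u))} v∈
      len , al = ∈-words⁻ (suc (length u)) u∈
  in len , All.map ∈-upTo⁻ al , co , p

∈-ribbonWords⁺ : ∀ u α {w} → length w ≡ suc (length u) → All (_< length α) w →
  content (length α) w ≡ α → T (hasSteps u w) → w ∈ ribbonWords u α
∈-ribbonWords⁺ u α {w} len al co p = ∈-filter⁺ (T? ∘ hasSteps u)
  (∈-filter⁺ (hasContent? α) (subst (λ n → w ∈ words (upTo (length α)) n) len
    (∈-words⁺ (All.map ∈-upTo⁺ al))) co) p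

module RibbonWords {c ℓ} (K : CommutativeRing c ℓ) where

  open FiniteSums K
  open SeriesProperties K
  open RibbonSeries K
  private h = completeHomogeneous

  indicator : List ℕ → Series
  indicator cs α = if does (List-≡-dec ℕ._≟_ cs α) then 1# else 0#

  indicator-zero : ∀ α → indicator (replicate (length α) 0) α ≈ h 0 α
  indicator-zero []          = ≈-refl
  indicator-zero (zero ∷ α)  = ≈-trans (reflexive (cong (if_then 1# else 0#)
    (does-⇔ (mk⇔ (proj₂ ∘ ∷-injective) (cong (0 ∷_)))
      (List-≡-dec ℕ._≟_ (0 ∷ replicate (length α) 0) (0 ∷ α))
      (List-≡-dec ℕ._≟_ (replicate (length α) 0) α)))) (indicator-zero α)
  indicator-zero (suc a ∷ α) = reflexive (cong (if_then 1# else 0#)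
    (dec-false (List-≡-dec ℕ._≟_ (0 ∷ replicate (length α) 0) (suc a ∷ α)) λ ()))

  shift-indicator : ∀ x cs α → length cs ≡ length α → x < length α →
    shift x (indicator cs) α ≈ indicator (increment x cs) α
  shift-indicator zero    (c ∷ cs) (zero ∷ α)  len p = reflexive (cong (if_then 1# else 0#)
    (sym (dec-false (List-≡-dec ℕ._≟_ (suc c ∷ cs) (zero ∷ α)) λ ())))
  shift-indicator zero    (c ∷ cs) (suc a ∷ α) len p = reflexive (cong (if_then 1# else 0#)
    (does-⇔ (mk⇔
      (λ eq → cong₂ _∷_ (cong suc (proj₁ (∷-injective eq))) (proj₂ (∷-injective eq)))
      (λ eq → cong₂ _∷_ (ℕ.suc-injective (proj₁ (∷-injective eq))) (proj₂ (∷-injective eq))))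
      (List-≡-dec ℕ._≟_ (c ∷ cs) (a ∷ α)) (List-≡-dec ℕ._≟_ (suc c ∷ cs) (suc a ∷ α))))
  shift-indicator (suc x) (c ∷ cs) (a ∷ α)     len (s≤s p) with c ℕ.≟ a
  ... | no  c≢a = ≈-trans (shift-zero x α (λ β → absent β c≢a))
          (≈-sym (absent′ c≢a))
    where
    absent : ∀ β → ¬ c ≡ a → indicator (c ∷ cs) (a ∷ β) ≈ 0#
    absent β ne = reflexive (cong (if_then 1# else 0#)
      (dec-false (List-≡-dec ℕ._≟_ (c ∷ cs) (a ∷ β)) (ne ∘ proj₁ ∘ ∷-injective)))
    absent′ : ¬ c ≡ a → indicator (c ∷ increment x cs) (a ∷ α) ≈ 0#
    absent′ ne = reflexive (cong (if_then 1# else 0#)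
      (dec-false (List-≡-dec ℕ._≟_ (c ∷ increment x cs) (a ∷ α)) (ne ∘ proj₁ ∘ ∷-injective)))
  ... | yes refl = begin
    shift x (λ β → indicator (c ∷ cs) (c ∷ β)) α
      ≈⟨ shift-cong x α (λ β _ → strip cs β) ⟩
    shift x (indicator cs) α ≈⟨ shift-indicator x cs α (ℕ.suc-injective len) p ⟩
    indicator (increment x cs) α ≈⟨ strip (increment x cs) α ⟨
    indicator (c ∷ increment x cs) (c ∷ α) ∎
    where
    strip : ∀ cs β → indicator (c ∷ cs) (c ∷ β) ≈ indicator cs β
    strip cs β = reflexive (cong (if_then 1# else 0#)
      (does-⇔ (mk⇔ (proj₂ ∘ ∷-injective) (cong (c ∷_)))
        (List-≡-dec ℕ._≟_ (c ∷ cs) (c ∷ β)) (List-≡-dec ℕ._≟_ cs β)))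

  monomial : List ℕ → Series
  monomial []      = h 0
  monomial (x ∷ w) = shift x (monomial w)

  monomial-indicator : ∀ w α → All (_< length α) w →
    monomial w α ≈ indicator (content (length α) w) α
  monomial-indicator []      α al = ≈-trans (≈-sym (indicator-zero α))
    (reflexive (cong (λ cs → indicator cs α) (sym (content-[] (length α)))))
  monomial-indicator (x ∷ w) α (p ∷ al) = begin
    shift x (monomial w) α
      ≈⟨ shift-cong x α (λ β eq → ≈-trans
           (monomial-indicator w β (subst (λ l → All (_< l) w) (sym eq) al))
           (reflexive (cong (λ l → indicator (content l w) β) eq))) ⟩
    shift x (indicator (content (length α) w)) α
      ≈⟨ shift-indicator x (content (length α) w) α (length-content (length α) w) p ⟩
    indicator (increment x (content (length α) w)) α
      ≡⟨ cong (λ cs → indicator cs α) (content-∷ (length α) x w p) ⟨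
    indicator (content (length α) (x ∷ w)) α ∎

  ∑-words-suc : ∀ {a} {A : Set a} (xs : List A) n f →
    ∑ (words xs (suc n)) f ≈ ∑ xs (λ x → ∑ (words xs n) (λ w → f (x ∷ w)))
  ∑-words-suc xs n f = go xs
    where
    go : ∀ ys → ∑ (cartesianProductWith _∷_ ys (words xs n)) f ≈
                ∑ ys (λ x → ∑ (words xs n) (λ w → f (x ∷ w)))
    go []       = ≈-refl
    go (y ∷ ys) = ≈-trans (∑-++ (map (y ∷_) (words xs n)) _ f)
      (+-cong (reflexive (∑-map (y ∷_) (words xs n) f)) (go ys))

  private
    shift-if : ∀ b f x α → shift x (λ β → if b then f β else 0#) α ≈ (if b then shift x f α else 0#)
    shift-if true  f x α = ≈-refl
    shift-if false f x α = shift-zero x α (λ _ → ≈-refl)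

    if-∑ : ∀ {a} {A : Set a} b (xs : List A) f →
      (if b then ∑ xs f else 0#) ≈ ∑ xs (λ x → if b then f x else 0#)
    if-∑ true  xs f = ≈-refl
    if-∑ false xs f = ≈-sym (∑-zero xs (λ _ → ≈-refl))

  ribbonFrom-words : ∀ u x α → ribbonFrom u x α ≈
    ∑ (words (upTo (length α)) (length u)) (λ w → if pattern? u x w then monomial (x ∷ w) α else 0#)
  ribbonFrom-words []      x α = ≈-sym (+-identityʳ _)
  ribbonFrom-words (s ∷ u) x α = begin
    shift x (ribbonAfter s x u) α
      ≈⟨ shift-cong x α (λ β eq → reflexive (cong (λ l → ∑ (upTo l) λ y →
           if follows s x y then ribbonFrom u y β else 0#) eq)) ⟩
    shift x (λ β → ∑ (upTo L) λ y → if follows s x y then ribbonFrom u y β else 0#) α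
      ≈⟨ shift-∑ (upTo L) _ x α ⟩
    (∑ (upTo L) λ y → shift x (λ β → if follows s x y then ribbonFrom u y β else 0#) α)
      ≈⟨ ∑-cong-ext (upTo L) (λ y → ≈-trans (shift-if (follows s x y) (ribbonFrom u y) x α)
           (≈-trans (if-cong (follows s x y) (onwards y)) (if-∑ (follows s x y) (words (upTo L) (length u))
               (λ w → if pattern? u y w then monomial (x ∷ y ∷ w) α else 0#)))) ⟩
    (∑ (upTo L) λ y → ∑ (words (upTo L) (length u)) λ w →
      if follows s x y then (if pattern? u y w then monomial (x ∷ y ∷ w) α else 0#) else 0#)
      ≈⟨ ∑-cong-ext (upTo L) (λ y → ∑-cong-ext (words (upTo L) (length u))
           λ w → reflexive (sym (if-∧ (follows s x y)))) ⟩
    _ ≈⟨ ∑-words-suc (upTo L) (length u) _ ⟨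
    _ ∎
    where
    L = length α
    onwards : ∀ y → shift x (ribbonFrom u y) α ≈ ∑ (words (upTo L) (length u)) λ w →
      if pattern? u y w then monomial (x ∷ y ∷ w) α else 0#
    onwards y = begin
      shift x (ribbonFrom u y) α
        ≈⟨ shift-cong x α (λ β eq → ≈-trans (ribbonFrom-words u y β)
             (reflexive (cong (λ l → ∑ (words (upTo l) (length u)) λ w →
               if pattern? u y w then monomial (y ∷ w) β else 0#) eq))) ⟩
      shift x (λ β → ∑ (words (upTo L) (length u)) λ w →
        if pattern? u y w then monomial (y ∷ w) β else 0#) α
        ≈⟨ shift-∑ (words (upTo L) (length u)) _ x α ⟩
      _ ≈⟨ ∑-cong-ext (words (upTo L) (length u)) (λ w → shift-if (pattern? u y w) _ x α) ⟩
      _ ∎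

  -- Links the recursive description of the series, suited to products, with a list of words, suited
  -- to a bijection with tableaux.
  ribbon-words : ∀ u α → ribbon u α ≈ ∑ (ribbonWords u α) (λ _ → 1#)
  ribbon-words u α = begin
    ribbon u α ≈⟨ ∑-cong-ext (upTo L) (λ x → ribbonFrom-words u x α) ⟩
    _ ≈⟨ ∑-words-suc (upTo L) (length u) (λ w → if hasSteps u w then monomial w α else 0#) ⟨
    ∑ ws (λ w → if hasSteps u w then monomial w α else 0#)
      ≈⟨ ∑-cong ws (λ {w} w∈ → ≈-trans
           (if-cong (hasSteps u w) (monomial-indicator w α
             (All.map ∈-upTo⁻ (proj₂ (∈-words⁻ (suc (length u)) w∈)))))
           (swap-if (hasSteps u w) (does (hasContent? α w)))) ⟩
    ∑ ws (λ w → if does (hasContent? α w) then (if hasSteps u w then 1# else 0#) else 0#)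
      ≈⟨ ∑-filter (hasContent? α) ws _ ⟨
    ∑ (filter (hasContent? α) ws) (λ w → if hasSteps u w then 1# else 0#)
      ≈⟨ ∑-filter (T? ∘ hasSteps u) (filter (hasContent? α) ws) _ ⟨
    ∑ (ribbonWords u α) (λ _ → 1#) ∎
    where
    L = length α
    ws = words (upTo L) (suc (length u))
    swap-if : ∀ b c → (if b then (if c then 1# else 0#) else 0#) ≈
                      (if c then (if b then 1# else 0#) else 0#)
    swap-if true  true  = ≈-refl
    swap-if true  false = ≈-refl
    swap-if false true  = ≈-refl
    swap-if false false = ≈-refl

-- Skew hooks

-- Nonempty strict partitions; they are the row ends of the skew hooks whose
-- columns have size at most 2 and whose last column has size 1.
data Strict : List ℕ → Set where
  single : ∀ {a} → 0 < a → Strict (a ∷ [])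
  _∷_ : ∀ {a b o} → b < a → Strict (b ∷ o) → Strict (a ∷ b ∷ o)

strict-positive : ∀ {a o} → Strict (a ∷ o) → 0 < a
strict-positive (single p) = p
strict-positive (p ∷ st) = ℕ.m<n⇒0<n p

-- Consecutive rows of a skew hook share exactly one column, the last of the lower row. So a row
-- starts in the column before the end of the next row, and the outer partition determines the inner
-- one.
skewHook : List ℕ → SkewDiagram
skewHook o = o / positiveParts (map pred (drop 1 o))

stepsOf : List ℕ → List Direction
stepsOf []          = []
stepsOf (a ∷ [])    = replicate (pred a) east
stepsOf (a ∷ b ∷ o) = replicate (a ∸ b) east ++ north ∷ stepsOf (b ∷ o)

hookRows : List ℕ → List (ℕ × ℕ)
hookRows []          = []
hookRows (a ∷ [])    = (0 , a) ∷ []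
hookRows (a ∷ b ∷ o) = (pred b , a) ∷ hookRows (b ∷ o)

rows-skewHook : ∀ {o} → Strict o → rows o (positiveParts (map pred (drop 1 o))) ≡ hookRows o
rows-skewHook (single p) = refl
rows-skewHook {a ∷ suc zero ∷ []}          (p ∷ st) = refl
rows-skewHook {a ∷ suc zero ∷ zero ∷ o}    (p ∷ (_ ∷ st)) = ⊥-elim (ℕ.<-irrefl refl (strict-positive st))
rows-skewHook {a ∷ suc zero ∷ suc c ∷ o}   (p ∷ (s≤s () ∷ _))
rows-skewHook {a ∷ suc (suc b) ∷ o}        (p ∷ st) = cong ((suc b , a) ∷_) (rows-skewHook st)
rows-skewHook {a ∷ zero ∷ o}               (p ∷ st) = ⊥-elim (ℕ.<-irrefl refl (strict-positive st))

hookWidth : ∀ {a b} → 0 < b → b < a → a ∸ pred b ≡ suc (a ∸ b)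
hookWidth {suc a} {suc b} p (s≤s q) = ℕ.+-∸-assoc 1 (ℕ.<⇒≤ q)

rowFill-first : ∀ d k x r {y} → ((d , k) , y) ∈ rowFill d k (x ∷ r) → y ≡ x
rowFill-first d k x r (here refl) = refl
rowFill-first d k x r (there p)   = ⊥-elim (ℕ.1+n≰n (rowFill-≥ d (suc k) r p))

∈-rowFill-last : ∀ d k r y → ((d , k ℕ.+ length r) , y) ∈ rowFill d k (r ∷ʳ y)
∈-rowFill-last d k []      y = here (cong (λ c → (d , c) , y) (ℕ.+-identityʳ k))
∈-rowFill-last d k (x ∷ r) y = there (subst (λ c → ((d , c) , y) ∈ rowFill d (suc k) (r ∷ʳ y))
  (sym (ℕ.+-suc k (length r))) (∈-rowFill-last d (suc k) r y))

rowFill-last : ∀ d k r y {c z} → ((d , c) , z) ∈ rowFill d k (r ∷ʳ y) → k ℕ.+ length r ≤ c →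
  c ≡ k ℕ.+ length r × z ≡ y
rowFill-last d k []      y (here refl) p = sym (ℕ.+-identityʳ k) , refl
rowFill-last d k (x ∷ r) y (here refl) p = ⊥-elim (ℕ.1+n≰n (ℕ.≤-trans
  (subst (_≤ k ℕ.+ suc (length r)) (ℕ.+-comm k 1) (ℕ.+-monoʳ-≤ k (s≤s z≤n))) p))
rowFill-last d k (x ∷ r) y {c} (there q)   p
  with e , f ← rowFill-last d (suc k) r y q (subst (_≤ c) (ℕ.+-suc k (length r)) p) =
  trans e (sym (ℕ.+-suc k (length r))) , f

-- consecutive rows of a skew hook overlap in the first cell of the upper and
-- the last cell of the lower one
columnStrict-corner⁻ : ∀ d k x r k′ r′ y → k ≡ k′ ℕ.+ length r′ →
  ColumnStrict d k (x ∷ r) k′ (r′ ∷ʳ y) → x < y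
columnStrict-corner⁻ d k x r k′ r′ y refl col = col (here refl) (∈-rowFill-last (suc d) k′ r′ y)

columnStrict-corner⁺ : ∀ d k x r k′ r′ y → k ≡ k′ ℕ.+ length r′ → x < y →
  ColumnStrict d k (x ∷ r) k′ (r′ ∷ʳ y)
columnStrict-corner⁺ d k x r k′ r′ y refl lt {c} p q
  with refl , refl ← rowFill-last (suc d) k′ r′ y {c} q (rowFill-≥ d k (x ∷ r) p)
  with refl ← rowFill-first d k x r p = lt

-- Rows from top to bottom, each from right to left: the ribbon traversed from its north-east end.
reading : List (List ℕ) → List ℕ
reading ρ = concat (map reverse ρ)

T-not⁻ : ∀ b → T (not b) → ¬ T b
T-not⁻ false t f = f

T-not⁺ : ∀ b → ¬ T b → T (not b)
T-not⁺ false f = tt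
T-not⁺ true  f = f tt

follows-east⁻ : ∀ x y → T (follows east x y) → y ≤ x
follows-east⁻ x y t = ℕ.s≤s⁻¹ (ℕ.<ᵇ⇒< y (suc x) t)

follows-east⁺ : ∀ x y → y ≤ x → T (follows east x y)
follows-east⁺ x y p = ℕ.<⇒<ᵇ (s≤s p)

follows-north⁻ : ∀ x y → T (follows north x y) → x < y
follows-north⁻ x y t = ℕ.≰⇒> λ p → T-not⁻ (y <ᵇ suc x) t (ℕ.<⇒<ᵇ (s≤s p))

follows-north⁺ : ∀ x y → x < y → T (follows north x y)
follows-north⁺ x y p = T-not⁺ (y <ᵇ suc x) λ t → ℕ.<⇒≱ p (ℕ.s≤s⁻¹ (ℕ.<ᵇ⇒< y (suc x) t))

reverse-∷-++ : ∀ (y : ℕ) r w → reverse (y ∷ r) ++ w ≡ reverse r ++ y ∷ w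
reverse-∷-++ y r w = trans (cong (_++ w) (unfold-reverse y r)) (++-assoc (reverse r) [ y ] w)

hasSteps-row⁻ : ∀ x r u w → T (hasSteps (replicate (length r) east ++ u) (reverse r ++ x ∷ w)) →
  Linked _≤_ (x ∷ r) × T (hasSteps u (x ∷ w))
hasSteps-row⁻ x []      u w t = [-] , t
hasSteps-row⁻ x (y ∷ r) u w t
  with lk , t′ ← hasSteps-row⁻ y r (east ∷ u) (x ∷ w)
         (subst₂ (λ v z → T (hasSteps v z)) (sym (replicate-snoc (length r) u)) (reverse-∷-++ y r (x ∷ w)) t)
  with p , t″ ← Equivalence.to (T-∧ {follows east y x}) t′ = follows-east⁻ y x p ∷ lk , t″

hasSteps-row⁺ : ∀ x r u w → Linked _≤_ (x ∷ r) → T (hasSteps u (x ∷ w)) →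
  T (hasSteps (replicate (length r) east ++ u) (reverse r ++ x ∷ w))
hasSteps-row⁺ x []      u w lk       t = t
hasSteps-row⁺ x (y ∷ r) u w (p ∷ lk) t =
  subst₂ (λ v z → T (hasSteps v z)) (replicate-snoc (length r) u) (sym (reverse-∷-++ y r (x ∷ w)))
    (hasSteps-row⁺ y r (east ∷ u) (x ∷ w) lk
      (Equivalence.from (T-∧ {follows east y x}) (follows-east⁺ y x p , t)))

private
  firstRow : ∀ a b (r : List ℕ) → length r ≡ suc (a ∸ b) → ∃[ x ] ∃[ r₀ ] r ≡ x ∷ r₀ × length r₀ ≡ a ∸ b
  firstRow a b (x ∷ r₀) eq = x , r₀ , refl , ℕ.suc-injective eq

  lastEntry : ∀ {b p} (r : List ℕ) → 0 < b → p < b → length r ≡ b ∸ p →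
    ∃[ r₀ ] ∃[ y ] r ≡ r₀ ∷ʳ y × pred b ≡ p ℕ.+ length r₀
  lastEntry {b} {p} r 0<b p<b eq with reverseView r
  ... | []          = ⊥-elim (ℕ.<⇒≢ (ℕ.m<n⇒0<n∸m p<b) eq)
  ... | r₀ ∶ _ ∶ʳ y = r₀ , y , refl , ℕ.suc-injective (trans (ℕ.suc-pred b {{ℕ.>-nonZero 0<b}})
        (trans (sym (ℕ.m+[n∸m]≡n (ℕ.<⇒≤ p<b))) (trans (cong (p ℕ.+_)
          (trans (sym eq) (length-∷ʳ r₀ y))) (ℕ.+-suc p _))))

  headRow : ∀ b o → Strict (b ∷ o) → ∃[ p ] ∃[ ps ] hookRows (b ∷ o) ≡ (p , b) ∷ ps × p < b
  headRow b []      (single q) = 0 , [] , refl , q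
  headRow b (c ∷ o) (q ∷ st) = pred c , hookRows (c ∷ o) , refl , ℕ.<-≤-trans (s≤s (ℕ.pred[n]≤n {c})) q

  reverse-∷ʳ : ∀ (r : List ℕ) y → reverse (r ∷ʳ y) ≡ y ∷ reverse r
  reverse-∷ʳ r y = reverse-++ r [ y ]

-- The last letter read in a row is its first entry, and the letter read next is the last entry of
-- the row below, directly under it. This is the only column that the two rows share, so the north
-- step expresses the whole column condition between them.
rowWise⇒hasSteps : ∀ d {o} → Strict o → ∀ ρ → map length ρ ≡ map width (hookRows o) →
  RowWise d (map proj₁ (hookRows o)) ρ → T (hasSteps (stepsOf o) (reading ρ))
hasSteps⇒rowWise : ∀ d {o} → Strict o → ∀ ρ → map length ρ ≡ map width (hookRows o) →
  T (hasSteps (stepsOf o) (reading ρ)) → RowWise d (map proj₁ (hookRows o)) ρ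

rowWise⇒hasSteps d {suc a ∷ []} (single p) ((x ∷ r) ∷ []) eq lk =
  subst₂ (λ v z → T (hasSteps v z))
    (trans (++-identityʳ _) (cong (λ n → replicate n east) (ℕ.suc-injective (proj₁ (∷-injective eq)))))
    (sym (reverse-∷-++ x r [])) (hasSteps-row⁺ x r [] [] lk tt)
rowWise⇒hasSteps d {a ∷ b ∷ []}    (_ ∷ _) (r ∷ []) ()
rowWise⇒hasSteps d {a ∷ b ∷ _ ∷ _} (_ ∷ _) (r ∷ []) ()
rowWise⇒hasSteps d {a ∷ b ∷ o} (b<a ∷ st) (r ∷ r′ ∷ ρ) eq rw
  with p , ps , hr , p<b ← headRow b o st
  with eq₁ , eq₂ ← ∷-injective eq
  with x , r₀ , refl , len ← firstRow a b r (trans eq₁ (hookWidth (strict-positive st) b<a))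
  with r₁ , y , refl , corner ← lastEntry r′ (strict-positive st) p<b
         (proj₁ (∷-injective (trans eq₂ (cong (map width) hr)))) =
  subst₂ (λ n z → T (hasSteps (replicate n east ++ north ∷ stepsOf (b ∷ o)) z)) len
    (sym (reverse-∷-++ x r₀ (reading ((r₁ ∷ʳ y) ∷ ρ))))
    (hasSteps-row⁺ x r₀ (north ∷ stepsOf (b ∷ o)) _ (proj₁ (parts hr rw)) rest)
  where
  parts : ∀ {ps p} → hookRows (b ∷ o) ≡ (p , b) ∷ ps →
    RowWise d (pred b ∷ map proj₁ (hookRows (b ∷ o))) ((x ∷ r₀) ∷ (r₁ ∷ʳ y) ∷ ρ) →
    Linked _≤_ (x ∷ r₀) × ColumnStrict d (pred b) (x ∷ r₀) p (r₁ ∷ʳ y) ×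
    RowWise (suc d) (map proj₁ (hookRows (b ∷ o))) ((r₁ ∷ʳ y) ∷ ρ)
  parts hr rw rewrite hr = rw
  tail-reading : reading ((r₁ ∷ʳ y) ∷ ρ) ≡ y ∷ (reverse r₁ ++ reading ρ)
  tail-reading = cong (_++ reading ρ) (reverse-∷ʳ r₁ y)
  rest : T (hasSteps (north ∷ stepsOf (b ∷ o)) (x ∷ reading ((r₁ ∷ʳ y) ∷ ρ)))
  rest = subst (λ z → T (hasSteps (north ∷ stepsOf (b ∷ o)) (x ∷ z))) (sym tail-reading)
    (Equivalence.from (T-∧ {follows north x y})
      (follows-north⁺ x y (columnStrict-corner⁻ d (pred b) x r₀ p r₁ y corner (proj₁ (proj₂ (parts hr rw)))) ,
      subst (λ z → T (hasSteps (stepsOf (b ∷ o)) z)) tail-reading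
        (rowWise⇒hasSteps (suc d) st ((r₁ ∷ʳ y) ∷ ρ) eq₂ (proj₂ (proj₂ (parts hr rw))))))

hasSteps⇒rowWise d {suc a ∷ []} (single p) ((x ∷ r) ∷ []) eq t =
  proj₁ (hasSteps-row⁻ x r [] [] (subst₂ (λ v z → T (hasSteps v z))
    (sym (trans (++-identityʳ _)
      (cong (λ n → replicate n east) (ℕ.suc-injective (proj₁ (∷-injective eq))))))
    (reverse-∷-++ x r []) t))
hasSteps⇒rowWise d {a ∷ b ∷ []}    (_ ∷ _) (r ∷ []) ()
hasSteps⇒rowWise d {a ∷ b ∷ _ ∷ _} (_ ∷ _) (r ∷ []) ()
hasSteps⇒rowWise d {a ∷ b ∷ o} (b<a ∷ st) (r ∷ r′ ∷ ρ) eq t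
  with p , ps , hr , p<b ← headRow b o st
  with eq₁ , eq₂ ← ∷-injective eq
  with x , r₀ , refl , len ← firstRow a b r (trans eq₁ (hookWidth (strict-positive st) b<a))
  with r₁ , y , refl , corner ← lastEntry r′ (strict-positive st) p<b
         (proj₁ (∷-injective (trans eq₂ (cong (map width) hr)))) = assemble hr
  where
  tail-reading : reading ((r₁ ∷ʳ y) ∷ ρ) ≡ y ∷ (reverse r₁ ++ reading ρ)
  tail-reading = cong (_++ reading ρ) (reverse-∷ʳ r₁ y)
  firstPart : Linked _≤_ (x ∷ r₀) × T (hasSteps (north ∷ stepsOf (b ∷ o)) (x ∷ reading ((r₁ ∷ʳ y) ∷ ρ)))
  firstPart = hasSteps-row⁻ x r₀ (north ∷ stepsOf (b ∷ o)) _
    (subst₂ (λ n z → T (hasSteps (replicate n east ++ north ∷ stepsOf (b ∷ o)) z)) (sym len)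
      (reverse-∷-++ x r₀ (reading ((r₁ ∷ʳ y) ∷ ρ))) t)
  secondPart = Equivalence.to (T-∧ {follows north x y})
    (subst (λ z → T (hasSteps (north ∷ stepsOf (b ∷ o)) (x ∷ z))) tail-reading (proj₂ firstPart))
  col = columnStrict-corner⁺ d (pred b) x r₀ p r₁ y corner (follows-north⁻ x y (proj₁ secondPart))
  rest = hasSteps⇒rowWise (suc d) st ((r₁ ∷ʳ y) ∷ ρ) eq₂
    (subst (λ z → T (hasSteps (stepsOf (b ∷ o)) z)) (sym tail-reading) (proj₂ secondPart))
  assemble : ∀ {ps} → hookRows (b ∷ o) ≡ (p , b) ∷ ps →
    RowWise d (pred b ∷ map proj₁ (hookRows (b ∷ o))) ((x ∷ r₀) ∷ (r₁ ∷ʳ y) ∷ ρ)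
  assemble hr = glue (hookRows (b ∷ o)) hr rest
    where
    glue : ∀ qs {ps} → qs ≡ (p , b) ∷ ps → RowWise (suc d) (map proj₁ qs) ((r₁ ∷ʳ y) ∷ ρ) →
      RowWise d (pred b ∷ map proj₁ qs) ((x ∷ r₀) ∷ (r₁ ∷ʳ y) ∷ ρ)
    glue _ refl rest = proj₁ firstPart , (λ {c} {z} → col {c} {z}) , rest

reading-↭ : ∀ ρ → reading ρ ↭ concat ρ
reading-↭ []      = ↭-refl
reading-↭ (r ∷ ρ) = ↭-++⁺ (↭-reverse r) (reading-↭ ρ)

map-length-reverse : ∀ (ρ : List (List ℕ)) → map length (map reverse ρ) ≡ map length ρ
map-length-reverse []      = refl
map-length-reverse (r ∷ ρ) = cong₂ _∷_ (length-reverse r) (map-length-reverse ρ)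

map-reverse-involutive : ∀ (ρ : List (List ℕ)) → map reverse (map reverse ρ) ≡ ρ
map-reverse-involutive []      = refl
map-reverse-involutive (r ∷ ρ) = cong₂ _∷_ (reverse-involutive r) (map-reverse-involutive ρ)

hook-size : ∀ {a o} → Strict (a ∷ o) → ℕ.sum (map width (hookRows (a ∷ o))) ≡ a ℕ.+ length o
hook-size (single p) = refl
hook-size {a} {b ∷ o} (b<a ∷ st) = trans
  (cong₂ ℕ._+_ (hookWidth (strict-positive st) b<a) (hook-size st))
  (trans (cong suc (trans (sym (ℕ.+-assoc (a ∸ b) b (length o)))
    (cong (ℕ._+ length o) (ℕ.m∸n+n≡m (ℕ.<⇒≤ b<a))))) (sym (ℕ.+-suc a (length o))))

length-stepsOf : ∀ {a o} → Strict (a ∷ o) → suc (length (stepsOf (a ∷ o))) ≡ a ℕ.+ length o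
length-stepsOf {suc a} (single p) = cong suc (trans (length-replicate a) (sym (ℕ.+-identityʳ a)))
length-stepsOf {a} {b ∷ o} (b<a ∷ st) = trans
  (cong suc (trans (length-++ (replicate (a ∸ b) east))
    (cong₂ ℕ._+_ (length-replicate (a ∸ b)) (length-stepsOf st))))
  (trans (cong suc (trans (sym (ℕ.+-assoc (a ∸ b) b (length o)))
    (cong (ℕ._+ length o) (ℕ.m∸n+n≡m (ℕ.<⇒≤ b<a))))) (sym (ℕ.+-suc a (length o))))

module HookSeries {c ℓ₁ ℓ₂} (K : CommutativeRing c ℓ₁)
                  (_≤ᴷ_ : Rel (CommutativeRing.Carrier K) ℓ₂) where

  open FiniteSums K
  open RibbonSeries K using (ribbon)
  open RibbonWords K
  open SchurBranching K _≤ᴷ_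
  private module SF = SymmetricFunctions rawRing _≤ᴷ_

  skewSchur-hook : ∀ {o} → Strict o → ∀ α → SF.skewSchur (skewHook o) α ≈ ribbon (stepsOf o) α
  skewSchur-hook {o@(a ∷ o′)} st α = begin
    SF.skewSchur (skewHook o) α ≈⟨ skewSchur-∑ (skewHook o) α ⟩
    ∑ (fillings (skewHook o) α) (λ _ → 1#)
      ≈⟨ ∑-bij reading (λ w → map reverse (chunk lens w)) (fillings-unique (skewHook o) α)
           (ribbonWords-unique (stepsOf o) α) to from (λ _ → ≈-refl) ⟩
    ∑ (ribbonWords (stepsOf o) α) (λ _ → 1#) ≈⟨ ribbon-words (stepsOf o) α ⟨
    ribbon (stepsOf o) α ∎
    where
    ps = rows o (positiveParts (map pred (drop 1 o)))
    lens = map width (hookRows o)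
    ps≡ : ps ≡ hookRows o
    ps≡ = rows-skewHook st
    size≡ : ℕ.sum lens ≡ suc (length (stepsOf o))
    size≡ = trans (hook-size st) (sym (length-stepsOf st))
    to : ∀ {ρ} → ρ ∈ fillings (skewHook o) α →
      reading ρ ∈ ribbonWords (stepsOf o) α × map reverse (chunk lens (reading ρ)) ≡ ρ
    to {ρ} ρ∈ with filling sh al co rw ← ∈-fillings⁻ (skewHook o) α ρ∈ =
      ∈-ribbonWords⁺ (stepsOf o) α
        (trans (↭-length (reading-↭ ρ)) (trans (sum-length ρ lens shape) size≡))
        (All-resp-↭ (↭-sym (reading-↭ ρ)) al)
        (trans (content-↭ (length α) (reading-↭ ρ)) co)
        (rowWise⇒hasSteps 0 st ρ shape (subst (λ qs → RowWise 0 (map proj₁ qs) ρ) ps≡ rw)) ,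
      trans (cong (λ ls → map reverse (chunk ls (reading ρ)))
          (trans (sym shape) (sym (map-length-reverse ρ))))
        (trans (cong (map reverse) (chunk-concat (map reverse ρ))) (map-reverse-involutive ρ))
      where
      shape : map length ρ ≡ lens
      shape = trans sh (cong (map width) ps≡)
    from : ∀ {w} → w ∈ ribbonWords (stepsOf o) α →
      map reverse (chunk lens w) ∈ fillings (skewHook o) α × reading (map reverse (chunk lens w)) ≡ w
    from {w} w∈ with len , al , co , t ← ∈-ribbonWords⁻ (stepsOf o) α w∈ =
      ∈-fillings⁺ (skewHook o) α (filling (trans shape (cong (map width) (sym ps≡)))
        (All-resp-↭ perm al) (trans (sym (content-↭ (length α) perm)) co)
        (subst (λ qs → RowWise 0 (map proj₁ qs) ρ) (sym ps≡)
          (hasSteps⇒rowWise 0 st ρ shape (subst (λ z → T (hasSteps (stepsOf o) z)) (sym back) t)))) ,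
      back
      where
      ρ = map reverse (chunk lens w)
      len′ = trans len (sym size≡)
      back : reading ρ ≡ w
      back = trans (cong concat (map-reverse-involutive (chunk lens w))) (concat-chunk lens w len′)
      shape : map length ρ ≡ lens
      shape = trans (map-length-reverse (chunk lens w)) (map-length-chunk lens w len′)
      perm : w ↭ concat ρ
      perm = subst (_↭ concat ρ) back (reading-↭ ρ)

-- The skew hooks of strict partitions: cells, columns, connectedness

n≤suc-pred : ∀ n → n ≤ suc (pred n)
n≤suc-pred zero    = z≤n
n≤suc-pred (suc n) = ℕ.≤-refl

part-beyond : ∀ xs {r} → length xs ≤ r → part xs r ≡ 0
part-beyond []       p       = refl
part-beyond (x ∷ xs) (s≤s p) = part-beyond xs p

part-positive : ∀ {xs} → All (0 <_) xs → ∀ {r} → r < length xs → 0 < part xs r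
part-positive (p ∷ ps) {zero}  _       = p
part-positive (p ∷ ps) {suc r} (s≤s q) = part-positive ps q

part-suc : ∀ {xs} → Decreasing xs → ∀ r → part xs (suc r) ≤ part xs r
part-suc {[]}     dec r       = z≤n
part-suc {x ∷ xs} dec zero    = part-head dec
part-suc {x ∷ xs} dec (suc r) = part-suc (Linked.tail dec) r

part-antitone : ∀ {xs} → Decreasing xs → ∀ {r s} → r ≤ s → part xs s ≤ part xs r
part-antitone {xs} dec {r} {s} r≤s =
  subst (λ n → part xs n ≤ part xs r) (ℕ.m∸n+n≡m r≤s) (go (s ∸ r))
  where
  go : ∀ j → part xs (j ℕ.+ r) ≤ part xs r
  go zero    = ℕ.≤-refl
  go (suc j) = ℕ.≤-trans (part-suc dec (j ℕ.+ r)) (go j)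

∈-cells⁺ : ∀ D {r c} → part (inner D) r ≤ c → c < part (outer D) r → (r , c) ∈ cells D
∈-cells⁺ (o / i) {r} {c} p q = ∈-concatMap⁺ _ (lose (∈-upTo⁺ r<) (∈-map⁺ (r ,_)
  (∈-filter⁺ (part i r ℕ.≤?_) (∈-upTo⁺ q) p)))
  where
  r< : r < length o
  r< = ℕ.≰⇒> λ len → ℕ.n≮0 (subst (c <_) (part-beyond o len) q)

∈-cells⁻ : ∀ D {r c} → (r , c) ∈ cells D → part (inner D) r ≤ c × c < part (outer D) r
∈-cells⁻ (o / i) {r} {c} p
  with r′ , _ , q ← find (∈-concatMap⁻
         (λ r → map (r ,_) (filter (part i r ℕ.≤?_) (upTo (part o r)))) {upTo (length o)} p)
  with c′ , s , refl ← ∈-map⁻ (r′ ,_) q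
  with t , u ← ∈-filter⁻ (part i r′ ℕ.≤?_) {xs = upTo (part o r′)} s = u , ∈-upTo⁻ t

strict-decreasing : ∀ {o} → Strict o → Decreasing o
strict-decreasing (single _) = [-]
strict-decreasing (p ∷ st)   = ℕ.<⇒≤ p ∷ strict-decreasing st

strict-all-positive : ∀ {o} → Strict o → All (0 <_) o
strict-all-positive (single p) = p ∷ []
strict-all-positive (p ∷ st)   = ℕ.m<n⇒0<n p ∷ strict-all-positive st

part-hookInner : ∀ {o} → Strict o → ∀ r →
  part (positiveParts (map pred (drop 1 o))) r ≡ pred (part o (suc r))
part-hookInner (single _) zero    = refl
part-hookInner (single _) (suc r) = refl
part-hookInner {a ∷ suc zero ∷ []}        (p ∷ st) zero    = refl
part-hookInner {a ∷ suc zero ∷ []}        (p ∷ st) (suc r) = refl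
part-hookInner {a ∷ suc zero ∷ zero ∷ o}  (p ∷ (_ ∷ st)) r = ⊥-elim (ℕ.<-irrefl refl (strict-positive st))
part-hookInner {a ∷ suc zero ∷ suc c ∷ o} (p ∷ (s≤s () ∷ _)) r
part-hookInner {a ∷ suc (suc b) ∷ o}      (p ∷ st) zero    = refl
part-hookInner {a ∷ suc (suc b) ∷ o}      (p ∷ st) (suc r) = part-hookInner st r
part-hookInner {a ∷ zero ∷ o}             (p ∷ st) r       = ⊥-elim (ℕ.<-irrefl refl (strict-positive st))

∈-boxPartitions⁺ : ∀ N {xs} → IsPartition xs → length xs ≤ N → All (_≤ N) xs → xs ∈ boxPartitions N
∈-boxPartitions⁺ N {xs} isP len al = ∈-filter⁺ isPartition?
  (∈-concatMap⁺ (words (map suc (upTo N))) (lose (∈-upTo⁺ (s≤s len)) (∈-words⁺ (letters (proj₂ isP) al)))) isP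
  where
  letters : ∀ {ys} → All (0 <_) ys → All (_≤ N) ys → All (_∈ map suc (upTo N)) ys
  letters []             []       = []
  letters (s≤s z≤n ∷ ps) (q ∷ qs) = ∈-map⁺ suc (∈-upTo⁺ q) ∷ letters ps qs

boxPartitions-unique : ∀ N → Unique (boxPartitions N)
boxPartitions-unique N = Unique.filter⁺ isPartition? (concatMap-unique (Unique.upTo⁺ (suc N))
  (λ {n} _ → words-unique n (Unique.map⁺ ℕ.suc-injective (Unique.upTo⁺ N)))
  λ {n} {n′} _ _ p q → trans (sym (proj₁ (∈-words⁻ n p))) (proj₁ (∈-words⁻ n′ q)))

hooks-unique : ∀ n k → Unique (hooks n k)
hooks-unique n k = Unique.filter⁺ (inHooks? n k) (Unique.cartesianProductWith⁺ _/_
  (λ { refl → refl , refl }) (boxPartitions-unique n) (boxPartitions-unique n))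

columnCount : List Cell → ℕ → ℕ
columnCount cs c = length (filter (λ x → proj₂ x ℕ.≟ c) cs)

columnCount-++ : ∀ xs ys c → columnCount (xs ++ ys) c ≡ columnCount xs c ℕ.+ columnCount ys c
columnCount-++ xs ys c = trans (cong length (filter-++ (λ x → proj₂ x ℕ.≟ c) xs ys))
  (length-++ (filter (λ x → proj₂ x ℕ.≟ c) xs))

rowColumn-outside : ∀ d b n c → c < b ⊎ b ℕ.+ n ≤ c → columnCount (map (d ,_) (range b n)) c ≡ 0
rowColumn-outside d b zero    c p = refl
rowColumn-outside d b (suc n) c p = trans
  (cong length (filter-reject (λ x → proj₂ x ℕ.≟ c) {xs = map (d ,_) (range (suc b) n)} (≢c p)))
  (rowColumn-outside d (suc b) n c (next p))
  where
  ≢c : c < b ⊎ b ℕ.+ suc n ≤ c → ¬ b ≡ c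
  ≢c (inj₁ q) refl = ℕ.<-irrefl refl q
  ≢c (inj₂ q) refl = ℕ.m+1+n≰m b q
  next : c < b ⊎ b ℕ.+ suc n ≤ c → c < suc b ⊎ suc b ℕ.+ n ≤ c
  next (inj₁ q) = inj₁ (ℕ.m<n⇒m<1+n q)
  next (inj₂ q) = inj₂ (subst (_≤ c) (ℕ.+-suc b n) q)

rowColumn-inside : ∀ d b n c → b ≤ c → c < b ℕ.+ n → columnCount (map (d ,_) (range b n)) c ≡ 1
rowColumn-inside d b zero    c p q = ⊥-elim (ℕ.<⇒≱ (subst (c <_) (ℕ.+-identityʳ b) q) p)
rowColumn-inside d b (suc n) c p q with ℕ.m≤n⇒m<n∨m≡n p
... | inj₁ b<c  = trans
  (cong length (filter-reject (λ x → proj₂ x ℕ.≟ c) {xs = map (d ,_) (range (suc b) n)} (ℕ.<⇒≢ b<c)))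
  (rowColumn-inside d (suc b) n c b<c (subst (c <_) (ℕ.+-suc b n) q))
... | inj₂ refl = trans
  (cong length (filter-accept (λ x → proj₂ x ℕ.≟ c) {xs = map (d ,_) (range (suc b) n)} refl))
  (cong suc (rowColumn-outside d (suc b) n c (inj₁ ℕ.≤-refl)))

hookColumns-beyond : ∀ {a o} → Strict (a ∷ o) → ∀ d c → a ≤ c →
  columnCount (cellsFrom d (hookRows (a ∷ o))) c ≡ 0
hookColumns-beyond {a} {[]}    (single _) d c p = trans
  (cong (λ xs → columnCount xs c) (++-identityʳ (map (d ,_) (range 0 a))))
  (rowColumn-outside d 0 a c (inj₂ p))
hookColumns-beyond {a} {b ∷ o} (q ∷ st)   d c p = trans
  (columnCount-++ (map (d ,_) (range (pred b) (a ∸ pred b))) _ c)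
  (cong₂ ℕ._+_
    (rowColumn-outside d (pred b) (a ∸ pred b) c
      (inj₂ (subst (_≤ c) (sym (ℕ.m+[n∸m]≡n (ℕ.≤-trans ℕ.pred[n]≤n (ℕ.<⇒≤ q)))) p)))
    (hookColumns-beyond st (suc d) c (ℕ.≤-trans (ℕ.<⇒≤ q) p)))

-- the column sizes of a skew hook, except for the last one
initColumns : List ℕ → List ℕ
initColumns []          = []
initColumns (a ∷ [])    = replicate (pred a) 1
initColumns (a ∷ b ∷ o) = initColumns (b ∷ o) ++ 2 ∷ replicate (pred (a ∸ b)) 1

upTo-++ : ∀ m n → upTo (m ℕ.+ n) ≡ upTo m ++ range m n
upTo-++ m zero    = trans (cong upTo (ℕ.+-identityʳ m)) (sym (++-identityʳ (upTo m)))
upTo-++ m (suc n) = begin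
  upTo (m ℕ.+ suc n)            ≡⟨ cong upTo (ℕ.+-suc m n) ⟩
  upTo (suc m ℕ.+ n)            ≡⟨ upTo-++ (suc m) n ⟩
  upTo (suc m) ++ range (suc m) n ≡⟨ cong (_++ range (suc m) n) (applyUpTo-∷ʳ id m) ⟨
  (upTo m ∷ʳ m) ++ range (suc m) n ≡⟨ ++-assoc (upTo m) [ m ] _ ⟩
  upTo m ++ range m (suc n)     ∎
  where open ≡-Reasoning

replicate-∷ʳ : ∀ n (x : ℕ) → replicate n x ∷ʳ x ≡ replicate (suc n) x
replicate-∷ʳ zero    x = refl
replicate-∷ʳ (suc n) x = cong (x ∷_) (replicate-∷ʳ n x)

range-< : ∀ k n → All (_< k ℕ.+ n) (range k n)
range-< k zero    = []
range-< k (suc n) = ℕ.m<m+n k (s≤s z≤n) ∷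
  All.map (λ {c} → subst (c <_) (sym (ℕ.+-suc k n))) (range-< (suc k) n)

-- Columns left of the shared one meet only the lower rows, columns right of it only the first row.
-- The rows being strictly decreasing, the last column is of the latter kind and has size 1.
hookColumns : ∀ {a o} → Strict (a ∷ o) → ∀ d →
  map (columnCount (cellsFrom d (hookRows (a ∷ o)))) (upTo a) ≡ initColumns (a ∷ o) ∷ʳ 1
hookColumns {suc a} {[]} (single _) d = begin
  map f (upTo (suc a))          ≡⟨ map-replicate-local (All.tabulate λ {c} c∈ → trans
    (cong (λ xs → columnCount xs c) (++-identityʳ (map (d ,_) (range 0 (suc a)))))
    (rowColumn-inside d 0 (suc a) c z≤n (∈-upTo⁻ c∈))) ⟩
  replicate (length (upTo (suc a))) 1 ≡⟨ cong (λ n → replicate n 1) (length-upTo (suc a)) ⟩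
  replicate (suc a) 1           ≡⟨ replicate-∷ʳ a 1 ⟨
  replicate a 1 ∷ʳ 1            ∎
  where
  open ≡-Reasoning
  f = columnCount (cellsFrom d (hookRows (suc a ∷ [])))
hookColumns {a} {zero ∷ o}  (p ∷ st) d = ⊥-elim (ℕ.<-irrefl refl (strict-positive st))
hookColumns {a} {suc b ∷ o} (b<a ∷ st) d = begin
  map f (upTo a) ≡⟨ cong (map f ∘ upTo) (ℕ.m+[n∸m]≡n (ℕ.<⇒≤ (ℕ.<⇒≤ b<a))) ⟨
  map f (upTo (b ℕ.+ (a ∸ b))) ≡⟨ cong (map f) (upTo-++ b (a ∸ b)) ⟩
  map f (upTo b ++ range b (a ∸ b)) ≡⟨ map-++ f (upTo b) _ ⟩
  map f (upTo b) ++ map f (range b (a ∸ b)) ≡⟨ cong₂ _++_ low (cong (map f ∘ range b) a∸b) ⟩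
  initColumns (suc b ∷ o) ++ f b ∷ map f (range (suc b) (suc e))
    ≡⟨ cong₂ (λ x xs → initColumns (suc b ∷ o) ++ x ∷ xs) corner high ⟩
  initColumns (suc b ∷ o) ++ 2 ∷ replicate (suc e) 1
    ≡⟨ cong (λ xs → initColumns (suc b ∷ o) ++ 2 ∷ xs) (replicate-∷ʳ e 1) ⟨
  initColumns (suc b ∷ o) ++ (2 ∷ replicate e 1) ∷ʳ 1
    ≡⟨ ++-assoc (initColumns (suc b ∷ o)) (2 ∷ replicate e 1) [ 1 ] ⟨
  initColumns (a ∷ suc b ∷ o) ∷ʳ 1 ∎
  where
  open ≡-Reasoning
  f  = columnCount (cellsFrom d (hookRows (a ∷ suc b ∷ o)))
  f′ = columnCount (cellsFrom (suc d) (hookRows (suc b ∷ o)))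
  e  = pred (a ∸ suc b)
  a∸b : a ∸ b ≡ suc (suc e)
  a∸b = trans (hookWidth (s≤s z≤n) b<a)
    (cong suc (sym (ℕ.suc-pred (a ∸ suc b) {{ℕ.>-nonZero (ℕ.m<n⇒0<n∸m b<a)}})))
  split : ∀ c → f c ≡ columnCount (map (d ,_) (range b (a ∸ b))) c ℕ.+ f′ c
  split = columnCount-++ (map (d ,_) (range b (a ∸ b))) (cellsFrom (suc d) (hookRows (suc b ∷ o)))
  b+[a∸b] : b ℕ.+ (a ∸ b) ≡ a
  b+[a∸b] = ℕ.m+[n∸m]≡n (ℕ.<⇒≤ (ℕ.<⇒≤ b<a))
  rest : map f′ (upTo b) ≡ initColumns (suc b ∷ o) × f′ b ≡ 1
  rest = ∷ʳ-injective _ _ (trans (sym (map-++ f′ (upTo b) [ b ]))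
    (trans (cong (map f′) (applyUpTo-∷ʳ id b)) (hookColumns st (suc d))))
  low : map f (upTo b) ≡ initColumns (suc b ∷ o)
  low = trans (map-cong-local (All.tabulate λ {c} c∈ → trans (split c)
    (cong (ℕ._+ f′ c) (rowColumn-outside d b (a ∸ b) c (inj₁ (∈-upTo⁻ c∈)))))) (proj₁ rest)
  corner : f b ≡ 2
  corner = trans (split b) (cong₂ ℕ._+_
    (rowColumn-inside d b (a ∸ b) b ℕ.≤-refl (subst (b <_) (sym b+[a∸b]) (ℕ.<⇒≤ b<a))) (proj₂ rest))
  high : map f (range (suc b) (suc e)) ≡ replicate (suc e) 1
  high = trans (map-replicate-local (All.zipWith (λ {c} (p , q) → trans (split c) (cong₂ ℕ._+_
      (rowColumn-inside d b (a ∸ b) c (ℕ.<⇒≤ p)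
        (subst (λ n → c < b ℕ.+ n) (sym a∸b) (subst (c <_) (sym (ℕ.+-suc b (suc e))) q)))
      (hookColumns-beyond st (suc d) c p)))
      (range-≥ (suc e) ℕ.≤-refl , range-< (suc b) (suc e))))
    (cong (λ n → replicate n 1) (length-range (suc b) (suc e)))

module _ {o} (st : Strict o) where

  cells-skewHook : cells (skewHook o) ≡ cellsFrom 0 (hookRows o)
  cells-skewHook = trans (cells-rows o _) (cong (cellsFrom 0) (rows-skewHook st))

columnSizes-skewHook : ∀ {o} → Strict o → columnSizes (skewHook o) ≡ initColumns o ∷ʳ 1
columnSizes-skewHook {a ∷ o} st = trans
  (cong (λ cs → map (columnCount cs) (upTo a)) (cells-skewHook st)) (hookColumns st 0)

size-skewHook : ∀ {a o} → Strict (a ∷ o) → size (skewHook (a ∷ o)) ≡ a ℕ.+ length o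
size-skewHook {a} {o} st = trans (cong length (cells-skewHook st))
  (trans (length-cellsFrom 0 (hookRows (a ∷ o))) (hook-size st))

count-++ : ∀ m xs ys → count m (xs ++ ys) ≡ count m xs ℕ.+ count m ys
count-++ m xs ys = trans (cong length (filter-++ (m ℕ.≟_) xs ys)) (length-++ (filter (m ℕ.≟_) xs))

count-replicate : ∀ m n {x} → ¬ m ≡ x → count m (replicate n x) ≡ 0
count-replicate m n m≢x = cong length (filter-none (m ℕ.≟_) (All.replicate⁺ n m≢x))

count-initColumns : ∀ {a o} → Strict (a ∷ o) → count 2 (initColumns (a ∷ o)) ≡ length o
count-initColumns {a} (single _) = count-replicate 2 (pred a) λ ()
count-initColumns {a} {b ∷ o} (p ∷ st) = trans (count-++ 2 (initColumns (b ∷ o)) _)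
  (trans (cong₂ ℕ._+_ (count-initColumns st)
    (cong suc (count-replicate 2 (pred (a ∸ b)) λ ()))) (ℕ.+-comm (length o) 1))

all-initColumns : ∀ {o} → Strict o → All (λ s → s ≡ 1 ⊎ s ≡ 2) (initColumns o)
all-initColumns {a ∷ []} (single _) = All.replicate⁺ (pred a) (inj₁ refl)
all-initColumns {a ∷ b ∷ o} (p ∷ st) =
  All.++⁺ (all-initColumns st) (inj₂ refl ∷ All.replicate⁺ (pred (a ∸ b)) (inj₁ refl))

last-∷ʳ : ∀ (xs : List ℕ) x → last (xs ∷ʳ x) ≡ just x
last-∷ʳ []           x = refl
last-∷ʳ (y ∷ [])     x = refl
last-∷ʳ (y ∷ z ∷ xs) x = last-∷ʳ (z ∷ xs) x

adjacent-sym : ∀ {x y} → Adjacent x y → Adjacent y x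
adjacent-sym (inj₁ p)               = inj₂ (inj₁ p)
adjacent-sym (inj₂ (inj₁ p))        = inj₁ p
adjacent-sym (inj₂ (inj₂ (inj₁ p))) = inj₂ (inj₂ (inj₂ p))
adjacent-sym (inj₂ (inj₂ (inj₂ p))) = inj₂ (inj₂ (inj₁ p))

module _ {a o′} (st : Strict (a ∷ o′)) where
  private
    o = a ∷ o′
    D = skewHook o
    dec = strict-decreasing st
    pos = strict-all-positive st

    hookInner = part-hookInner st

    ∈D⁺ : ∀ {r c} → pred (part o (suc r)) ≤ c → c < part o r → (r , c) ∈ cells D
    ∈D⁺ {r} p q = ∈-cells⁺ D (subst (_≤ _) (sym (hookInner r)) p) q

    ∈D⁻ : ∀ {r c} → (r , c) ∈ cells D → pred (part o (suc r)) ≤ c × c < part o r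
    ∈D⁻ {r} p with q , s ← ∈-cells⁻ D p = subst (_≤ _) (hookInner r) q , s

    -- `Step` records only that its target is a cell; with both ends recorded, paths can be
    -- reversed.
    _↔_ : Cell → Cell → Set
    x ↔ y = Adjacent x y × x ∈ cells D × y ∈ cells D

    corner : Cell
    corner = 0 , pred a

    toRowEnd : ∀ {r} j c → j ℕ.+ suc c ≡ part o r → pred (part o (suc r)) ≤ c →
      Star _↔_ (r , c) (r , pred (part o r))
    toRowEnd {r} zero    c eq p = subst (λ n → Star _↔_ (r , c) (r , pred n)) eq Star.ε
    toRowEnd {r} (suc j) c eq p =
      (inj₁ refl , ∈D⁺ p (subst (c <_) eq′ (ℕ.m≤n⇒m≤o+n j (s≤s (ℕ.n≤1+n c)))) ,
        ∈D⁺ (ℕ.m≤n⇒m≤1+n p) (subst (suc c <_) eq′ (ℕ.m≤n+m (2 ℕ.+ c) j))) ◅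
      toRowEnd j (suc c) eq′ (ℕ.m≤n⇒m≤1+n p)
      where
      eq′ : j ℕ.+ suc (suc c) ≡ part o r
      eq′ = trans (ℕ.+-suc j (suc c)) eq

    -- Every cell is joined to the north-east one: go right to the end of the row, then up, which
    -- leads to the first cell of the row above.
    toCorner : ∀ r c → (r , c) ∈ cells D → Star _↔_ (r , c) corner
    toCorner r c p with q , s ← ∈D⁻ p with r
    ... | zero   = toRowEnd (a ∸ suc c) c (ℕ.m∸n+n≡m s) q
    ... | suc r′ = toRowEnd (part o (suc r′) ∸ suc c) c (ℕ.m∸n+n≡m s) q ◅◅
      (inj₂ (inj₂ (inj₂ refl)) , end , up) ◅ toCorner r′ _ up
      where
      pred< : pred (part o (suc r′)) < part o (suc r′)
      pred< = ℕ.≤-reflexive (ℕ.suc-pred _ {{ℕ.>-nonZero (ℕ.≤-<-trans z≤n s)}})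
      end : (suc r′ , pred (part o (suc r′))) ∈ cells D
      end = ∈D⁺ (ℕ.pred-mono-≤ (part-suc dec (suc r′))) pred<
      up : (r′ , pred (part o (suc r′))) ∈ cells D
      up = ∈D⁺ ℕ.≤-refl (ℕ.<-≤-trans pred< (part-suc dec r′))

  skewHook-connected : Connected D
  skewHook-connected = All.tabulate λ {x} x∈ → All.tabulate λ {y} y∈ →
    Star.map (λ (adj , _ , q) → adj , q)
      (toCorner _ _ x∈ ◅◅ Star.reverse (λ (adj , p , q) → adjacent-sym adj , q , p) (toCorner _ _ y∈))

  skewHook-isSkewHook : IsSkewHook D
  skewHook-isSkewHook =
    ((dec , pos) , (innerDec , All.all-filter (0 ℕ.<?_) (map pred o′)) ,
      All.tabulate λ {r} _ → subst (_≤ part o r) (sym (hookInner r))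
        (ℕ.≤-trans ℕ.pred[n]≤n (part-suc dec r))) ,
    (lose (∈D⁺ {0} {pred a} (ℕ.pred-mono-≤ (part-suc dec 0)) (ℕ.≤-reflexive (ℕ.suc-pred a {{ℕ.>-nonZero (strict-positive st)}})))
       refl ,
     lose (∈D⁺ {length o′} {0} (ℕ.≤-reflexive (cong pred (part-beyond o {suc (length o′)} ℕ.≤-refl)))
       (part-positive pos ℕ.≤-refl)) refl) ,
    skewHook-connected ,
    -- As (r, c) is a cell, row r + 1 reaches column c at most, whereas a square would require it to
    -- reach column c + 1.
    All.tabulate λ { {r , c} _ (x∈ , _ , _ , z∈) → ℕ.<⇒≱
      (ℕ.<-≤-trans (ℕ.n<1+n (suc c)) (proj₂ (∈D⁻ z∈)))
      (ℕ.≤-trans (n≤suc-pred (part o (suc r))) (s≤s (proj₁ (∈D⁻ x∈)))) }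
    where
    innerDec : Decreasing (positiveParts (map pred o′))
    innerDec = Linked.filter⁺ (0 ℕ.<?_) (λ p q → ℕ.≤-trans q p)
      (Linked.map⁺ (Linked.map ℕ.pred-mono-≤ (Linked.tail dec)))

  skewHook-∈-hooks : ∀ n k → a ℕ.+ length o′ ≡ n → length o′ ≡ k → D ∈ hooks n k
  skewHook-∈-hooks n k refl refl = ∈-filter⁺ (inHooks? n k)
    (∈-cartesianProductWith⁺ _/_
      (∈-boxPartitions⁺ n (dec , pos)
        (ℕ.+-monoˡ-≤ (length o′) (strict-positive st)) (All.map (λ p → ℕ.≤-trans p (ℕ.m≤m+n a _)) bounded))
      (∈-boxPartitions⁺ n (proj₁ (proj₂ (proj₁ skewHook-isSkewHook)))
        (ℕ.≤-trans (length-filter (0 ℕ.<?_) (map pred o′))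
          (ℕ.≤-trans (ℕ.≤-reflexive (length-map pred o′)) (ℕ.m≤n+m (length o′) a)))
        (All.filter⁺ (0 ℕ.<?_) (All.map⁺ (All.map (λ p → ℕ.≤-trans ℕ.pred[n]≤n (ℕ.≤-trans p (ℕ.m≤m+n a _)))
          (All.tail bounded))))))
    (skewHook-isSkewHook , size-skewHook st ,
     trans (cong (count 2) (columnSizes-skewHook st)) (trans (count-++ 2 (initColumns o) [ 1 ])
       (trans (ℕ.+-identityʳ _) (count-initColumns st))) ,
     subst (All _) (sym (columnSizes-skewHook st)) (All.++⁺ (all-initColumns st) (inj₁ refl ∷ [])) ,
     trans (cong last (columnSizes-skewHook st)) (last-∷ʳ (initColumns o) 1))
    where
    bounded : All (_≤ a) o
    bounded = go dec
      where
      go : ∀ {x xs} → Decreasing (x ∷ xs) → All (_≤ x) (x ∷ xs)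
      go [-]       = ℕ.≤-refl ∷ []
      go (p ∷ dec) = ℕ.≤-refl ∷ All.map (λ q → ℕ.≤-trans q p) (go dec)

-- Every element of `hooks` comes from a strict partition

-- A step changes the row by at most one, so a path from row s or above to a row below s contains a
-- downward step from row s to row s + 1.
crossing : ∀ D s {x y} → x ∈ cells D → Star (Step D) x y → proj₁ x ≤ s → s < proj₁ y →
  ∃[ c ] (s , c) ∈ cells D × (suc s , c) ∈ cells D
crossing D s x∈ Star.ε p q = ⊥-elim (ℕ.<⇒≱ q p)
crossing D s {r , c} x∈ (_◅_ {j = r′ , c′} (adj , z∈) path) p q with r′ ℕ.≤? s
... | yes r′≤s = crossing D s z∈ path r′≤s q
... | no  r′≰s with adj
...   | inj₁ refl               = ⊥-elim (r′≰s p)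
...   | inj₂ (inj₁ refl)        = ⊥-elim (r′≰s p)
...   | inj₂ (inj₂ (inj₂ refl)) = ⊥-elim (r′≰s (ℕ.<⇒≤ p))
...   | inj₂ (inj₂ (inj₁ refl)) with refl ← ℕ.≤-antisym p (ℕ.s≤s⁻¹ (ℕ.≰⇒> r′≰s)) = c , x∈ , z∈

part-injective : ∀ {xs ys} → All (0 <_) xs → All (0 <_) ys → (∀ r → part xs r ≡ part ys r) → xs ≡ ys
part-injective []       []       eq = refl
part-injective []       (p ∷ ps) eq = ⊥-elim (ℕ.<⇒≢ p (eq 0))
part-injective (p ∷ ps) []       eq = ⊥-elim (ℕ.<⇒≢ p (sym (eq 0)))
part-injective (p ∷ ps) (q ∷ qs) eq = cong₂ _∷_ (eq 0) (part-injective ps qs (eq ∘ suc))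

two-members : ∀ {a} {A : Set a} {x y : A} {xs} → x ∈ xs → y ∈ xs → ¬ x ≡ y → 2 ≤ length xs
two-members (here refl) (here refl) ne = ⊥-elim (ne refl)
two-members {xs = _ ∷ _ ∷ _} p q ne = s≤s (s≤s z≤n)
two-members {xs = _ ∷ []} (here _) (there ()) ne
two-members {xs = _ ∷ []} (there ()) q ne

three-members : ∀ {a} {A : Set a} {x y z : A} {xs} → x ∈ xs → y ∈ xs → z ∈ xs →
  ¬ x ≡ y → ¬ x ≡ z → ¬ y ≡ z → 3 ≤ length xs
three-members (here refl) (here refl) _           xy xz yz = ⊥-elim (xy refl)
three-members (here refl) (there q)   (here refl) xy xz yz = ⊥-elim (xz refl)
three-members (here refl) (there q)   (there r)   xy xz yz = s≤s (two-members q r yz)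
three-members (there p)   (here refl) (here refl) xy xz yz = ⊥-elim (yz refl)
three-members (there p)   (here refl) (there r)   xy xz yz = s≤s (two-members p r xz)
three-members (there p)   (there q)   (here refl) xy xz yz = s≤s (two-members p q xy)
three-members (there p)   (there q)   (there r)   xy xz yz = ℕ.m≤n⇒m≤1+n (three-members p q r xy xz yz)

strict⁺ : ∀ {a o} → All (0 <_) (a ∷ o) → (∀ r → suc r < length (a ∷ o) → part (a ∷ o) (suc r) < part (a ∷ o) r) →
  Strict (a ∷ o)
strict⁺ {o = []}    (p ∷ [])  lt = single p
strict⁺ {o = b ∷ o} (p ∷ ps)  lt = lt 0 (s≤s (s≤s z≤n)) ∷ strict⁺ ps (λ r q → lt (suc r) (s≤s q))

module FromHook {n k o i} (D∈ : InHooks n k (o / i)) where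
  private
    D = o / i
    hook = proj₁ D∈
    decᵒ = proj₁ (proj₁ (proj₁ hook))
    posᵒ = proj₂ (proj₁ (proj₁ hook))
    decⁱ = proj₁ (proj₁ (proj₂ (proj₁ hook)))
    posⁱ = proj₂ (proj₁ (proj₂ (proj₁ hook)))
    fits = proj₂ (proj₂ (proj₁ hook))
    normal = proj₁ (proj₂ hook)
    connected = proj₁ (proj₂ (proj₂ hook))
    noSquare = proj₂ (proj₂ (proj₂ hook))
    columns = proj₁ (proj₂ (proj₂ (proj₂ D∈)))
    lastColumn = proj₂ (proj₂ (proj₂ (proj₂ D∈)))

    firstColumn : ∃[ r ] (r , 0) ∈ cells D
    firstColumn with (r , _) , x∈ , refl ← find (proj₂ normal) = r , x∈

    topRow : ∃[ c ] (0 , c) ∈ cells D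
    topRow with (_ , c) , x∈ , refl ← find (proj₁ normal) = c , x∈

    row< : ∀ {r c} → (r , c) ∈ cells D → r < length o
    row< p = ℕ.≰⇒> λ len → ℕ.n≮0 (subst (_ <_) (part-beyond o len) (proj₂ (∈-cells⁻ D p)))

    -- Normalisation enters here: the row of a cell in column 0 has inner part 0, and so has every
    -- row below it.
    inner-last : ∀ {r} → length o ≤ suc r → part i r ≡ 0
    inner-last {r} len with r₀ , x∈ ← firstColumn = ℕ.n≤0⇒n≡0 (ℕ.≤-trans
      (part-antitone decⁱ (ℕ.s≤s⁻¹ (ℕ.≤-trans (row< x∈) len))) (proj₁ (∈-cells⁻ D x∈)))

    bottom : ∀ {s} → suc s < length o → ∃[ y ] y ∈ cells D × s < proj₁ y
    bottom {s} lt = (pred (length o) , 0) ,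
      ∈-cells⁺ D (ℕ.≤-reflexive (inner-last (ℕ.≤-reflexive (sym suc-pred))))
        (part-positive posᵒ (ℕ.≤-reflexive suc-pred)) ,
      ℕ.s≤s⁻¹ (subst (suc s <_) (sym suc-pred) lt)
      where
      suc-pred : suc (pred (length o)) ≡ length o
      suc-pred = ℕ.suc-pred (length o) {{ℕ.>-nonZero (ℕ.≤-<-trans z≤n lt)}}

    -- Connectedness enters here: a path from the top row to the bottom row has to cross from row s
    -- to row s + 1 in a common column.
    overlapping : ∀ {s} → suc s < length o → part i s < part o (suc s)
    overlapping {s} lt with c₀ , x∈ ← topRow | y , y∈ , s<y ← bottom lt
      with c , p , q ← crossing D s x∈ (All.lookup (All.lookup connected x∈) y∈) z≤n s<y =
      ℕ.≤-<-trans (proj₁ (∈-cells⁻ D p)) (proj₂ (∈-cells⁻ D q))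

    -- If the two rows shared more than one column, there would be a square at the first cell of row
    -- s.
    corner≤ : ∀ {s} → suc s < length o → part o (suc s) ≤ suc (part i s)
    corner≤ {s} lt = ℕ.≮⇒≥ λ wide → All.lookup noSquare
      (a wide) (a wide , b wide ,
        ∈-cells⁺ D (part-suc decⁱ s) (ℕ.<⇒≤ wide) ,
        ∈-cells⁺ D (ℕ.m≤n⇒m≤1+n (part-suc decⁱ s)) wide)
      where
      a : suc (part i s) < part o (suc s) → (s , part i s) ∈ cells D
      a wide = ∈-cells⁺ D ℕ.≤-refl (ℕ.<-≤-trans (ℕ.<⇒≤ wide) (part-suc decᵒ s))
      b : suc (part i s) < part o (suc s) → (s , suc (part i s)) ∈ cells D
      b wide = ∈-cells⁺ D (ℕ.n≤1+n _) (ℕ.<-≤-trans wide (part-suc decᵒ s))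

    inner-part : ∀ s → part i s ≡ pred (part o (suc s))
    inner-part s with suc s ℕ.<? length o
    ... | yes lt = ℕ.suc-injective (trans (ℕ.≤-antisym (overlapping lt) (corner≤ lt))
                     (sym (ℕ.suc-pred _ {{ℕ.>-nonZero (ℕ.≤-<-trans z≤n (overlapping lt))}})))
    ... | no  ge = trans (inner-last (ℕ.≮⇒≥ ge)) (cong pred (sym (part-beyond o (ℕ.≮⇒≥ ge))))

    ∈D : ∀ r c → pred (part o (suc r)) ≤ c → c < part o r → (r , c) ∈ cells D
    ∈D r c p q = ∈-cells⁺ D (subst (_≤ c) (sym (inner-part r)) p) q

    inColumn : ∀ r c → (r , c) ∈ cells D → (r , c) ∈ filter (λ x → proj₂ x ℕ.≟ c) (cells D)
    inColumn r c p = ∈-filter⁺ (λ x → proj₂ x ℕ.≟ c) p refl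

    lastColumnSize : ∀ {a} → part o 0 ≡ suc a → columnCount (cells D) a ≡ 1
    lastColumnSize {a} eq = Maybe.just-injective (trans (sym (last-∷ʳ (map (columnCount (cells D)) (upTo a)) _))
      (trans (cong last (sym (trans (cong (map (columnCount (cells D)))
          (trans (cong upTo eq) (sym (applyUpTo-∷ʳ id a))))
        (map-++ (columnCount (cells D)) (upTo a) [ a ])))) lastColumn))

    columnSize≤2 : ∀ {c} → c < part o 0 → columnCount (cells D) c ≤ 2
    columnSize≤2 {c} p with All.lookup columns (∈-map⁺ (columnCount (cells D)) (∈-upTo⁺ p))
    ... | inj₁ eq = ℕ.≤-trans (ℕ.≤-reflexive eq) (s≤s z≤n)
    ... | inj₂ eq = ℕ.≤-reflexive eq

    -- Suppose rows r and r + 1 end in the same column. For r = 0 it is the last column, which has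
    -- size 1. Otherwise row r - 1 starts in that very column and gives it a third cell.
    strictly : ∀ r → suc r < length o → part o (suc r) < part o r
    strictly r lt = ℕ.≤∧≢⇒< (part-suc decᵒ r) λ eq → clash r lt eq
      where
      clash : ∀ r → suc r < length o → part o (suc r) ≡ part o r → ⊥
      clash r lt eq = refute r refl
        where
        c = pred (part o (suc r))
        suc-c : suc c ≡ part o (suc r)
        suc-c = ℕ.suc-pred _ {{ℕ.>-nonZero (part-positive posᵒ lt)}}
        c< : c < part o (suc r)
        c< = ℕ.≤-reflexive suc-c
        lower : (suc r , c) ∈ cells D
        lower = ∈D (suc r) c (ℕ.pred-mono-≤ (part-suc decᵒ (suc r))) c<
        upper : (r , c) ∈ cells D
        upper = ∈D r c ℕ.≤-refl (subst (c <_) eq c<)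
        refute : ∀ s → r ≡ s → ⊥
        refute zero    refl = ℕ.<⇒≱ (two-members (inColumn 0 c upper) (inColumn 1 c lower) λ ())
          (ℕ.≤-reflexive (lastColumnSize (trans (sym eq) (sym suc-c))))
        refute (suc s) refl = ℕ.<⇒≱
          (three-members (inColumn s c (∈D s c (ℕ.≤-reflexive (cong pred (sym eq)))
              (ℕ.<-≤-trans (subst (c <_) eq c<) (part-suc decᵒ s))))
            (inColumn (suc s) c upper) (inColumn (2 ℕ.+ s) c lower)
            (λ e → ℕ.1+n≢n (sym (cong proj₁ e))) (λ e → ℕ.<⇒≢ (ℕ.m<n+m s {2} (s≤s z≤n)) (cong proj₁ e))
            (λ e → ℕ.1+n≢n (sym (cong proj₁ e))))
          (columnSize≤2 (ℕ.<-≤-trans c< (part-antitone decᵒ z≤n)))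

    go : ∀ o′ → o ≡ o′ → ∃[ a ] ∃[ o′ ] o ≡ a ∷ o′
    go []       refl = ⊥-elim (ℕ.n≮0 (row< (proj₂ topRow)))
    go (a ∷ o′) refl = a , o′ , refl

  outer-strict : Strict o
  outer-strict with a , o′ , refl ← go o refl = strict⁺ posᵒ strictly

  isSkewHook⇒skewHook : o / i ≡ skewHook o
  isSkewHook⇒skewHook = cong (o /_) (part-injective posⁱ (All.all-filter (0 ℕ.<?_) (map pred (drop 1 o)))
    (λ r → trans (inner-part r) (sym (part-hookInner outer-strict r))))

-- Skew hooks and step sequences

record HookShape (n k : ℕ) (o : List ℕ) : Set where
  constructor hookShape
  field
    strict : Strict o
    rowCount : length o ≡ suc k
    cellCount : part o 0 ℕ.+ k ≡ n

-- The columns of size 2 are those shared by consecutive rows, so k of them mean k + 1 rows; and n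
-- cells then cover n - k columns, the length of the first row.
skewHook-shape : ∀ {n k} o → Strict o → size (skewHook o) ≡ n →
  count 2 (columnSizes (skewHook o)) ≡ k → HookShape n k o
skewHook-shape (a ∷ o) st refl refl = hookShape st (cong suc (sym k≡))
  (trans (cong (a ℕ.+_) k≡) (sym (size-skewHook st)))
  where
  k≡ : count 2 (columnSizes (skewHook (a ∷ o))) ≡ length o
  k≡ = trans (cong (count 2) (columnSizes-skewHook st))
    (trans (count-++ 2 (initColumns (a ∷ o)) [ 1 ])
      (trans (ℕ.+-identityʳ _) (count-initColumns st)))

∈-hooks⁻ : ∀ n k {D} → D ∈ hooks n k → HookShape n k (outer D) × skewHook (outer D) ≡ D
∈-hooks⁻ n k {o / i} D∈
  with h@(_ , sz , ct , _) ← proj₂ (∈-filter⁻ (inHooks? n k)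
         {xs = cartesianProductWith _/_ (boxPartitions n) (boxPartitions n)} D∈)
  with eq ← FromHook.isSkewHook⇒skewHook h =
  skewHook-shape o (FromHook.outer-strict h) (trans (cong size (sym eq)) sz)
    (trans (cong (count 2 ∘ columnSizes) (sym eq)) ct) ,
  sym eq

∈-hooks⁺ : ∀ {n k o} → HookShape n k o → skewHook o ∈ hooks n k
∈-hooks⁺ {n} {k} {a ∷ o} (hookShape st len eq) = skewHook-∈-hooks st n k
  (trans (cong (a ℕ.+_) (ℕ.suc-injective len)) eq) (ℕ.suc-injective len)

-- A north step opens a row whose only cell lies above the last cell of the row below, so both rows
-- end in the same column. The east step in front of it, present in every block, then makes the new
-- row end farther right.
outerOf : List Direction → List ℕ
outerOf []          = [ 1 ]
outerOf (east ∷ u)  = increment 0 (outerOf u)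
outerOf (north ∷ u) = part (outerOf u) 0 ∷ outerOf u

outerOf-east : ∀ {a o} → Strict (a ∷ o) → Strict (suc a ∷ o) × stepsOf (suc a ∷ o) ≡ east ∷ stepsOf (a ∷ o)
outerOf-east {suc a} (single p) = single (s≤s z≤n) , refl
outerOf-east {a} {b ∷ o} (b<a ∷ st) = ℕ.m<n⇒m<1+n b<a ∷ st ,
  cong (λ n → replicate n east ++ north ∷ stepsOf (b ∷ o)) (ℕ.+-∸-assoc 1 (ℕ.<⇒≤ b<a))

outerOf-shape : ∀ d j {u} → u ∈ steps d j → HookShape (suc d) j (outerOf u) × stepsOf (outerOf u) ≡ u
outerOf-shape zero    zero (here refl) = hookShape (single (s≤s z≤n)) refl refl , refl
outerOf-shape (suc d) j u∈ with ∈-++⁻ (map (east ∷_) (steps d j)) u∈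
... | inj₁ p with v , v∈ , refl ← ∈-map⁻ (east ∷_) p
             with outerOf v | outerOf-shape d j v∈
...   | a ∷ o | hookShape st len eq , refl with st′ , e ← outerOf-east st =
  hookShape st′ len (cong suc eq) , e
outerOf-shape (suc (suc d)) (suc j) u∈ | inj₂ p
  with v , v∈ , refl ← ∈-map⁻ (λ u → east ∷ north ∷ u) p
  with outerOf v | outerOf-shape d j v∈
...   | a ∷ o | hookShape st len eq , refl =
  hookShape (ℕ.n<1+n a ∷ st) (cong suc len) (cong suc (trans (ℕ.+-suc a j) (cong suc eq))) ,
  cong (λ n → replicate n east ++ north ∷ stepsOf (a ∷ o)) (ℕ.m+n∸n≡m 1 a)

private
  row-∈-steps : ∀ a → replicate a east ∈ steps a 0
  row-∈-steps zero    = here refl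
  row-∈-steps (suc a) = ∈-++⁺ˡ (∈-map⁺ (east ∷_) (row-∈-steps a))

  row-outerOf : ∀ a → outerOf (replicate a east) ≡ [ suc a ]
  row-outerOf zero    = refl
  row-outerOf (suc a) = cong (increment 0) (row-outerOf a)

  -- Of the suc e east steps, the one next to the north step belongs to its block; the other e are
  -- blocks of their own.
  upon-∈-steps : ∀ e d j u → u ∈ steps d j →
    replicate (suc e) east ++ north ∷ u ∈ steps (2 ℕ.+ e ℕ.+ d) (suc j)
  upon-∈-steps zero    d j u u∈ = ∈-++⁺ʳ (map (east ∷_) (steps (suc d) (suc j)))
    (∈-map⁺ (λ u → east ∷ north ∷ u) u∈)
  upon-∈-steps (suc e) d j u u∈ = ∈-++⁺ˡ (∈-map⁺ (east ∷_) (upon-∈-steps e d j u u∈))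

  upon-outerOf : ∀ e u {b o} → outerOf u ≡ b ∷ o →
    outerOf (replicate e east ++ north ∷ u) ≡ e ℕ.+ b ∷ b ∷ o
  upon-outerOf zero    u eq = cong₂ _∷_ (cong (λ o → part o 0) eq) eq
  upon-outerOf (suc e) u eq = cong (increment 0) (upon-outerOf e u eq)

stepsOf-shape : ∀ d j {o} → HookShape (suc d) j o → stepsOf o ∈ steps d j × outerOf (stepsOf o) ≡ o
stepsOf-shape d zero {suc a ∷ []} (hookShape (single p) len eq)
  with refl ← trans (sym (ℕ.+-identityʳ a)) (ℕ.suc-injective eq) = row-∈-steps a , row-outerOf a
stepsOf-shape d (suc j) {a ∷ zero ∷ o} (hookShape (_ ∷ st) len eq) =
  ⊥-elim (ℕ.<-irrefl refl (strict-positive st))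
stepsOf-shape d (suc j) {a ∷ suc b ∷ o} (hookShape (b<a ∷ st) len eq)
  with b∈ , back ← stepsOf-shape (b ℕ.+ j) j (hookShape st (ℕ.suc-injective len) refl) =
  subst₂ (λ n d → replicate n east ++ north ∷ stepsOf (suc b ∷ o) ∈ steps d (suc j)) (sym a∸b) d≡
    (upon-∈-steps e (b ℕ.+ j) j (stepsOf (suc b ∷ o)) b∈) ,
  trans (upon-outerOf (a ∸ suc b) (stepsOf (suc b ∷ o)) back)
    (cong (_∷ suc b ∷ o) (ℕ.m∸n+n≡m (ℕ.<⇒≤ b<a)))
  where
  e = pred (a ∸ suc b)
  a∸b : a ∸ suc b ≡ suc e
  a∸b = sym (ℕ.suc-pred (a ∸ suc b) {{ℕ.>-nonZero (ℕ.m<n⇒0<n∸m b<a)}})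
  d≡ : 2 ℕ.+ e ℕ.+ (b ℕ.+ j) ≡ d
  d≡ = ℕ.suc-injective (trans (sym (trans (cong (ℕ._+ suc j) a≡) arith)) eq)
    where
    a≡ : a ≡ suc e ℕ.+ suc b
    a≡ = trans (sym (ℕ.m∸n+n≡m (ℕ.<⇒≤ b<a))) (cong (ℕ._+ suc b) a∸b)
    arith : suc e ℕ.+ suc b ℕ.+ suc j ≡ suc (2 ℕ.+ e ℕ.+ (b ℕ.+ j))
    arith = shuffle e b j
      where
      shuffle : ∀ e b j → suc e ℕ.+ suc b ℕ.+ suc j ≡ suc (2 ℕ.+ e ℕ.+ (b ℕ.+ j))
      shuffle = solve-∀

mutual
  steps-unique : ∀ d j → Unique (steps d j)
  steps-unique zero    zero    = [] ∷ []
  steps-unique zero    (suc j) = []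
  steps-unique (suc d) j       = Unique.++⁺ (Unique.map⁺ (proj₂ ∘ ∷-injective) (steps-unique d j))
    (blocks-unique d j) (disjoint d j)
    where
    -- The decomposition into blocks is unique: no sequence of blocks starts with a north step, so
    -- the letter after the first "east" decides to which block it belongs.
    disjoint : ∀ d j {u} → u ∈ map (east ∷_) (steps d j) × u ∈ blocks d j → ⊥
    disjoint (suc d) (suc j) (p , q)
      with v , v∈ , refl ← ∈-map⁻ (east ∷_) p
      with w , w∈ , refl ← ∈-map⁻ (λ u → east ∷ north ∷ u) q = notNorth (suc d) (suc j) v∈
      where
      notNorth : ∀ d j {w} → ¬ north ∷ w ∈ steps d j
      notNorth zero    zero    (here ())
      notNorth (suc d) j       p with ∈-++⁻ (map (east ∷_) (steps d j)) p
      ... | inj₁ q with _ , _ , () ← ∈-map⁻ (east ∷_) q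
      notNorth (suc (suc d)) (suc j) p | inj₂ q with _ , _ , () ← ∈-map⁻ (λ u → east ∷ north ∷ u) q

  blocks-unique : ∀ d j → Unique (blocks d j)
  blocks-unique zero    j       = []
  blocks-unique (suc d) zero    = []
  blocks-unique (suc d) (suc j) =
    Unique.map⁺ (proj₂ ∘ ∷-injective ∘ proj₂ ∘ ∷-injective) (steps-unique d j)

module HookSums {c ℓ₁ ℓ₂} (K : CommutativeRing c ℓ₁)
                (_≤ᴷ_ : Rel (CommutativeRing.Carrier K) ℓ₂) where

  open FiniteSums K
  open RibbonSeries K using (ribbon)
  open HookSeries K _≤ᴷ_
  private module SF = SymmetricFunctions rawRing _≤ᴷ_

  seriesSum : ∀ {a} {A : Set a} (xs : List A) f α →
    Sums.∑ SF.seriesRing xs f α ≡ ∑ xs (λ x → f x α)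
  seriesSum []       f α = refl
  seriesSum (x ∷ xs) f α = cong (f x α +_) (seriesSum xs f α)

  γ-ribbons : ∀ d j α → SF.γ (suc d) j α ≈ ∑ (steps d j) (λ u → ribbon u α)
  γ-ribbons d j α = begin
    SF.γ (suc d) j α ≡⟨ seriesSum (hooks (suc d) j) SF.skewSchur α ⟩
    ∑ (hooks (suc d) j) (λ D → SF.skewSchur D α)
      ≈⟨ ∑-bij (stepsOf ∘ outer) (skewHook ∘ outerOf) (hooks-unique (suc d) j) (steps-unique d j)
           to from value ⟩
    ∑ (steps d j) (λ u → ribbon u α) ∎
    where
    to : ∀ {D} → D ∈ hooks (suc d) j → stepsOf (outer D) ∈ steps d j × skewHook (outerOf (stepsOf (outer D))) ≡ D
    to D∈ with sh , eq ← ∈-hooks⁻ (suc d) j D∈ with u∈ , back ← stepsOf-shape d j sh =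
      u∈ , trans (cong skewHook back) eq
    from : ∀ {u} → u ∈ steps d j → skewHook (outerOf u) ∈ hooks (suc d) j × stepsOf (outerOf u) ≡ u
    from u∈ with sh , back ← outerOf-shape d j u∈ = ∈-hooks⁺ sh , back
    value : ∀ {D} → D ∈ hooks (suc d) j → SF.skewSchur D α ≈ ribbon (stepsOf (outer D)) α
    value {D} D∈ with sh , eq ← ∈-hooks⁻ (suc d) j D∈ = ≈-trans
      (reflexive (cong (λ E → SF.skewSchur E α) (sym eq)))
      (skewSchur-hook (HookShape.strict sh) α)

-- Schur-γ-positivity

d<2*suc⌊d/2⌋ : ∀ d → d < 2 ℕ.* suc ⌊ d /2⌋
d<2*suc⌊d/2⌋ zero          = s≤s z≤n
d<2*suc⌊d/2⌋ (suc zero)    = s≤s (s≤s z≤n)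
d<2*suc⌊d/2⌋ (suc (suc d)) = subst (2 ℕ.+ d <_) (cong suc (sym (ℕ.+-suc (suc ⌊ d /2⌋) _)))
  (s≤s (s≤s (d<2*suc⌊d/2⌋ d)))

length-steps : ∀ d j {u} → u ∈ steps d j → length u ≡ d
length-steps zero    zero (here refl) = refl
length-steps (suc d) j u∈ with ∈-++⁻ (map (east ∷_) (steps d j)) u∈
... | inj₁ p with _ , v∈ , refl ← ∈-map⁻ (east ∷_) p = cong suc (length-steps d j v∈)
length-steps (suc (suc d)) (suc j) u∈ | inj₂ p
  with _ , v∈ , refl ← ∈-map⁻ (λ u → east ∷ north ∷ u) p = cong (suc ∘ suc) (length-steps d j v∈)

sum-positiveParts : ∀ ν → ℕ.sum (positiveParts ν) ≡ ℕ.sum ν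
sum-positiveParts []          = refl
sum-positiveParts (zero ∷ ν)  = sum-positiveParts ν
sum-positiveParts (suc n ∷ ν) = cong (suc n ℕ.+_) (sum-positiveParts ν)

length≤sum : ∀ {xs} → All (0 <_) xs → length xs ≤ ℕ.sum xs
length≤sum []       = z≤n
length≤sum (p ∷ ps) = ℕ.+-mono-≤ p (length≤sum ps)

positiveParts-∈-box : ∀ {ν n} → Decreasing ν → ℕ.sum ν ≡ n → positiveParts ν ∈ boxPartitions n
positiveParts-∈-box {ν} dec refl = ∈-boxPartitions⁺ (ℕ.sum ν)
  (Linked.filter⁺ (0 ℕ.<?_) (λ p q → ℕ.≤-trans q p) dec , pos)
  (subst (length (positiveParts ν) ≤_) (sum-positiveParts ν) (length≤sum pos))
  (subst (λ n → All (_≤ n) (positiveParts ν)) (sum-positiveParts ν)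
    (All.map ℕ.s≤s⁻¹ (all≤sum (positiveParts ν))))
  where pos = All.all-filter (0 ℕ.<?_) ν

module Expansion {c ℓ₁ ℓ₂} (K : CommutativeRing c ℓ₁)
                 (_≤ᴷ_ : Rel (CommutativeRing.Carrier K) ℓ₂) where

  open FiniteSums K
  open RibbonSeries K using (ribbon)
  open Coefficients K
  open PolynomialCoefficients K _≤ᴷ_
  open RibbonExpansion K _≤ᴷ_
  open HookSums K _≤ᴷ_
  open SF using (coeff; IsSymmetricFunction)

  coeff-Q : ∀ {Q} → SF.IsQ Q → ∀ d k α → coeff (Q (suc d)) k α ≈
    ∑≤ ⌊ d /2⌋ λ j → τ j (binomial (d ∸ 2 ℕ.* j) (SF.γ (suc d) j α)) k
  coeff-Q {Q} isQ d k α = begin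
    coeff (Q (suc d)) k α ≈⟨ IsQ⇒ribbonSum isQ (suc d) k α ⟩
    weighted d (λ u → ribbon u α) k
      ≈⟨ weighted≈binomials d ⌊ d /2⌋ (d<2*suc⌊d/2⌋ d) (λ u → ribbon u α) k ⟨
    _ ≈⟨ ∑-cong-ext (upTo (suc ⌊ d /2⌋)) (λ j → τ-cong j k λ k →
           binomial-cong (d ∸ 2 ℕ.* j) k (≈-sym (γ-ribbons d j α))) ⟩
    _ ∎

  Q≈γ-expansion : ∀ {Q} → SF.IsQ Q → ∀ d → Q (suc d) SF.Poly.≈ SF.γ-expansion d (SF.γ (suc d))
  Q≈γ-expansion isQ d k α =
    ≈-trans (coeff-Q isQ d k α) (≈-sym (coeff-γ-expansion d (SF.γ (suc d)) k α))

  symmetric-resp : ∀ {f g} → (∀ α → f α ≈ g α) → IsSymmetricFunction f → IsSymmetricFunction g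
  symmetric-resp eq sym = record
    { trailing-zero = λ α → ≈-trans (≈-sym (eq _)) (≈-trans (S.trailing-zero α) (eq α))
    ; symmetric     = λ p → ≈-trans (≈-sym (eq _)) (≈-trans (S.symmetric p) (eq _))
    ; bounded       = proj₁ S.bounded , λ α p → ≈-trans (≈-sym (eq α)) (proj₂ S.bounded α p)
    }
    where module S = IsSymmetricFunction sym

  symmetric-map : ∀ {f} (L : Carrier → Carrier) → (∀ {x y} → x ≈ y → L x ≈ L y) → L 0# ≈ 0# →
    IsSymmetricFunction f → IsSymmetricFunction (L ∘ f)
  symmetric-map L L-cong L-zero sym = record
    { trailing-zero = λ α → L-cong (S.trailing-zero α)
    ; symmetric     = λ p → L-cong (S.symmetric p)
    ; bounded       = proj₁ S.bounded , λ α p → ≈-trans (L-cong (proj₂ S.bounded α p)) L-zero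
    }
    where module S = IsSymmetricFunction sym

  symmetric-0 : IsSymmetricFunction (λ _ → 0#)
  symmetric-0 = record
    { trailing-zero = λ _ → ≈-refl ; symmetric = λ _ → ≈-refl ; bounded = 0 , λ _ _ → ≈-refl }

  symmetric-+ : ∀ {f g} → IsSymmetricFunction f → IsSymmetricFunction g →
    IsSymmetricFunction (λ α → f α + g α)
  symmetric-+ sym₁ sym₂ = record
    { trailing-zero = λ α → +-cong (S₁.trailing-zero α) (S₂.trailing-zero α)
    ; symmetric     = λ p → +-cong (S₁.symmetric p) (S₂.symmetric p)
    ; bounded       = d₁ ℕ.⊔ d₂ , λ α p → ≈-trans
        (+-cong (proj₂ S₁.bounded α (ℕ.≤-<-trans (ℕ.m≤m⊔n d₁ d₂) p))
                (proj₂ S₂.bounded α (ℕ.≤-<-trans (ℕ.m≤n⊔m d₁ d₂) p))) (+-identityˡ 0#)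
    }
    where
    module S₁ = IsSymmetricFunction sym₁
    module S₂ = IsSymmetricFunction sym₂
    d₁ = proj₁ S₁.bounded
    d₂ = proj₁ S₂.bounded

  symmetric-∑ : ∀ {a} {A : Set a} (xs : List A) {f : A → SF.Series} →
    (∀ {x} → x ∈ xs → IsSymmetricFunction (f x)) → IsSymmetricFunction (λ α → ∑ xs λ x → f x α)
  symmetric-∑ []       sym = symmetric-0
  symmetric-∑ (x ∷ xs) sym = symmetric-+ (sym (here refl)) (symmetric-∑ xs (sym ∘ there))

  symmetric-coeff : ∀ {p} → All IsSymmetricFunction p → ∀ k → IsSymmetricFunction (coeff p k)
  symmetric-coeff []         k       = symmetric-0
  symmetric-coeff (sym ∷ al) zero    = sym
  symmetric-coeff (sym ∷ al) (suc k) = symmetric-coeff al k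

  τ-< : ∀ f {m k} → k < m → τ m f k ≈ 0#
  τ-< f {suc m} {zero}  p       = ≈-refl
  τ-< f {suc m} {suc k} (s≤s p) = τ-< f p

  τ-diagonal : ∀ f m → τ m f m ≈ f 0
  τ-diagonal f zero    = ≈-refl
  τ-diagonal f (suc m) = τ-diagonal f m

  binomial-0 : ∀ e x → binomial e x 0 ≈ x
  binomial-0 zero    x = ≈-refl
  binomial-0 (suc e) x = ≈-trans (+-identityʳ _) (binomial-0 e x)

  ∑-truncate : ∀ {k J} F → k ≤ J → (∀ i → k < i → F i ≈ 0#) → ∑≤ J F ≈ ∑≤ k F
  ∑-truncate {k} {J} F k≤J vanish with ℕ.m≤n⇒m<n∨m≡n k≤J
  ... | inj₂ refl = ≈-refl
  ∑-truncate {k} {suc J} F k≤J vanish | inj₁ k<J = begin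
    ∑≤ (suc J) F         ≈⟨ ∑-upTo-last (suc J) F ⟩
    ∑≤ J F + F (suc J)   ≈⟨ +-cong (∑-truncate F (ℕ.s≤s⁻¹ k<J) vanish) (vanish (suc J) k<J) ⟩
    ∑≤ k F + 0#          ≈⟨ +-identityʳ _ ⟩
    ∑≤ k F               ∎

  -- The γ's are obtained from the coefficients of Q by solving a unitriangular
  -- system.
  γ-symmetric : ∀ {Q} → SF.IsQ Q → ∀ d k → k ≤ ⌊ d /2⌋ → IsSymmetricFunction (SF.γ (suc d) k)
  γ-symmetric {Q} isQ d = <-rec _ λ k IH → step k (λ i i<k → IH {i} i<k)
    where
    -- The coefficient of t^k in x t^i (1 + t)^(d - 2i): zero for i > k, and x itself for i = k.
    L : ℕ → ℕ → Carrier → Carrier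
    L k i x = τ i (binomial (d ∸ 2 ℕ.* i) x) k
    step : ∀ k → (∀ i → i < k → i ≤ ⌊ d /2⌋ → IsSymmetricFunction (SF.γ (suc d) i)) →
      k ≤ ⌊ d /2⌋ → IsSymmetricFunction (SF.γ (suc d) k)
    step k IH k≤ = symmetric-resp solve (symmetric-+
      (symmetric-coeff (SF.IsQ.coefficients∈Λ isQ (suc d)) k)
      (symmetric-map -_ -‿cong -0#≈0# (symmetric-∑ (upTo k) λ {i} i∈ → symmetric-map (L k i)
        (λ p → τ-cong i k λ k → binomial-cong (d ∸ 2 ℕ.* i) k p)
        (τ-zero i k λ k → binomial-zero (d ∸ 2 ℕ.* i) k ≈-refl)
        (IH i (∈-upTo⁻ i∈) (ℕ.≤-trans (ℕ.<⇒≤ (∈-upTo⁻ i∈)) k≤)))))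
      where
      S = λ α → ∑ (upTo k) λ i → L k i (SF.γ (suc d) i α)
      solve : ∀ α → coeff (Q (suc d)) k α - S α ≈ SF.γ (suc d) k α
      solve α = begin
        coeff (Q (suc d)) k α - S α ≈⟨ +-congʳ (coeff-Q isQ d k α) ⟩
        ∑≤ ⌊ d /2⌋ (λ i → L k i (SF.γ (suc d) i α)) - S α
          ≈⟨ +-congʳ (∑-truncate _ k≤ λ i k<i → τ-< _ k<i) ⟩
        ∑≤ k (λ i → L k i (SF.γ (suc d) i α)) - S α
          ≈⟨ +-congʳ (≈-trans (∑-upTo-last k _) (+-comm _ _)) ⟩
        (L k k (SF.γ (suc d) k α) + S α) - S α ≈⟨ +-assoc _ _ _ ⟩
        L k k (SF.γ (suc d) k α) + (S α - S α) ≈⟨ +-congˡ (-‿inverseʳ _) ⟩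
        L k k (SF.γ (suc d) k α) + 0# ≈⟨ +-identityʳ _ ⟩
        L k k (SF.γ (suc d) k α)
          ≈⟨ ≈-trans (τ-diagonal _ k) (binomial-0 (d ∸ 2 ℕ.* k) _) ⟩
        SF.γ (suc d) k α ∎

  -- Listed with repetitions, as the multiplicity of a shape becomes its coefficient. Zero rows are
  -- dropped because `boxPartitions` contains only partitions with positive parts.
  shapes : ℕ → ℕ → List (List ℕ)
  shapes d j = concatMap (λ u → map (positiveParts ∘ proj₂) (chains u)) (steps d j)

  shapes-∈-box : ∀ d j {λs} → λs ∈ shapes d j → λs ∈ boxPartitions (suc d)
  shapes-∈-box d j λs∈
    with u , u∈ , q ← find (∈-concatMap⁻ (λ u → map (positiveParts ∘ proj₂) (chains u)) {steps d j} λs∈)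
    with s , s∈ , refl ← ∈-map⁻ (positiveParts ∘ proj₂) q
    with state dec _ total ← chains-state u s∈ =
    positiveParts-∈-box dec (trans total (cong suc (length-steps d j u∈)))

  γ-schur : ∀ d j α → SF.γ (suc d) j α ≈ ∑ (shapes d j) (λ λs → SF.schur λs α)
  γ-schur d j α = begin
    SF.γ (suc d) j α ≈⟨ γ-ribbons d j α ⟩
    ∑ (steps d j) (λ u → ribbon u α)
      ≈⟨ ∑-cong-ext (steps d j) (λ u → begin
           ribbon u α ≈⟨ ribbon-schur u α ⟩
           ∑ (chains u) (λ (_ , ν) → SF.schur ν α)
             ≈⟨ ∑-cong (chains u) (λ {s} s∈ → reflexive (sym (skewSchur-cells
                  (positiveParts (proj₂ s) / []) (proj₂ s / [])
                  (cells-positiveParts (State.decreasing (chains-state u s∈))) α))) ⟩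
           _ ≡⟨ ∑-map (positiveParts ∘ proj₂) (chains u) (λ λs → SF.schur λs α) ⟨
           ∑ (map (positiveParts ∘ proj₂) (chains u)) (λ λs → SF.schur λs α) ∎) ⟩
    _ ≈⟨ ∑-concatMap (λ u → map (positiveParts ∘ proj₂) (chains u)) (steps d j) _ ⟨
    ∑ (shapes d j) (λ λs → SF.schur λs α) ∎

  multiplicity : List ℕ → List (List ℕ) → ℕ
  multiplicity λs P = length (filter (List-≡-dec ℕ._≟_ λs) P)

  -- Each term is written as a sum over the box against a Kronecker delta, and the two sums are
  -- exchanged.
  collect : ∀ N P (F : List ℕ → Carrier) → (∀ {λs} → λs ∈ P → λs ∈ boxPartitions N) →
    ∑ P F ≈ ∑ (boxPartitions N) (λ λs → (multiplicity λs P · 1#) * F λs)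
  collect N P F P⊆ = begin
    ∑ P F ≈⟨ ∑-cong P (λ {μ} μ∈ → ≈-sym (≈-trans
      (∑-single (boxPartitions-unique N) (P⊆ μ∈) λ {λs} _ λs≢μ → ≈-trans
        (*-congʳ (reflexive (cong (if_then 1# else 0#) (dec-false (List-≡-dec ℕ._≟_ λs μ) λs≢μ)))) (zeroˡ _))
      (≈-trans (*-congʳ (reflexive (cong (if_then 1# else 0#) (dec-true (List-≡-dec ℕ._≟_ μ μ) refl))))
        (*-identityˡ _)))) ⟩
    ∑ P (λ μ → ∑ box λ λs → (if does (List-≡-dec ℕ._≟_ λs μ) then 1# else 0#) * F λs)
      ≈⟨ ∑-comm P box _ ⟩
    ∑ box (λ λs → ∑ P λ μ → (if does (List-≡-dec ℕ._≟_ λs μ) then 1# else 0#) * F λs)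
      ≈⟨ ∑-cong-ext box (λ λs → ≈-trans (≈-sym (*-distribʳ-∑ P (F λs) _)) (*-congʳ (≈-trans
           (≈-sym (∑-filter (List-≡-dec ℕ._≟_ λs) P (λ _ → 1#)))
           (∑-const (filter (List-≡-dec ℕ._≟_ λs) P) 1#)))) ⟩
    ∑ box (λ λs → (multiplicity λs P · 1#) * F λs) ∎
    where box = boxPartitions N

  -- The Schur coefficients are multiplicities, so what positivity asks of the ring is that the
  -- natural multiples of 1 are nonnegative.
  Q-schurγPositive : (∀ m → 0# ≤ᴷ (m · 1#)) → ∀ {Q} → SF.IsQ Q → ∀ d → SF.SchurγPositive (Q (suc d))
  Q-schurγPositive ·1-nonneg isQ d = d , SF.γ (suc d) ,
    (λ k k≤ → γ-symmetric isQ d k k≤ , suc d , (λ λs → multiplicity λs (shapes d k) · 1#) ,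
      (λ λs → ·1-nonneg (multiplicity λs (shapes d k))) ,
      λ α → ≈-trans (γ-schur d k α) (≈-trans
        (collect (suc d) (shapes d k) (λ λs → SF.schur λs α) (shapes-∈-box d k))
        (reflexive (sym (seriesSum (boxPartitions (suc d)) _ α))))) ,
    Q≈γ-expansion isQ d

open Expansion ℝ-commutativeRing _≤ᴿ_
open FiniteSums ℝ-commutativeRing using (_·_)

·1-nonneg : ∀ m → fromℚ 0ℚ ≤ᴿ (m · fromℚ 1ℚ)
·1-nonneg m ε 0<ε = 0 , λ n _ → ℚ.+-mono-≤ (nonneg m n) (ℚ.<⇒≤ 0<ε)
  where
  nonneg : ∀ m n → 0ℚ ℚ.≤ seq (m · fromℚ 1ℚ) n
  nonneg zero    n = ℚ.≤-refl
  nonneg (suc m) n = ℚ.+-mono-≤ (ℚ.<⇒≤ (ℚ.positive⁻¹ 1ℚ)) (nonneg m n)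

corollary3p2 : (Q : ℕ → Polynomial) → IsQ Q → (n : ℕ) → 1 ≤ n →
    (Q n Poly.≈ γ-expansion (n ∸ 1) (γ n)) × SchurγPositive (Q n)
corollary3p2 Q isQ (suc d) _ = Q≈γ-expansion isQ d , Q-schurγPositive ·1-nonneg isQ d
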